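{- Let $\mathcal{F} = \{H,T\} \cup \{\mathrm{F}_n \mid n\ge 1\}$ and $\mathcal{F}' = \{H,T\} \cup \{\mathrm{F}_n \mid n\ge 1\} \cup \{\mathrm{T}_n \mid n\ge 1\}$. For each of the two gate families $\mathcal{G}\in\{\mathcal{F},\mathcal{F}'\}$ there exists a family of quantum circuits $\{U_{n,d}\}_{n,d>0}$ that is depth-universal over $\mathcal{G}$. Moreover, $U_{n,d}$ uses $O(n^2 d)$ qubits, and the family can be constructed log-space uniformly in $n$ and $d$.
   Context: Gates: $H$ is the Hadamard gate and $T=\mathrm{diag}(1,e^{i\pi/4})$ is the $\pi/8$ gate. For $n\ge1$, the fanout gate $\mathrm{F}_n$ acts on $n+1$ qubits by $\lvert c,t_1,\ldots,t_n\rangle \mapsto \lvert c, c\oplus t_1,\ldots,c\oplus t_n\rangle$ on computational basis states (extended linearly); $\mathrm{F}_1$ is CNOT. The unbounded Toffoli gate $\mathrm{T}_n$ acts on $n+1$ qubits by $\lvert c_1,\ldots,c_n,t\rangle\mapsto \lvert c_1,\ldots,c_n, t\oplus \bigwedge_{i=1}^n c_i\rangle$. The depth of a circuit is the number of layers, where a layer is a set of gates acting simultaneously on pairwise disjoint sets of qubits. Universal circuit: fix $n>0$ and a collection $\mathcal{C}$ of quantum circuits on $n$ qubits. A quantum circuit $U$ on $n+m$ qubits (possibly plus ancilla qubits initialized to and returned to $\lvert 0\rangle$) is universal for $\mathcal{C}$ if for every $C\in\mathcal{C}$ there is a string $x\in\{0,1\}^m$ (the encoding) such that for all $y\in\{0,1\}^n$,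 $U(\lvert y\rangle\otimes\lvert x\rangle) = C\lvert y\rangle\otimes\lvert x\rangle$. Depth-universal: for a family $\mathcal{G}$ of unitary gates, a family $\{U_{n,d}\}_{n,d>0}$ is depth-universal over $\mathcal{G}$ if (1) $U_{n,d}$ is universal for the collection of $n$-qubit circuits of depth at most $d$ using gates from $\mathcal{G}$; (2) $U_{n,d}$ uses only gates from $\mathcal{G}$; (3) $U_{n,d}$ has depth $O(d)$; (4) the number $m$ of encoding qubits of $U_{n,d}$ is polynomial in $n$ and $d$. -}

module Defs where

open import Data.Bool using (Bool; true; false; if_then_else_; _xor_; _∧_; not)
open import Data.Nat using (ℕ; zero; suc; _+_; _*_; _∸_; _^_; _≤_; _≡ᵇ_)
open import Data.Nat.Logarithm using (⌈log₂_⌉)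
open import Data.Integer using (ℤ) renaming (_+_ to _+ℤ_; -_ to -ℤ_; _-_ to _-ℤ_)
import Data.Integer as ℤ
open import Data.Fin using (Fin; toℕ)
open import Data.Vec using (Vec; []; _∷_; lookup; _[_]≔_; take; drop; replicate)
import Data.Vec as Vec
open import Data.Vec.Properties using (≡-dec)
import Data.Bool.Properties as BoolP
open import Data.List using (List; []; _∷_; _++_; length; foldr; concatMap)
import Data.List as List
open import Data.List.Relation.Unary.Unique.Propositional using (Unique)
open import Data.Maybe using (Maybe; just; nothing)
open import Data.Product using (Σ; _×_; _,_; proj₁; proj₂)
open import Relation.Nullary using (yes; no)
open import Relation.Binary.PropositionalEquality using (_≡_)

-- Exact amplitudes: the ring ℤ[ω, 1/√2], ω = e^{iπ/4}.
-- Every entry of H, T, F_n, T_n (and hence every amplitude arising from a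
-- circuit applied to a basis state) lies in this ring.

-- z = a + b ω + c ω² + d ω³  (ℤ[ω] is free of rank 4 over ℤ, ω⁴ = -1)
record ℤω : Set where
  constructor ⟨_,_,_,_⟩
  field a b c d : ℤ

0ω 1ω : ℤω
0ω = ⟨ ℤ.0ℤ , ℤ.0ℤ , ℤ.0ℤ , ℤ.0ℤ ⟩
1ω = ⟨ ℤ.1ℤ , ℤ.0ℤ , ℤ.0ℤ , ℤ.0ℤ ⟩

_+ω_ : ℤω → ℤω → ℤω
⟨ a , b , c , d ⟩ +ω ⟨ a' , b' , c' , d' ⟩ = ⟨ a +ℤ a' , b +ℤ b' , c +ℤ c' , d +ℤ d' ⟩

negω : ℤω → ℤω
negω ⟨ a , b , c , d ⟩ = ⟨ -ℤ a , -ℤ b , -ℤ c , -ℤ d ⟩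

mulω : ℤω → ℤω
mulω ⟨ a , b , c , d ⟩ = ⟨ -ℤ d , a , b , c ⟩

-- multiplication by √2 = ω - ω³
mul√2 : ℤω → ℤω
mul√2 z = mulω z +ω negω (mulω (mulω (mulω z)))

mul√2^ : ℕ → ℤω → ℤω
mul√2^ zero z = z
mul√2^ (suc k) z = mul√2 (mul√2^ k z)

-- An amplitude (k , z) denotes z / (√2)^k.
Amp : Set
Amp = ℕ × ℤω

_≈A_ : Amp → Amp → Set
(k , z) ≈A (k' , z') = mul√2^ k' z ≡ mul√2^ k z'

0A 1A : Amp
0A = (0 , 0ω)
1A = (0 , 1ω)

_+A_ : Amp → Amp → Amp
(k , z) +A (k' , z') = (k + k' , mul√2^ k' z +ω mul√2^ k z')

negA : Amp → Amp
negA (k , z) = (k , negω z)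

ωA : Amp → Amp
ωA (k , z) = (k , mulω z)

div√2 : Amp → Amp
div√2 (k , z) = (suc k , z)

State : ℕ → Set
State N = Vec Bool N → Amp

_≈S_ : ∀ {N} → State N → State N → Set
ψ ≈S φ = ∀ v → ψ v ≈A φ v

basis : ∀ {N} → Vec Bool N → State N
basis v w with ≡-dec BoolP._≟_ v w
... | yes _ = 1A
... | no  _ = 0A

-- Gates placed on qubits.  The index g : Bool selects the gate family:
--   g = false : 𝓕  = {H, T} ∪ {F_n | n ≥ 1}
--   g = true  : 𝓕' = {H, T} ∪ {F_n | n ≥ 1} ∪ {T_n | n ≥ 1}

data Placed : Bool → ℕ → Set where
  pH   : ∀ {g N} → Fin N → Placed g N
  pT   : ∀ {g N} → Fin N → Placed g N
  -- fanout F_{k+1}: control, then k+1 targets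
  pF   : ∀ {g N} (k : ℕ) → Fin N → Vec (Fin N) (suc k) → Placed g N
  -- unbounded Toffoli T_{k+1}: k+1 controls, then target
  pTof : ∀ {N} (k : ℕ) → Vec (Fin N) (suc k) → Fin N → Placed true N

support : ∀ {g N} → Placed g N → List (Fin N)
support (pH q) = q ∷ []
support (pT q) = q ∷ []
support (pF k c ts) = c ∷ Vec.toList ts
support (pTof k cs t) = t ∷ Vec.toList cs

Layer : Bool → ℕ → Set
Layer g N = Σ (List (Placed g N)) (λ gs → Unique (concatMap support gs))

Circuit : Bool → ℕ → Set
Circuit g N = List (Layer g N)

depth : ∀ {g N} → Circuit g N → ℕ
depth = length

fanPerm : ∀ {N k} → Bool → Vec (Fin N) k → Vec Bool N → Vec Bool N
fanPerm cb [] v = v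
fanPerm cb (t ∷ ts) v = let w = fanPerm cb ts v in w [ t ]≔ (lookup w t xor cb)

allOn : ∀ {N k} → Vec (Fin N) k → Vec Bool N → Bool
allOn [] v = true
allOn (c ∷ cs) v = lookup v c ∧ allOn cs v

applyPlaced : ∀ {g N} → Placed g N → State N → State N
applyPlaced (pH q) ψ v =
  div√2 (ψ (v [ q ]≔ false) +A
         (if lookup v q then negA (ψ (v [ q ]≔ true)) else ψ (v [ q ]≔ true)))
applyPlaced (pT q) ψ v = if lookup v q then ωA (ψ v) else ψ v
applyPlaced (pF k c ts) ψ v = ψ (fanPerm (lookup v c) ts v)
applyPlaced (pTof k cs t) ψ v = ψ (v [ t ]≔ (lookup v t xor allOn cs v))

applyLayer : ∀ {g N} → Layer g N → State N → State N
applyLayer (gs , _) ψ = foldr applyPlaced ψ gs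

run : ∀ {g N} → Circuit g N → State N → State N
run [] ψ = ψ
run (L ∷ Ls) ψ = run Ls (applyLayer L ψ)

-- Universality.  U acts on n input qubits, then m encoding qubits, then
-- a ancilla qubits (initialised to and returned to |0⟩).

-- (C|y⟩) ⊗ |x⟩ ⊗ |0^a⟩
tensorOut : ∀ {n m} → State n → Vec Bool m → (a : ℕ) → State (n + (m + a))
tensorOut {n} {m} ψ x a v with ≡-dec BoolP._≟_ (take m (drop n v)) x
                             | ≡-dec BoolP._≟_ (drop m (drop n v)) (replicate a false)
... | yes _ | yes _ = ψ (take n v)
... | _     | _     = 0A

Implements : ∀ {g} (n m a : ℕ) → Circuit g (n + (m + a)) → Vec Bool m → Circuit g n → Set
Implements n m a U x C =
  ∀ (y : Vec Bool n) →
    run U (basis (y Vec.++ (x Vec.++ replicate a false))) ≈S tensorOut (run C (basis y)) x a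

UniversalFor : ∀ {g} (n d m a : ℕ) → Circuit g (n + (m + a)) → Set
UniversalFor {g} n d m a U =
  ∀ (C : Circuit g n) → depth C ≤ d → Σ (Vec Bool m) (λ x → Implements n m a U x C)

-- Log-space computation: deterministic Turing machine with a read-only
-- input tape (with end markers), one binary work tape (initially all 0),
-- and a write-only output tape.

data Move : Set where
  L S R : Move

record Instr (Q : ℕ) : Set where
  field
    next  : Maybe (Fin Q)   -- nothing = halt
    write : Bool
    wmove : Move
    imove : Move
    out   : Maybe Bool

record TM : Set where
  field
    Q     : ℕ
    start : Fin Q
    δ     : Fin Q → Maybe Bool → Bool → Instr Q   -- state, input symbol (nothing = end marker), work symbol

record Config (Q : ℕ) : Set where
  field
    state : Maybe (Fin Q)   -- nothing = halted
    ihead : ℕ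
    work  : ℕ → Bool
    whead : ℕ
    output : List Bool

-- input tape: position 0 is the left marker, positions 1..|w| the word,
-- position |w|+1 the right marker
readIn : List Bool → ℕ → Maybe Bool
readIn w zero = nothing
readIn [] (suc i) = nothing
readIn (b ∷ w) (suc zero) = just b
readIn (b ∷ w) (suc (suc i)) = readIn w (suc i)

moveW : Move → ℕ → ℕ
moveW L i = i ∸ 1
moveW S i = i
moveW R i = suc i

moveI : ℕ → Move → ℕ → ℕ
moveI bound L i = i ∸ 1
moveI bound S i = i
moveI bound R i = if suc i Data.Nat.≤ᵇ bound then suc i else i

stepTM : (M : TM) → List Bool → Config (TM.Q M) → Config (TM.Q M)
stepTM M w cfg with Config.state cfg
... | nothing = cfg
... | just q =
  let ins = TM.δ M q (readIn w (Config.ihead cfg)) (Config.work cfg (Config.whead cfg))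
      wh  = Config.whead cfg
      o   = Instr.out ins
  in record
    { state  = Instr.next ins
    ; ihead  = moveI (suc (length w)) (Instr.imove ins) (Config.ihead cfg)
    ; work   = λ j → if j ≡ᵇ wh then Instr.write ins else Config.work cfg j
    ; whead  = moveW (Instr.wmove ins) wh
    ; output = Config.output cfg ++ (Data.Maybe.maybe (λ b → b ∷ []) [] o)
    }

initConfig : (M : TM) → Config (TM.Q M)
initConfig M = record { state = just (TM.start M) ; ihead = 0 ; work = λ _ → false ; whead = 0 ; output = [] }

configAt : (M : TM) → List Bool → ℕ → Config (TM.Q M)
configAt M w zero = initConfig M
configAt M w (suc t) = stepTM M w (configAt M w t)

ComputesInSpace : TM → List Bool → List Bool → ℕ → Set
ComputesInSpace M w o s =
  Σ ℕ (λ t → (Config.state (configAt M w t) ≡ nothing)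
           × (Config.output (configAt M w t) ≡ o)
           × (∀ t' → t' ≤ t → Config.whead (configAt M w t') ≤ s))

-- Encodings (prefix-free bit strings)

encNat : ℕ → List Bool
encNat k = List.replicate k true ++ (false ∷ [])

encList : ∀ {A : Set} → (A → List Bool) → List A → List Bool
encList f [] = false ∷ []
encList f (x ∷ xs) = true ∷ (f x ++ encList f xs)

encFin : ∀ {N} → Fin N → List Bool
encFin q = encNat (toℕ q)

encPlaced : ∀ {g N} → Placed g N → List Bool
encPlaced (pH q) = encNat 0 ++ encFin q
encPlaced (pT q) = encNat 1 ++ encFin q
encPlaced (pF k c ts) = encNat 2 ++ encNat k ++ encFin c ++ encList encFin (Vec.toList ts)
encPlaced (pTof k cs t) = encNat 3 ++ encNat k ++ encList encFin (Vec.toList cs) ++ encFin t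

encCircuit : ∀ {g N} → Circuit g N → List Bool
encCircuit = encList (λ L → encList encPlaced (proj₁ L))

-- description of U: number of encoding qubits m, of ancillas a, and the gates
-- (the number n of input qubits is part of the input to the generator)
encU : ∀ {g} (n m a : ℕ) → Circuit g (n + (m + a)) → List Bool
encU n m a U = encNat m ++ encNat a ++ encCircuit U

encND : ℕ → ℕ → List Bool
encND n d = List.replicate n true ++ (false ∷ List.replicate d true)

Family : Bool → Set
Family g = (n d : ℕ) → Σ ℕ (λ m → Σ ℕ (λ a → Circuit g (n + (m + a))))

module _ {g : Bool} (U : Family g) (n d : ℕ) where
  mOf aOf : ℕ
  mOf = proj₁ (U n d)
  aOf = proj₁ (proj₂ (U n d))
  circOf : Circuit g (n + (mOf + aOf))
  circOf = proj₂ (proj₂ (U n d))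

-- Depth-universality (conditions (1),(3),(4); (2) holds by typing)
-- together with the O(n² d) qubit bound.
DepthUniversal : ∀ {g} → Family g → Set
DepthUniversal {g} U =
  Σ ℕ λ c → Σ ℕ λ k →
    ∀ n d → 1 ≤ n → 1 ≤ d →
        UniversalFor n d (mOf U n d) (aOf U n d) (circOf U n d)
      × depth (circOf U n d) ≤ c * d
      × mOf U n d ≤ c * (n + d) ^ k
      × n + (mOf U n d + aOf U n d) ≤ c * (n * n * d)

LogSpaceUniform : ∀ {g} → Family g → Set
LogSpaceUniform U =
  Σ TM λ M → Σ ℕ λ c →
    ∀ n d → 1 ≤ n → 1 ≤ d →
      ComputesInSpace M (encND n d) (encU n (mOf U n d) (aOf U n d) (circOf U n d))
                      (c * (⌈log₂ (length (encND n d)) ⌉ + 1))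

{-# OPTIONS --safe #-}
module Submission where

-- Every layer of a circuit acts as H^{τ′} D H^{τ}, where τ and τ′ select qubits and D
-- is diagonal: a Hadamard gate has D = 1, a T gate is diagonal, and a gate that flips
-- its target under a condition c is H Z^c H there; a fanout gate is a product of CNOTs.
-- A Hadamard gate switched by a classical bit τ is B X^τ B⁻¹ for a fixed Clifford+T
-- word B.  For D, every data qubit is copied by fanout to n cells, a relative-phase
-- Toffoli gate computes f_ji ∧ v_i into a cell r_ji, the cells of row j are combined
-- into a phase on v_j (their parity by a fanout gate conjugated by Hadamard gates,
-- their conjunction by an unbounded Toffoli gate), and the computation is undone.
-- Undoing is conjugation of a diagonal operator, so the relative phases cancel and the
-- ancillas return to 0.  All of this has constant depth per simulated layer.
--
-- The description of the circuit is printed by nested loops whose counters are bounded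
-- by n and d.  A Turing machine runs such a loop program with its counters in binary.

open import Defs hiding (L; S; R)
open import Algebra.Bundles using (CommutativeRing)
import Algebra.Properties.Ring as RingProps
open import Data.Bool using (Bool; true; false; if_then_else_; _xor_; _∧_; _∨_; not)
import Data.Bool.Properties as BoolP
open import Data.Empty using (⊥; ⊥-elim)
open import Data.Fin using (Fin; zero; suc; toℕ; _↑ˡ_; _↑ʳ_; splitAt; combine; remQuot)
import Data.Fin.Properties as FinP
open import Data.List using (List; []; _∷_; _++_; map; foldr; concatMap; allFin; cartesianProduct; tabulate; length; replicate)
import Data.List.Properties as ListP
open import Data.List.Membership.Propositional using (_∈_; _∉_)
import Data.List.Membership.Propositional.Properties as MembP
import Data.List.Membership.DecPropositional as DecMemb
open import Data.List.Relation.Unary.All using (All; []; _∷_)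
import Data.List.Relation.Unary.All as All
import Data.List.Relation.Unary.All.Properties as AllP
open import Data.List.Relation.Unary.AllPairs using (AllPairs; []; _∷_)
import Data.List.Relation.Unary.AllPairs as AllPairs
import Data.List.Relation.Unary.AllPairs.Properties as AllPairsP
open import Data.List.Relation.Unary.Any using (here; there)
open import Data.List.Relation.Unary.Unique.Propositional using (Unique)
import Data.List.Relation.Unary.Unique.Propositional.Properties as UniqueP
open import Data.Maybe using (Maybe; just; nothing; maybe)
open import Data.Nat using (ℕ; zero; suc; _+_; _*_; _∸_; _^_; _≤_; _<_; _≤ᵇ_; z≤n; s≤s; _≡ᵇ_; _⊔_)
open import Data.Nat.Logarithm using (⌈log₂_⌉; ⌈log₂⌉-mono-≤; ⌈log₂2^n⌉≡n; ⌈log₂2*n⌉≡1+⌈log₂n⌉)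
import Data.Nat.Properties as ℕP
open import Data.Nat.Tactic.RingSolver using (solve-∀)
open import Data.Product using (Σ; _×_; _,_; proj₁; proj₂; uncurry)
open import Data.Sum as Sum using (_⊎_; inj₁; inj₂; [_,_]′)
open import Data.Unit using (⊤; tt)
open import Data.Vec using (Vec; []; _∷_; lookup; _[_]≔_)
import Data.Vec as Vec
import Data.Vec.Properties as VecP
open import Data.Vec.Relation.Unary.All using ([]; _∷_) renaming (All to VecAll)
import Data.Vec.Relation.Unary.All.Properties as VecAllP
open import Level using (0ℓ)
import Relation.Binary.Reasoning.Setoid as SetoidReasoning
open import Relation.Binary.PropositionalEquality using (_≡_; _≢_; refl; sym; trans; cong; cong₂; subst; isEquivalence; module ≡-Reasoning)
open import Relation.Nullary using (Dec; yes; no; does)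
open import Relation.Nullary.Decidable using (dec-true; dec-false)

-- The circuit is fixed, so every choice comes from an encoding qubit through a CNOT, that is, as
-- X^b on one target; hence each switched gate is a one-qubit word that contains X^b. Consecutive
-- layers with the same targets read none of these targets, so together they act on each target by a
-- product of 2×2 matrices for every value of the controls. What has to be verified about gates is
-- then a finite list of matrix identities over exact amplitudes. The gate sets contain no inverses,
-- so T† and S† are spelled T⁷ and T⁶.
--
-- Constant depth forces gates of a layer to have disjoint supports. The n² cells r therefore need
-- n² copies of the data and, at every level, n² bits f and n² bits e of their own; this is the
-- origin of n² d. The ancillas return to 0 after each level and are shared by all levels.
--
-- The printed description uses unary numerals. An address is never computed as a number but printed
-- by nested loops, so no counter exceeds n + d, and reset, increment and comparison for equality
-- are all the arithmetic that the machine performs.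

-- The commutative ring of amplitudes z / √2^k up to cross multiplication.

module Amplitudes where
  import Data.Nat as ℕ
  open import Data.Integer using (ℤ; +_)
  import Data.Integer as ℤ
  import Data.Integer.Properties as ℤP
  open import Data.Integer.Tactic.RingSolver using (ring)
  open import Tactic.RingSolver.NonReflective ring using (solve; _⊜_; Expr; _⊕_; _⊗_; ⊝_; Κ)

  mk≡ : ∀ {a b c d a′ b′ c′ d′ : ℤ} → a ≡ a′ → b ≡ b′ → c ≡ c′ → d ≡ d′ →
        ⟨ a , b , c , d ⟩ ≡ ⟨ a′ , b′ , c′ , d′ ⟩
  mk≡ refl refl refl refl = refl

  +ω-assoc : ∀ x y z → (x +ω y) +ω z ≡ x +ω (y +ω z)
  +ω-assoc ⟨ a , b , c , d ⟩ ⟨ a′ , b′ , c′ , d′ ⟩ ⟨ p , q , r , s ⟩ =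
    mk≡ (ℤP.+-assoc a a′ p) (ℤP.+-assoc b b′ q) (ℤP.+-assoc c c′ r) (ℤP.+-assoc d d′ s)

  +ω-comm : ∀ x y → x +ω y ≡ y +ω x
  +ω-comm ⟨ a , b , c , d ⟩ ⟨ a′ , b′ , c′ , d′ ⟩ =
    mk≡ (ℤP.+-comm a a′) (ℤP.+-comm b b′) (ℤP.+-comm c c′) (ℤP.+-comm d d′)

  +ω-identityˡ : ∀ x → 0ω +ω x ≡ x
  +ω-identityˡ ⟨ a , b , c , d ⟩ =
    mk≡ (ℤP.+-identityˡ a) (ℤP.+-identityˡ b) (ℤP.+-identityˡ c) (ℤP.+-identityˡ d)

  -ω-inverseˡ : ∀ x → negω x +ω x ≡ 0ω
  -ω-inverseˡ ⟨ a , b , c , d ⟩ =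
    mk≡ (ℤP.+-inverseˡ a) (ℤP.+-inverseˡ b) (ℤP.+-inverseˡ c) (ℤP.+-inverseˡ d)

  -- Multiplication of ℤω on solver expressions, so that each coordinate of a
  -- ring law is a call to the integer ring solver.
  Expr⁴ : ℕ → Set
  Expr⁴ n = Expr ℤ n × Expr ℤ n × Expr ℤ n × Expr ℤ n

  infixl 7 _⊛ω_
  _⊛ω_ : ∀ {n} → Expr⁴ n → Expr⁴ n → Expr⁴ n
  (a , b , c , d) ⊛ω (a′ , b′ , c′ , d′) =
    ( a ⊗ a′ ⊕ ⊝ (b ⊗ d′) ⊕ ⊝ (c ⊗ c′) ⊕ ⊝ (d ⊗ b′)
    , a ⊗ b′ ⊕ b ⊗ a′ ⊕ ⊝ (c ⊗ d′) ⊕ ⊝ (d ⊗ c′)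
    , a ⊗ c′ ⊕ b ⊗ b′ ⊕ c ⊗ a′ ⊕ ⊝ (d ⊗ d′)
    , a ⊗ d′ ⊕ b ⊗ c′ ⊕ c ⊗ b′ ⊕ d ⊗ a′ )

  _⊕ω_ : ∀ {n} → Expr⁴ n → Expr⁴ n → Expr⁴ n
  (a , b , c , d) ⊕ω (a′ , b′ , c′ , d′) = (a ⊕ a′ , b ⊕ b′ , c ⊕ c′ , d ⊕ d′)

  coord : ∀ {n} → Fin 4 → Expr⁴ n → Expr ℤ n
  coord zero (a , b , c , d) = a
  coord (suc zero) (a , b , c , d) = b
  coord (suc (suc zero)) (a , b , c , d) = c
  coord (suc (suc (suc zero))) (a , b , c , d) = d

  ωω √2ω : ℤω
  ωω = ⟨ ℤ.0ℤ , ℤ.1ℤ , ℤ.0ℤ , ℤ.0ℤ ⟩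
  √2ω = ⟨ ℤ.0ℤ , ℤ.1ℤ , ℤ.0ℤ , ℤ.-1ℤ ⟩

  infixl 7 _*ω_

  opaque
    _*ω_ : ℤω → ℤω → ℤω
    ⟨ a , b , c , d ⟩ *ω ⟨ a′ , b′ , c′ , d′ ⟩ =
      ⟨ a ℤ.* a′ ℤ.- b ℤ.* d′ ℤ.- c ℤ.* c′ ℤ.- d ℤ.* b′
      , a ℤ.* b′ ℤ.+ b ℤ.* a′ ℤ.- c ℤ.* d′ ℤ.- d ℤ.* c′
      , a ℤ.* c′ ℤ.+ b ℤ.* b′ ℤ.+ c ℤ.* a′ ℤ.- d ℤ.* d′
      , a ℤ.* d′ ℤ.+ b ℤ.* c′ ℤ.+ c ℤ.* b′ ℤ.+ d ℤ.* a′ ⟩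

    *ω-comm : ∀ x y → x *ω y ≡ y *ω x
    *ω-comm ⟨ a , b , c , d ⟩ ⟨ p , q , r , s ⟩ =
      mk≡ (solve 8 (eq zero) refl a b c d p q r s)
          (solve 8 (eq (suc zero)) refl a b c d p q r s)
          (solve 8 (eq (suc (suc zero))) refl a b c d p q r s)
          (solve 8 (eq (suc (suc (suc zero)))) refl a b c d p q r s)
      where
        eq : Fin 4 → (a b c d p q r s : Expr ℤ 8) → Expr ℤ 8 × Expr ℤ 8
        eq i a b c d p q r s = let x = (a , b , c , d) ; y = (p , q , r , s) in
          coord i (x ⊛ω y) ⊜ coord i (y ⊛ω x)

    *ω-assoc : ∀ x y z → (x *ω y) *ω z ≡ x *ω (y *ω z)
    *ω-assoc ⟨ a , b , c , d ⟩ ⟨ p , q , r , s ⟩ ⟨ t , u , v , w ⟩ =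
      mk≡ (solve 12 (eq zero) refl a b c d p q r s t u v w)
          (solve 12 (eq (suc zero)) refl a b c d p q r s t u v w)
          (solve 12 (eq (suc (suc zero))) refl a b c d p q r s t u v w)
          (solve 12 (eq (suc (suc (suc zero)))) refl a b c d p q r s t u v w)
      where
        eq : Fin 4 → (a b c d p q r s t u v w : Expr ℤ 12) → Expr ℤ 12 × Expr ℤ 12
        eq i a b c d p q r s t u v w = let x = (a , b , c , d) ; y = (p , q , r , s) ; z = (t , u , v , w) in
          coord i ((x ⊛ω y) ⊛ω z) ⊜ coord i (x ⊛ω (y ⊛ω z))

    *ω-distribˡ : ∀ x y z → x *ω (y +ω z) ≡ (x *ω y) +ω (x *ω z)
    *ω-distribˡ ⟨ a , b , c , d ⟩ ⟨ p , q , r , s ⟩ ⟨ t , u , v , w ⟩ =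
      mk≡ (solve 12 (eq zero) refl a b c d p q r s t u v w)
          (solve 12 (eq (suc zero)) refl a b c d p q r s t u v w)
          (solve 12 (eq (suc (suc zero))) refl a b c d p q r s t u v w)
          (solve 12 (eq (suc (suc (suc zero)))) refl a b c d p q r s t u v w)
      where
        eq : Fin 4 → (a b c d p q r s t u v w : Expr ℤ 12) → Expr ℤ 12 × Expr ℤ 12
        eq i a b c d p q r s t u v w = let x = (a , b , c , d) ; y = (p , q , r , s) ; z = (t , u , v , w) in
          coord i (x ⊛ω (y ⊕ω z)) ⊜ coord i ((x ⊛ω y) ⊕ω (x ⊛ω z))

    *ω-identityˡ : ∀ x → 1ω *ω x ≡ x
    *ω-identityˡ ⟨ a , b , c , d ⟩ =
      mk≡ (solve 4 (eq zero) refl a b c d)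
          (solve 4 (eq (suc zero)) refl a b c d)
          (solve 4 (eq (suc (suc zero))) refl a b c d)
          (solve 4 (eq (suc (suc (suc zero)))) refl a b c d)
      where
        eq : Fin 4 → (a b c d : Expr ℤ 4) → Expr ℤ 4 × Expr ℤ 4
        eq i a b c d = coord i ((Κ ℤ.1ℤ , Κ ℤ.0ℤ , Κ ℤ.0ℤ , Κ ℤ.0ℤ) ⊛ω (a , b , c , d)) ⊜ coord i (a , b , c , d)

    mulω-* : ∀ x → mulω x ≡ ωω *ω x
    mulω-* ⟨ a , b , c , d ⟩ =
      mk≡ (solve 4 (eq zero) refl a b c d)
          (solve 4 (eq (suc zero)) refl a b c d)
          (solve 4 (eq (suc (suc zero))) refl a b c d)
          (solve 4 (eq (suc (suc (suc zero)))) refl a b c d)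
      where
        eq : Fin 4 → (a b c d : Expr ℤ 4) → Expr ℤ 4 × Expr ℤ 4
        eq i a b c d = coord i (⊝ d , a , b , c)
          ⊜ coord i ((Κ ℤ.0ℤ , Κ ℤ.1ℤ , Κ ℤ.0ℤ , Κ ℤ.0ℤ) ⊛ω (a , b , c , d))

    mul√2-* : ∀ x → mul√2 x ≡ √2ω *ω x
    mul√2-* ⟨ a , b , c , d ⟩ =
      mk≡ (solve 4 (eq zero) refl a b c d)
          (solve 4 (eq (suc zero)) refl a b c d)
          (solve 4 (eq (suc (suc zero))) refl a b c d)
          (solve 4 (eq (suc (suc (suc zero)))) refl a b c d)
      where
        eq : Fin 4 → (a b c d : Expr ℤ 4) → Expr ℤ 4 × Expr ℤ 4
        eq i a b c d = coord i ((⊝ d , a , b , c) ⊕ω (⊝ ⊝ b , ⊝ ⊝ c , ⊝ ⊝ d , ⊝ a))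
          ⊜ coord i ((Κ ℤ.0ℤ , Κ ℤ.1ℤ , Κ ℤ.0ℤ , Κ ℤ.-1ℤ) ⊛ω (a , b , c , d))

    √2ω²-* : √2ω *ω √2ω ≡ 1ω +ω 1ω
    √2ω²-* = refl

  ℤω-ring : CommutativeRing 0ℓ 0ℓ
  ℤω-ring = record
    { Carrier = ℤω ; _≈_ = _≡_ ; _+_ = _+ω_ ; _*_ = _*ω_ ; -_ = negω ; 0# = 0ω ; 1# = 1ω
    ; isCommutativeRing = record
      { isRing = record
        { +-isAbelianGroup = record
          { isGroup = record
            { isMonoid = record
              { isSemigroup = record
                { isMagma = record { isEquivalence = isEquivalence ; ∙-cong = cong₂ _+ω_ }
                ; assoc = +ω-assoc }
              ; identity = +ω-identityˡ , λ x → trans (+ω-comm x 0ω) (+ω-identityˡ x) }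
            ; inverse = -ω-inverseˡ , λ x → trans (+ω-comm x (negω x)) (-ω-inverseˡ x)
            ; ⁻¹-cong = cong negω }
          ; comm = +ω-comm }
        ; *-cong = cong₂ _*ω_
        ; *-assoc = *ω-assoc
        ; *-identity = *ω-identityˡ , λ x → trans (*ω-comm x 1ω) (*ω-identityˡ x)
        ; distrib = *ω-distribˡ , λ x y z → trans (*ω-comm (y +ω z) x)
                      (trans (*ω-distribˡ x y z) (cong₂ _+ω_ (*ω-comm x y) (*ω-comm x z))) }
      ; *-comm = *ω-comm } }

  open RingProps (CommutativeRing.ring ℤω-ring) using (-‿distribʳ-*; -‿distribˡ-*) public

  open import Algebra.Solver.Ring.NaturalCoefficients.Default (CommutativeRing.commutativeSemiring ℤω-ring)
    using (_:+_; _:*_; _:=_) renaming (solve to solveω)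

  pw : ℕ → ℤω
  pw zero = 1ω
  pw (suc k) = √2ω *ω pw k

  pw-+ : ∀ k l → pw (k ℕ.+ l) ≡ pw k *ω pw l
  pw-+ zero l = sym (*ω-identityˡ _)
  pw-+ (suc k) l = trans (cong (√2ω *ω_) (pw-+ k l)) (sym (*ω-assoc _ _ _))

  mul√2^-* : ∀ k z → mul√2^ k z ≡ pw k *ω z
  mul√2^-* zero z = sym (*ω-identityˡ z)
  mul√2^-* (suc k) z = trans (mul√2-* (mul√2^ k z))
    (trans (cong (√2ω *ω_) (mul√2^-* k z)) (sym (*ω-assoc _ _ _)))

  -- A second factor √2 turns both sides into doubles, and integer coordinates can be halved.
  √2-cancel : ∀ x y → √2ω *ω x ≡ √2ω *ω y → x ≡ y
  √2-cancel x y e = halve (trans (sym (double x)) (trans (cong (√2ω *ω_) e) (double y)))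
    where
      2ω : ℤω
      2ω = ⟨ + 2 , ℤ.0ℤ , ℤ.0ℤ , ℤ.0ℤ ⟩
      dbl : ∀ a → a ℤ.+ a ≡ + 2 ℤ.* a
      dbl a = solve 1 (λ a → a ⊕ a ⊜ Κ (+ 2) ⊗ a) refl a
      double : ∀ x → √2ω *ω (√2ω *ω x) ≡ x +ω x
      double x = trans (sym (*ω-assoc √2ω √2ω x)) (trans (cong (_*ω x) √2ω²-*)
        (trans (*ω-comm _ x) (trans (*ω-distribˡ x 1ω 1ω)
          (cong₂ _+ω_ (trans (*ω-comm x 1ω) (*ω-identityˡ x)) (trans (*ω-comm x 1ω) (*ω-identityˡ x))))))
      coord-halve : ∀ a b → a ℤ.+ a ≡ b ℤ.+ b → a ≡ b
      coord-halve a b e = ℤP.*-cancelˡ-≡ (+ 2) a b (trans (sym (dbl a)) (trans e (dbl b)))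
      halve : ∀ {x y} → x +ω x ≡ y +ω y → x ≡ y
      halve {⟨ a , b , c , d ⟩} {⟨ p , q , r , s ⟩} e =
        mk≡ (coord-halve a p (cong ℤω.a e)) (coord-halve b q (cong ℤω.b e))
            (coord-halve c r (cong ℤω.c e)) (coord-halve d s (cong ℤω.d e))

  pw-cancel : ∀ k x y → pw k *ω x ≡ pw k *ω y → x ≡ y
  pw-cancel zero x y e = trans (sym (*ω-identityˡ x)) (trans e (*ω-identityˡ y))
  pw-cancel (suc k) x y e = pw-cancel k x y (√2-cancel _ _
    (trans (sym (*ω-assoc √2ω (pw k) x)) (trans e (*ω-assoc √2ω (pw k) y))))

  ≈A-intro : ∀ k z k′ z′ → pw k′ *ω z ≡ pw k *ω z′ → (k , z) ≈A (k′ , z′)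
  ≈A-intro k z k′ z′ e = trans (mul√2^-* k′ z) (trans e (sym (mul√2^-* k z′)))

  ≈A-elim : ∀ k z k′ z′ → (k , z) ≈A (k′ , z′) → pw k′ *ω z ≡ pw k *ω z′
  ≈A-elim k z k′ z′ e = trans (sym (mul√2^-* k′ z)) (trans e (mul√2^-* k z′))

  infixl 7 _*A_
  _*A_ : Amp → Amp → Amp
  (k , z) *A (k′ , z′) = (k ℕ.+ k′ , z *ω z′)

  -- As for fractions: after scaling by the middle denominator `pw l` both equations can be chained,
  -- and `pw-cancel` removes that factor again.
  ≈A-trans : ∀ {x y z} → x ≈A y → y ≈A z → x ≈A z
  ≈A-trans {k , x} {l , y} {m , z} e f = ≈A-intro k x m z (pw-cancel l _ _ (begin
    pw l *ω (pw m *ω x) ≡⟨ swap (pw l) (pw m) x ⟩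
    pw m *ω (pw l *ω x) ≡⟨ cong (pw m *ω_) (≈A-elim k x l y e) ⟩
    pw m *ω (pw k *ω y) ≡⟨ swap (pw m) (pw k) y ⟩
    pw k *ω (pw m *ω y) ≡⟨ cong (pw k *ω_) (≈A-elim l y m z f) ⟩
    pw k *ω (pw l *ω z) ≡⟨ swap (pw k) (pw l) z ⟩
    pw l *ω (pw k *ω z) ∎))
    where
      open ≡-Reasoning
      swap : ∀ a b c → a *ω (b *ω c) ≡ b *ω (a *ω c)
      swap = solveω 3 (λ a b c → a :* (b :* c) := b :* (a :* c)) refl

  +A-sum : ∀ k x l y → proj₂ ((k , x) +A (l , y)) ≡ (pw l *ω x) +ω (pw k *ω y)
  +A-sum k x l y = cong₂ _+ω_ (mul√2^-* l x) (mul√2^-* k y)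

  +A-cong : ∀ {x x′ y y′} → x ≈A x′ → y ≈A y′ → (x +A y) ≈A (x′ +A y′)
  +A-cong {k , x} {k′ , x′} {l , y} {l′ , y′} e f = ≈A-intro (k ℕ.+ l) _ (k′ ℕ.+ l′) _ (begin
    pw (k′ ℕ.+ l′) *ω (mul√2^ l x +ω mul√2^ k y)
      ≡⟨ cong₂ _*ω_ (pw-+ k′ l′) (+A-sum k x l y) ⟩
    pw k′ *ω pw l′ *ω ((pw l *ω x) +ω (pw k *ω y))
      ≡⟨ expand (pw k′) (pw l′) (pw k) (pw l) x y ⟩
    ((pw l′ *ω pw l) *ω (pw k′ *ω x)) +ω ((pw k′ *ω pw k) *ω (pw l′ *ω y))
      ≡⟨ cong₂ (λ u v → ((pw l′ *ω pw l) *ω u) +ω ((pw k′ *ω pw k) *ω v))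
           (≈A-elim k x k′ x′ e) (≈A-elim l y l′ y′ f) ⟩
    ((pw l′ *ω pw l) *ω (pw k *ω x′)) +ω ((pw k′ *ω pw k) *ω (pw l *ω y′))
      ≡⟨ collect (pw k′) (pw l′) (pw k) (pw l) x′ y′ ⟩
    pw k *ω pw l *ω ((pw l′ *ω x′) +ω (pw k′ *ω y′))
      ≡⟨ cong₂ _*ω_ (pw-+ k l) (+A-sum k′ x′ l′ y′) ⟨
    pw (k ℕ.+ l) *ω (mul√2^ l′ x′ +ω mul√2^ k′ y′) ∎)
    where
      open ≡-Reasoning
      expand : ∀ k′ l′ k l x y → k′ *ω l′ *ω ((l *ω x) +ω (k *ω y)) ≡ ((l′ *ω l) *ω (k′ *ω x)) +ω ((k′ *ω k) *ω (l′ *ω y))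
      expand = solveω 6 (λ k′ l′ k l x y → k′ :* l′ :* ((l :* x) :+ (k :* y)) := ((l′ :* l) :* (k′ :* x)) :+ ((k′ :* k) :* (l′ :* y))) refl
      collect : ∀ k′ l′ k l x y → ((l′ *ω l) *ω (k *ω x)) +ω ((k′ *ω k) *ω (l *ω y)) ≡ k *ω l *ω ((l′ *ω x) +ω (k′ *ω y))
      collect = solveω 6 (λ k′ l′ k l x y → ((l′ :* l) :* (k :* x)) :+ ((k′ :* k) :* (l :* y)) := k :* l :* ((l′ :* x) :+ (k′ :* y))) refl

  *A-cong : ∀ {x x′ y y′} → x ≈A x′ → y ≈A y′ → (x *A y) ≈A (x′ *A y′)
  *A-cong {k , x} {k′ , x′} {l , y} {l′ , y′} e f = ≈A-intro (k ℕ.+ l) _ (k′ ℕ.+ l′) _ (begin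
    pw (k′ ℕ.+ l′) *ω (x *ω y)        ≡⟨ cong (_*ω (x *ω y)) (pw-+ k′ l′) ⟩
    pw k′ *ω pw l′ *ω (x *ω y)        ≡⟨ swap (pw k′) (pw l′) x y ⟩
    (pw k′ *ω x) *ω (pw l′ *ω y)      ≡⟨ cong₂ _*ω_ (≈A-elim k x k′ x′ e) (≈A-elim l y l′ y′ f) ⟩
    (pw k *ω x′) *ω (pw l *ω y′)      ≡⟨ swap (pw k) (pw l) x′ y′ ⟨
    pw k *ω pw l *ω (x′ *ω y′)        ≡⟨ cong (_*ω (x′ *ω y′)) (pw-+ k l) ⟨
    pw (k ℕ.+ l) *ω (x′ *ω y′)        ∎)
    where
      open ≡-Reasoning
      swap : ∀ k l x y → k *ω l *ω (x *ω y) ≡ (k *ω x) *ω (l *ω y)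
      swap = solveω 4 (λ k l x y → k :* l :* (x :* y) := (k :* x) :* (l :* y)) refl

  negA-cong : ∀ {x x′} → x ≈A x′ → negA x ≈A negA x′
  negA-cong {k , x} {k′ , x′} e = ≈A-intro k _ k′ _
    (trans (pull (pw k′) x) (trans (cong negω (≈A-elim k x k′ x′ e)) (sym (pull (pw k) x′))))
    where
      pull : ∀ k x → k *ω negω x ≡ negω (k *ω x)
      pull k x = sym (-‿distribʳ-* k x)

  infix 4 _≋_
  infixl 6 _⊞_
  infixl 7 _⊠_
  infix 8 ⊟_

  opaque
    -- Opaque because the unfolded relation is an equation in `ℤω`, from which the two amplitudes
    -- that it compares cannot be inferred.
    _≋_ : Amp → Amp → Set
    _≋_ = _≈A_

    _⊞_ _⊠_ : Amp → Amp → Amp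
    _⊞_ = _+A_
    _⊠_ = _*A_

    ⊟_ : Amp → Amp
    ⊟_ = negA

    ≋-refl : ∀ {x} → x ≋ x
    ≋-refl = refl

    ≋-sym : ∀ {x y} → x ≋ y → y ≋ x
    ≋-sym e = sym e

    ≋-trans : ∀ {x y z} → x ≋ y → y ≋ z → x ≋ z
    ≋-trans {x} {y} {z} = ≈A-trans {x} {y} {z}

    ⊞-cong : ∀ {x x′ y y′} → x ≋ x′ → y ≋ y′ → x ⊞ y ≋ x′ ⊞ y′
    ⊞-cong {x} {x′} {y} {y′} = +A-cong {x} {x′} {y} {y′}

    ⊠-cong : ∀ {x x′ y y′} → x ≋ x′ → y ≋ y′ → x ⊠ y ≋ x′ ⊠ y′
    ⊠-cong {x} {x′} {y} {y′} = *A-cong {x} {x′} {y} {y′}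

    ⊟-cong : ∀ {x x′} → x ≋ x′ → ⊟ x ≋ ⊟ x′
    ⊟-cong {x} {x′} = negA-cong {x} {x′}

    from≡ : ∀ {k l z w} → k ≡ l → z ≡ w → (k , z) ≋ (l , w)
    from≡ refl refl = refl

    ⊞-assoc : ∀ x y z → (x ⊞ y) ⊞ z ≋ x ⊞ (y ⊞ z)
    ⊞-assoc (k , x) (l , y) (m , z) = from≡ (ℕP.+-assoc k l m) (begin
      mul√2^ m (mul√2^ l x +ω mul√2^ k y) +ω mul√2^ (k ℕ.+ l) z
        ≡⟨ +A-sum (k ℕ.+ l) (mul√2^ l x +ω mul√2^ k y) m z ⟩
      (pw m *ω (mul√2^ l x +ω mul√2^ k y)) +ω (pw (k ℕ.+ l) *ω z)
        ≡⟨ cong₂ (λ u v → (pw m *ω u) +ω (v *ω z)) (+A-sum k x l y) (pw-+ k l) ⟩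
      (pw m *ω ((pw l *ω x) +ω (pw k *ω y))) +ω ((pw k *ω pw l) *ω z)
        ≡⟨ regroup (pw k) (pw l) (pw m) x y z ⟩
      ((pw l *ω pw m) *ω x) +ω (pw k *ω ((pw m *ω y) +ω (pw l *ω z)))
        ≡⟨ cong₂ (λ u v → (u *ω x) +ω (pw k *ω v)) (pw-+ l m) (+A-sum l y m z) ⟨
      (pw (l ℕ.+ m) *ω x) +ω (pw k *ω (mul√2^ m y +ω mul√2^ l z))
        ≡⟨ +A-sum k x (l ℕ.+ m) (mul√2^ m y +ω mul√2^ l z) ⟨
      mul√2^ (l ℕ.+ m) x +ω mul√2^ k (mul√2^ m y +ω mul√2^ l z) ∎)
      where
        open ≡-Reasoning
        regroup : ∀ k l m x y z → (m *ω ((l *ω x) +ω (k *ω y))) +ω ((k *ω l) *ω z)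
                                ≡ ((l *ω m) *ω x) +ω (k *ω ((m *ω y) +ω (l *ω z)))
        regroup = solveω 6 (λ k l m x y z → (m :* ((l :* x) :+ (k :* y))) :+ ((k :* l) :* z) := ((l :* m) :* x) :+ (k :* ((m :* y) :+ (l :* z)))) refl

    ⊞-comm : ∀ x y → x ⊞ y ≋ y ⊞ x
    ⊞-comm (k , x) (l , y) = from≡ (ℕP.+-comm k l) (+ω-comm (mul√2^ l x) (mul√2^ k y))

    mul√2^-0 : ∀ k → mul√2^ k 0ω ≡ 0ω
    mul√2^-0 zero = refl
    mul√2^-0 (suc k) = cong mul√2 (mul√2^-0 k)

    ⊞-identityˡ : ∀ x → 0A ⊞ x ≋ x
    ⊞-identityˡ (k , x) = from≡ refl (trans (cong (_+ω x) (mul√2^-0 k)) (+ω-identityˡ x))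

    ⊟-inverseˡ : ∀ x → ⊟ x ⊞ x ≋ 0A
    ⊟-inverseˡ (k , x) = trans
      (trans (cong₂ _+ω_ (mul√2^-* k (negω x)) (mul√2^-* k x))
        (trans (cong (_+ω (pw k *ω x)) (sym (-‿distribʳ-* (pw k) x))) (-ω-inverseˡ (pw k *ω x))))
      (sym (mul√2^-0 (k ℕ.+ k)))

    ⊠-assoc : ∀ x y z → (x ⊠ y) ⊠ z ≋ x ⊠ (y ⊠ z)
    ⊠-assoc (k , x) (l , y) (m , z) = from≡ (ℕP.+-assoc k l m) (*ω-assoc x y z)

    ⊠-comm : ∀ x y → x ⊠ y ≋ y ⊠ x
    ⊠-comm (k , x) (l , y) = from≡ (ℕP.+-comm k l) (*ω-comm x y)

    ⊠-identityˡ : ∀ x → 1A ⊠ x ≋ x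
    ⊠-identityˡ (k , x) = from≡ refl (*ω-identityˡ x)

    -- The right side carries one more factor √2^k in its denominator. Unlike associativity and
    -- commutativity, this law therefore needs a genuine cross multiplication.
    ⊠-distribˡ : ∀ x y z → x ⊠ (y ⊞ z) ≋ x ⊠ y ⊞ x ⊠ z
    ⊠-distribˡ (k , x) (l , y) (m , z) = ≈A-intro (k ℕ.+ (l ℕ.+ m)) _ (k ℕ.+ l ℕ.+ (k ℕ.+ m)) _ (begin
      pw (k ℕ.+ l ℕ.+ (k ℕ.+ m)) *ω (x *ω (mul√2^ m y +ω mul√2^ l z))
        ≡⟨ cong₂ (λ u v → u *ω (x *ω v)) (trans (pw-+ (k ℕ.+ l) (k ℕ.+ m)) (cong₂ _*ω_ (pw-+ k l) (pw-+ k m))) (+A-sum l y m z) ⟩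
      (pw k *ω pw l) *ω (pw k *ω pw m) *ω (x *ω ((pw m *ω y) +ω (pw l *ω z)))
        ≡⟨ regroup (pw k) (pw l) (pw m) x y z ⟩
      (pw k *ω (pw l *ω pw m)) *ω (((pw k *ω pw m) *ω (x *ω y)) +ω ((pw k *ω pw l) *ω (x *ω z)))
        ≡⟨ cong₂ _*ω_ (trans (pw-+ k (l ℕ.+ m)) (cong (pw k *ω_) (pw-+ l m)))
             (trans (+A-sum (k ℕ.+ l) (x *ω y) (k ℕ.+ m) (x *ω z))
               (cong₂ (λ u v → (u *ω (x *ω y)) +ω (v *ω (x *ω z))) (pw-+ k m) (pw-+ k l))) ⟨
      pw (k ℕ.+ (l ℕ.+ m)) *ω proj₂ (((k , x) *A (l , y)) +A ((k , x) *A (m , z))) ∎)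
      where
        open ≡-Reasoning
        regroup : ∀ k l m x y z → (k *ω l) *ω (k *ω m) *ω (x *ω ((m *ω y) +ω (l *ω z)))
                                ≡ (k *ω (l *ω m)) *ω (((k *ω m) *ω (x *ω y)) +ω ((k *ω l) *ω (x *ω z)))
        regroup k l m x y z = trans (spread (k *ω l *ω (k *ω m)) x (m *ω y) (l *ω z))
          (trans (cong₂ _+ω_ (shuffle k k l m m x y) (shuffle k k l m l x z)) (sym (*ω-distribˡ _ _ _)))
          where
            spread : ∀ p x u v → p *ω (x *ω (u +ω v)) ≡ (p *ω (x *ω u)) +ω (p *ω (x *ω v))
            spread = solveω 4 (λ p x u v → p :* (x :* (u :+ v)) := p :* (x :* u) :+ p :* (x :* v)) refl
            shuffle : ∀ k k′ l m m′ x y → k *ω l *ω (k′ *ω m) *ω (x *ω (m′ *ω y)) ≡ k *ω (l *ω m) *ω (k′ *ω m′ *ω (x *ω y))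
            shuffle k k′ l m m′ x y = begin
              k *ω l *ω (k′ *ω m) *ω (x *ω (m′ *ω y))
                ≡⟨ cong₂ _*ω_ (trans (cong (k *ω l *ω_) (*ω-comm k′ m)) (trans (sym (*ω-assoc (k *ω l) m k′))
                     (cong (_*ω k′) (*ω-assoc k l m)))) (trans (sym (*ω-assoc x m′ y)) (trans (cong (_*ω y) (*ω-comm x m′)) (*ω-assoc m′ x y))) ⟩
              k *ω (l *ω m) *ω k′ *ω (m′ *ω (x *ω y))
                ≡⟨ trans (*ω-assoc (k *ω (l *ω m)) k′ _) (cong (k *ω (l *ω m) *ω_) (sym (*ω-assoc k′ m′ (x *ω y)))) ⟩
              k *ω (l *ω m) *ω (k′ *ω m′ *ω (x *ω y)) ∎

  Amp-ring : CommutativeRing 0ℓ 0ℓ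
  Amp-ring = record
    { Carrier = Amp ; _≈_ = _≋_ ; _+_ = _⊞_ ; _*_ = _⊠_ ; -_ = ⊟_ ; 0# = 0A ; 1# = 1A
    ; isCommutativeRing = record
      { isRing = record
        { +-isAbelianGroup = record
          { isGroup = record
            { isMonoid = record
              { isSemigroup = record
                { isMagma = record { isEquivalence = record { refl = ≋-refl ; sym = ≋-sym ; trans = ≋-trans } ; ∙-cong = ⊞-cong }
                ; assoc = ⊞-assoc }
              ; identity = ⊞-identityˡ , λ x → ≋-trans (⊞-comm x 0A) (⊞-identityˡ x) }
            ; inverse = ⊟-inverseˡ , λ x → ≋-trans (⊞-comm x (⊟ x)) (⊟-inverseˡ x)
            ; ⁻¹-cong = ⊟-cong }
          ; comm = ⊞-comm }
        ; *-cong = ⊠-cong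
        ; *-assoc = ⊠-assoc
        ; *-identity = ⊠-identityˡ , λ x → ≋-trans (⊠-comm x 1A) (⊠-identityˡ x)
        ; distrib = ⊠-distribˡ , λ x y z → ≋-trans (⊠-comm (y ⊞ z) x)
                      (≋-trans (⊠-distribˡ x y z) (⊞-cong (⊠-comm x y) (⊠-comm x z))) }
      ; *-comm = ⊠-comm } }

-- Controlled one-qubit operators, diagonal operators and families acting in parallel.

module Operators where
  open Amplitudes
  import Data.Nat as ℕ
  open import Algebra.Solver.Ring.NaturalCoefficients.Default (CommutativeRing.commutativeSemiring Amp-ring)
    using (_:+_; _:*_; _:=_) renaming (solve to solveA)
  open CommutativeRing Amp-ring public using () renaming (setoid to Amp-setoid; zeroˡ to ⊠-zeroˡ; zeroʳ to ⊠-zeroʳ)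
  module ≋-Reasoning = SetoidReasoning Amp-setoid

  ≋-reflexive : ∀ {x y} → x ≡ y → x ≋ y
  ≋-reflexive refl = ≋-refl

  opaque
    unfolding _≋_

    -- `_+A_` multiplies denominators even when they agree. Cancelling the surplus lets a matrix
    -- keep a single denominator for its four entries.
    ⊞-common : ∀ k x y → (k , x) ⊞ (k , y) ≋ (k , x +ω y)
    ⊞-common k x y = ≈A-intro (k + k) (mul√2^ k x +ω mul√2^ k y) k (x +ω y)
      (trans (cong₂ _*ω_ refl (+A-sum k x k y))
        (trans (cong (pw k *ω_) (sym (*ω-distribˡ (pw k) x y)))
          (trans (sym (*ω-assoc (pw k) (pw k) (x +ω y))) (cong (_*ω (x +ω y)) (sym (pw-+ k k))))))

    ⊠-pair : ∀ k x l y → (k , x) ⊠ (l , y) ≡ (k + l , x *ω y)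
    ⊠-pair k x l y = refl

  record Mat : Set where
    constructor mat
    field
      den : ℕ
      m00 m01 m10 m11 : ℤω
  open Mat

  num : Mat → Bool → Bool → ℤω
  num M false false = m00 M
  num M false true = m01 M
  num M true false = m10 M
  num M true true = m11 M

  ent : Mat → Bool → Bool → Amp
  ent M r c = (den M , num M r c)

  infixl 7 _⊙_

  opaque
    _⊙_ : Mat → Mat → Mat
    A ⊙ B = mat (den A + den B)
      ((m00 A *ω m00 B) +ω (m01 A *ω m10 B)) ((m00 A *ω m01 B) +ω (m01 A *ω m11 B))
      ((m10 A *ω m00 B) +ω (m11 A *ω m10 B)) ((m10 A *ω m01 B) +ω (m11 A *ω m11 B))

    num-⊙ : ∀ A B r c → num (A ⊙ B) r c ≡ (num A r false *ω num B false c) +ω (num A r true *ω num B true c)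
    num-⊙ A B false false = refl
    num-⊙ A B false true = refl
    num-⊙ A B true false = refl
    num-⊙ A B true true = refl

    ent-⊙ : ∀ A B r c → ent (A ⊙ B) r c ≋ ent A r false ⊠ ent B false c ⊞ ent A r true ⊠ ent B true c
    ent-⊙ A B r c = ≋-trans (≋-reflexive (cong (den A + den B ,_) (num-⊙ A B r c)))
      (≋-trans (≋-sym (⊞-common (den A + den B) _ _))
        (⊞-cong (≋-reflexive (sym (⊠-pair (den A) (num A r false) (den B) (num B false c))))
                (≋-reflexive (sym (⊠-pair (den A) (num A r true) (den B) (num B true c))))))

  infix 4 _≈M_
  record _≈M_ (A B : Mat) : Set where
    constructor entrywise
    field
      entry : ∀ r c → ent A r c ≋ ent B r c
  open _≈M_ public

  ≈M-refl : ∀ {A} → A ≈M A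
  ≈M-refl .entry r c = ≋-refl

  ≈M-sym : ∀ {A B} → A ≈M B → B ≈M A
  ≈M-sym e .entry r c = ≋-sym (entry e r c)

  ≈M-trans : ∀ {A B C} → A ≈M B → B ≈M C → A ≈M C
  ≈M-trans e f .entry r c = ≋-trans (entry e r c) (entry f r c)

  ⊙-cong : ∀ {A A′ B B′} → A ≈M A′ → B ≈M B′ → A ⊙ B ≈M A′ ⊙ B′
  ⊙-cong {A} {A′} {B} {B′} e f .entry r c = ≋-trans (ent-⊙ A B r c) (≋-trans
    (⊞-cong (⊠-cong (entry e r false) (entry f false c)) (⊠-cong (entry e r true) (entry f true c)))
    (≋-sym (ent-⊙ A′ B′ r c)))

  ⊙-assoc : ∀ A B C → (A ⊙ B) ⊙ C ≈M A ⊙ (B ⊙ C)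
  ⊙-assoc A B C .entry r c = begin
    ent ((A ⊙ B) ⊙ C) r c
      ≈⟨ ent-⊙ (A ⊙ B) C r c ⟩
    ent (A ⊙ B) r false ⊠ ent C false c ⊞ ent (A ⊙ B) r true ⊠ ent C true c
      ≈⟨ ⊞-cong (⊠-cong (ent-⊙ A B r false) ≋-refl) (⊠-cong (ent-⊙ A B r true) ≋-refl) ⟩
    (ent A r false ⊠ ent B false false ⊞ ent A r true ⊠ ent B true false) ⊠ ent C false c
      ⊞ (ent A r false ⊠ ent B false true ⊞ ent A r true ⊠ ent B true true) ⊠ ent C true c
      ≈⟨ regroup (ent A r false) (ent A r true) (ent B false false) (ent B true false)
           (ent B false true) (ent B true true) (ent C false c) (ent C true c) ⟩
    ent A r false ⊠ (ent B false false ⊠ ent C false c ⊞ ent B false true ⊠ ent C true c)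
      ⊞ ent A r true ⊠ (ent B true false ⊠ ent C false c ⊞ ent B true true ⊠ ent C true c)
      ≈⟨ ⊞-cong (⊠-cong ≋-refl (ent-⊙ B C false c)) (⊠-cong ≋-refl (ent-⊙ B C true c)) ⟨
    ent A r false ⊠ ent (B ⊙ C) false c ⊞ ent A r true ⊠ ent (B ⊙ C) true c
      ≈⟨ ent-⊙ A (B ⊙ C) r c ⟨
    ent (A ⊙ (B ⊙ C)) r c ∎
    where
      open ≋-Reasoning
      regroup : ∀ a a′ p q s t x y → (a ⊠ p ⊞ a′ ⊠ q) ⊠ x ⊞ (a ⊠ s ⊞ a′ ⊠ t) ⊠ y
                                   ≋ a ⊠ (p ⊠ x ⊞ s ⊠ y) ⊞ a′ ⊠ (q ⊠ x ⊞ t ⊠ y)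
      regroup = solveA 8 (λ a a′ p q s t x y → (a :* p :+ a′ :* q) :* x :+ (a :* s :+ a′ :* t) :* y
                                   := a :* (p :* x :+ s :* y) :+ a′ :* (q :* x :+ t :* y)) ≋-refl

  private variable
    N : ℕ

  infix 4 _≈ψ_
  _≈ψ_ : State N → State N → Set
  ψ ≈ψ φ = ∀ v → ψ v ≋ φ v

  ≈ψ-refl : {ψ : State N} → ψ ≈ψ ψ
  ≈ψ-refl v = ≋-refl

  ≈ψ-sym : {ψ φ : State N} → ψ ≈ψ φ → φ ≈ψ ψ
  ≈ψ-sym e v = ≋-sym (e v)

  ≈ψ-trans : {ψ φ χ : State N} → ψ ≈ψ φ → φ ≈ψ χ → ψ ≈ψ χ
  ≈ψ-trans e f v = ≋-trans (e v) (f v)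

  Indep : {A : Set} → (Vec Bool N → A) → Fin N → Set
  Indep f q = ∀ v b → f (v [ q ]≔ b) ≡ f v

  -- The one-qubit operator diag(u false, u true) · X^b.
  mono : (Bool → Amp) → Bool → Bool → Bool → Amp
  mono u b r c = if (r xor b) xor c then 0A else u r

  row : Mat → Bool → Amp → Amp → Amp
  row A l x y = ent A l false ⊠ x ⊞ ent A l true ⊠ y

  row-cong : ∀ {A A′ l l′ x x′ y y′} → A ≡ A′ → l ≡ l′ → x ≡ x′ → y ≡ y′ → row A l x y ≡ row A′ l′ x′ y′
  row-cong refl refl refl refl = refl

  row-≋ : ∀ A l {x x′ y y′} → x ≋ x′ → y ≋ y′ → row A l x y ≋ row A l x′ y′
  row-≋ A l p q = ⊞-cong (⊠-cong ≋-refl p) (⊠-cong ≋-refl q)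

  row-⊙ : ∀ A B l x y → row A l (row B false x y) (row B true x y) ≋ row (A ⊙ B) l x y
  row-⊙ A B l x y = ≋-trans
    (regroup (ent A l false) (ent A l true) (ent B false false) (ent B false true) (ent B true false) (ent B true true) x y)
    (⊞-cong (⊠-cong (≋-sym (ent-⊙ A B l false)) ≋-refl) (⊠-cong (≋-sym (ent-⊙ A B l true)) ≋-refl))
    where
      regroup : ∀ a a′ p q s t x y → a ⊠ (p ⊠ x ⊞ q ⊠ y) ⊞ a′ ⊠ (s ⊠ x ⊞ t ⊠ y)
                                   ≋ (a ⊠ p ⊞ a′ ⊠ s) ⊠ x ⊞ (a ⊠ q ⊞ a′ ⊠ t) ⊠ y
      regroup = solveA 8 (λ a a′ p q s t x y → a :* (p :* x :+ q :* y) :+ a′ :* (s :* x :+ t :* y)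
                                   := (a :* p :+ a′ :* s) :* x :+ (a :* q :+ a′ :* t) :* y) ≋-refl

  row-swap : ∀ A B l k x y z w → row A l (row B k x y) (row B k z w) ≋ row B k (row A l x z) (row A l y w)
  row-swap A B l k = regroup (ent A l false) (ent A l true) (ent B k false) (ent B k true)
    where
      regroup : ∀ a a′ b b′ x y z w → a ⊠ (b ⊠ x ⊞ b′ ⊠ y) ⊞ a′ ⊠ (b ⊠ z ⊞ b′ ⊠ w)
                                    ≋ b ⊠ (a ⊠ x ⊞ a′ ⊠ z) ⊞ b′ ⊠ (a ⊠ y ⊞ a′ ⊠ w)
      regroup = solveA 8 (λ a a′ b b′ x y z w → a :* (b :* x :+ b′ :* y) :+ a′ :* (b :* z :+ b′ :* w)
                                    := b :* (a :* x :+ a′ :* z) :+ b′ :* (a :* y :+ a′ :* w)) ≋-refl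

  row-pull : ∀ A l c x y → row A l (c ⊠ x) (c ⊠ y) ≋ c ⊠ row A l x y
  row-pull A l c = pull (ent A l false) (ent A l true) c
    where
      pull : ∀ a b c x y → a ⊠ (c ⊠ x) ⊞ b ⊠ (c ⊠ y) ≋ c ⊠ (a ⊠ x ⊞ b ⊠ y)
      pull = solveA 5 (λ a b c x y → a :* (c :* x) :+ b :* (c :* y) := c :* (a :* x :+ b :* y)) ≋-refl

  opaque
    -- The matrix may depend on the other qubits, so controlled gates are of this form.
    op : (Vec Bool N → Mat) → Fin N → State N → State N
    op M q ψ v = row (M v) (lookup v q) (ψ (v [ q ]≔ false)) (ψ (v [ q ]≔ true))

    op-apply : ∀ (M : Vec Bool N → Mat) q ψ v → op M q ψ v ≡ row (M v) (lookup v q) (ψ (v [ q ]≔ false)) (ψ (v [ q ]≔ true))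
    op-apply M q ψ v = refl

  op-by : ∀ (M : Vec Bool N → Mat) q ψ v {x} → row (M v) (lookup v q) (ψ (v [ q ]≔ false)) (ψ (v [ q ]≔ true)) ≋ x → op M q ψ v ≋ x
  op-by M q ψ v h = ≋-trans (≋-reflexive (op-apply M q ψ v)) h

  op-cong : ∀ {M M′ : Vec Bool N → Mat} {q} {ψ φ : State N} → (∀ v → M v ≈M M′ v) → ψ ≈ψ φ → op M q ψ ≈ψ op M′ q φ
  op-cong {M = M} {M′} {q} {ψ} {φ} eM e v = op-by M q ψ v
    (≋-trans (⊞-cong (⊠-cong (entry (eM v) (lookup v q) false) (e _)) (⊠-cong (entry (eM v) (lookup v q) true) (e _)))
      (≋-reflexive (sym (op-apply M′ q φ v))))

  -- Only the inner matrix has to ignore `q`: it is evaluated where `q` has been overwritten by a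
  -- summation index, whereas the outer matrix is evaluated at `v` itself.
  op-fuse : ∀ {M M′ : Vec Bool N → Mat} {q} → Indep M′ q → ∀ ψ → op M q (op M′ q ψ) ≈ψ op (λ v → M v ⊙ M′ v) q ψ
  op-fuse {M = M} {M′} {q} ind ψ v = op-by M q (op M′ q ψ) v
    (≋-trans (row-≋ (M v) (lookup v q) (inner false) (inner true))
      (≋-trans (row-⊙ (M v) (M′ v) (lookup v q) (ψ (v [ q ]≔ false)) (ψ (v [ q ]≔ true)))
        (≋-reflexive (sym (op-apply (λ v → M v ⊙ M′ v) q ψ v)))))
    where
      inner : ∀ b → op M′ q ψ (v [ q ]≔ b) ≋ row (M′ v) b (ψ (v [ q ]≔ false)) (ψ (v [ q ]≔ true))
      inner b = op-by M′ q ψ (v [ q ]≔ b) (≋-reflexive (row-cong (ind v b) (VecP.lookup∘update q v b)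
        (cong ψ (VecP.[]≔-idempotent v q)) (cong ψ (VecP.[]≔-idempotent v q))))

  op-comm : ∀ {M M′ : Vec Bool N → Mat} {q q′} → q ≢ q′ → Indep M q′ → Indep M′ q →
            ∀ ψ → op M q (op M′ q′ ψ) ≈ψ op M′ q′ (op M q ψ)
  op-comm {M = M} {M′} {q} {q′} q≢q′ ind ind′ ψ v = op-by M q (op M′ q′ ψ) v
    (≋-trans (row-≋ (M v) (lookup v q) (inner false) (inner true))
      (≋-trans (row-swap (M v) (M′ v) (lookup v q) (lookup v q′) (ψ₂ false false) (ψ₂ false true) (ψ₂ true false) (ψ₂ true true))
        (≋-trans (row-≋ (M′ v) (lookup v q′) (≋-sym (inner′ false)) (≋-sym (inner′ true)))
          (≋-reflexive (sym (op-apply M′ q′ (op M q ψ) v))))))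
    where
      ψ₂ : Bool → Bool → Amp
      ψ₂ x y = ψ ((v [ q ]≔ x) [ q′ ]≔ y)
      inner : ∀ x → op M′ q′ ψ (v [ q ]≔ x) ≋ row (M′ v) (lookup v q′) (ψ₂ x false) (ψ₂ x true)
      inner x = op-by M′ q′ ψ (v [ q ]≔ x) (≋-reflexive (row-cong (ind′ v x) (VecP.lookup∘update′ (λ e → q≢q′ (sym e)) v x) refl refl))
      inner′ : ∀ y → op M q ψ (v [ q′ ]≔ y) ≋ row (M v) (lookup v q) (ψ₂ false y) (ψ₂ true y)
      inner′ y = op-by M q ψ (v [ q′ ]≔ y) (≋-reflexive (row-cong (ind v y) (VecP.lookup∘update′ q≢q′ v y)
        (cong ψ (sym (VecP.[]≔-commutes v q q′ q≢q′))) (cong ψ (sym (VecP.[]≔-commutes v q q′ q≢q′)))))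

  -- A row of a monomial matrix has one nonzero entry, so the sum over the two values of qubit `q`
  -- collapses. Phase gates, controlled flips and the relative-phase Toffoli gate are all used in
  -- this form.
  op-mono : ∀ {M : Vec Bool N → Mat} {q} (u : Vec Bool N → Bool → Amp) (b : Vec Bool N → Bool) →
            (∀ v r c → ent (M v) r c ≋ mono (u v) (b v) r c) →
            ∀ ψ → op M q ψ ≈ψ λ v → u v (lookup v q) ⊠ ψ (v [ q ]≔ (lookup v q xor b v))
  op-mono {M = M} {q} u b e ψ v = op-by M q ψ v (
    ≋-trans (⊞-cong (⊠-cong (e v (lookup v q) false) ≋-refl) (⊠-cong (e v (lookup v q) true) ≋-refl))
      (pick (lookup v q) (b v)))
    where
      left : ∀ x y z → x ⊠ y ⊞ 0A ⊠ z ≋ x ⊠ y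
      left x y z = ≋-trans (⊞-cong ≋-refl (⊠-zeroˡ z)) (CommutativeRing.+-identityʳ Amp-ring _)
      right : ∀ x y z → 0A ⊠ z ⊞ x ⊠ y ≋ x ⊠ y
      right x y z = ≋-trans (⊞-cong (⊠-zeroˡ z) ≋-refl) (⊞-identityˡ _)
      pick : ∀ r b → mono (u v) b r false ⊠ ψ (v [ q ]≔ false) ⊞ mono (u v) b r true ⊠ ψ (v [ q ]≔ true)
                   ≋ u v r ⊠ ψ (v [ q ]≔ (r xor b))
      pick false false = left _ _ _
      pick false true = right _ _ _
      pick true false = right _ _ _
      pick true true = left _ _ _

  op-id : ∀ {M : Vec Bool N → Mat} {q} → (∀ v r c → ent (M v) r c ≋ mono (λ _ → 1A) false r c) → ∀ ψ → op M q ψ ≈ψ ψ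
  op-id {M = M} {q} e ψ v = ≋-trans (op-mono (λ _ _ → 1A) (λ _ → false) e ψ v)
    (≋-trans (⊠-identityˡ _) (≋-reflexive (cong ψ (trans (cong (v [ q ]≔_) (xor-false (lookup v q))) (VecP.[]≔-lookup v q)))))
    where
      xor-false : ∀ x → x xor false ≡ x
      xor-false false = refl
      xor-false true = refl

  opaque
    unfolding op

    diag : (Vec Bool N → Amp) → State N → State N
    diag χ ψ v = χ v ⊠ ψ v

    diag-cong : ∀ {χ χ′} {ψ φ : State N} → (∀ v → χ v ≋ χ′ v) → ψ ≈ψ φ → diag χ ψ ≈ψ diag χ′ φ
    diag-cong eχ e v = ⊠-cong (eχ v) (e v)

    diag-fuse : ∀ χ χ′ (ψ : State N) → diag χ (diag χ′ ψ) ≈ψ diag (λ v → χ v ⊠ χ′ v) ψ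
    diag-fuse χ χ′ ψ v = ≋-sym (⊠-assoc _ _ _)

    diag-apply : ∀ χ (ψ : State N) v → diag χ ψ v ≡ χ v ⊠ ψ v
    diag-apply χ ψ v = refl

  op-diag-comm : ∀ {M : Vec Bool N → Mat} {q χ} → (∀ v b → χ (v [ q ]≔ b) ≋ χ v) →
                 ∀ ψ → op M q (diag χ ψ) ≈ψ diag χ (op M q ψ)
  op-diag-comm {M = M} {q} {χ} ind ψ v = op-by M q (diag χ ψ) v (≋-trans
    (row-≋ (M v) (lookup v q) (at false) (at true))
    (≋-trans (row-pull (M v) (lookup v q) (χ v) (ψ (v [ q ]≔ false)) (ψ (v [ q ]≔ true)))
      (≋-trans (⊠-cong ≋-refl (≋-reflexive (sym (op-apply M q ψ v)))) (≋-reflexive (sym (diag-apply χ (op M q ψ) v))))))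
    where
      at : ∀ b → diag χ ψ (v [ q ]≔ b) ≋ χ v ⊠ ψ (v [ q ]≔ b)
      at b = ≋-trans (≋-reflexive (diag-apply χ ψ (v [ q ]≔ b))) (⊠-cong (ind v b) ≋-refl)

  module Parallel {N : ℕ} {I : Set} (t : I → Fin N) where

    Apart : List I → Set
    Apart = AllPairs (λ i j → t i ≢ t j)

    IndepAll : {A : Set} → (I → Vec Bool N → A) → Set
    IndepAll f = ∀ i j → Indep (f i) (t j)

    opaque
      par : (I → Vec Bool N → Mat) → List I → State N → State N
      par M xs ψ = foldr (λ i φ → op (M i) (t i) φ) ψ xs

      par-cong : ∀ {M M′} xs {ψ φ} → (∀ i v → M i v ≈M M′ i v) → ψ ≈ψ φ → par M xs ψ ≈ψ par M′ xs φ
      par-cong [] eM e = e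
      par-cong (x ∷ xs) eM e = op-cong (eM x) (par-cong xs eM e)

      par-congʳ : ∀ {M} xs {ψ φ} → ψ ≈ψ φ → par M xs ψ ≈ψ par M xs φ
      par-congʳ {M} xs = par-cong xs (λ i v → ≈M-refl {M i v})

      op-congʳ : ∀ {M : Vec Bool N → Mat} {q} {ψ φ : State N} → ψ ≈ψ φ → op M q ψ ≈ψ op M q φ
      op-congʳ {M} = op-cong (λ v → ≈M-refl {M v})

      par-op-comm : ∀ {A : Vec Bool N → Mat} {q M} xs → All (λ i → q ≢ t i) xs → (∀ i → Indep A (t i)) → (∀ i → Indep (M i) q) →
                    ∀ ψ → op A q (par M xs ψ) ≈ψ par M xs (op A q ψ)
      par-op-comm [] _ _ _ ψ = ≈ψ-refl
      par-op-comm (x ∷ xs) (q≢ ∷ qs) iA iM ψ =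
        ≈ψ-trans (op-comm q≢ (iA x) (iM x) _) (op-congʳ (par-op-comm xs qs iA iM ψ))

      -- Since the targets are distinct and no matrix reads a target, the gate `M′ x` can pass the
      -- other gates of the outer layer and meet `M x`. This is what reduces circuits to products of
      -- 2×2 matrices.
      par-fuse : ∀ {M M′} xs → Apart xs → IndepAll M → IndepAll M′ → ∀ ψ →
                 par M xs (par M′ xs ψ) ≈ψ par (λ i v → M i v ⊙ M′ i v) xs ψ
      par-fuse [] _ _ _ ψ = ≈ψ-refl
      par-fuse {M} {M′} (x ∷ xs) (a ∷ as) iM iM′ ψ =
        ≈ψ-trans (op-congʳ (≈ψ-sym (par-op-comm xs a (iM′ x) (λ i → iM i x) _)))
          (≈ψ-trans (op-fuse (iM′ x x) _) (op-congʳ (par-fuse xs as iM iM′ ψ)))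

      -- The alternative is taken qubit by qubit: where χ depends on a target, the gate there must
      -- be the identity. A layer of Hadamard gates selected by bits needs exactly this.
      par-diag-comm : ∀ {M χ} xs → (∀ i → (∀ v b → χ (v [ t i ]≔ b) ≋ χ v) ⊎ (∀ v r c → ent (M i v) r c ≋ mono (λ _ → 1A) false r c)) →
                      ∀ ψ → par M xs (diag χ ψ) ≈ψ diag χ (par M xs ψ)
      par-diag-comm [] h ψ = ≈ψ-refl
      par-diag-comm {M} {χ} (x ∷ xs) h ψ = ≈ψ-trans (op-congʳ (par-diag-comm xs h ψ)) (step (h x))
        where
          step : (∀ v b → χ (v [ t x ]≔ b) ≋ χ v) ⊎ (∀ v r c → ent (M x v) r c ≋ mono (λ _ → 1A) false r c) →
                 op (M x) (t x) (diag χ (par M xs ψ)) ≈ψ diag χ (op (M x) (t x) (par M xs ψ))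
          step (inj₁ ind) = op-diag-comm ind _
          step (inj₂ one) v = ≋-trans (op-id one _ v) (diag-cong (λ _ → ≋-refl) (≈ψ-sym (op-id one _)) v)

      par-diag : ∀ {M} (u : I → Vec Bool N → Bool → Amp) xs → (∀ i v r c → ent (M i v) r c ≋ mono (u i v) false r c) →
                 ∀ ψ → par M xs ψ ≈ψ diag (λ v → foldr (λ i → u i v (lookup v (t i)) ⊠_) 1A xs) ψ
      par-diag u [] e ψ v = ≋-sym (≋-trans (≋-reflexive (diag-apply _ ψ v)) (⊠-identityˡ _))
      par-diag {M} u (x ∷ xs) e ψ v = ≋-trans (op-mono (u x) (λ _ → false) (e x) _ v)
        (≋-trans (⊠-cong ≋-refl (≋-trans (≋-reflexive (cong (par M xs ψ) same)) (≋-trans (par-diag u xs e ψ v) (≋-reflexive (diag-apply _ ψ v)))))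
          (≋-trans (≋-sym (⊠-assoc _ _ _)) (≋-reflexive (sym (diag-apply _ ψ v)))))
        where
          xor-false : ∀ x → x xor false ≡ x
          xor-false false = refl
          xor-false true = refl
          same : v [ t x ]≔ (lookup v (t x) xor false) ≡ v
          same = trans (cong (v [ t x ]≔_) (xor-false _)) (VecP.[]≔-lookup v (t x))

      flips : (I → Vec Bool N → Bool) → List I → Vec Bool N → Vec Bool N
      flips b [] v = v
      flips b (x ∷ xs) v = flips b xs (v [ t x ]≔ (lookup v (t x) xor b x v))

      lookup-flips-other : ∀ b xs v c → All (λ i → c ≢ t i) xs → lookup (flips b xs v) c ≡ lookup v c
      lookup-flips-other b [] v c [] = refl
      lookup-flips-other b (x ∷ xs) v c (c≢ ∷ cs) = trans (lookup-flips-other b xs _ c cs) (VecP.lookup∘update′ c≢ v _)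

      lookup-flips : ∀ b → IndepAll b → ∀ xs → Apart xs → ∀ v → All (λ i → lookup (flips b xs v) (t i) ≡ lookup v (t i) xor b i v) xs
      lookup-flips b ib [] [] v = []
      lookup-flips b ib (x ∷ xs) (a ∷ as) v =
        trans (lookup-flips-other b xs _ (t x) a) (VecP.lookup∘update (t x) v _)
        ∷ All.zipWith (λ { {i} (p , x≢) → trans p (cong₂ _xor_ (VecP.lookup∘update′ (λ e → x≢ (sym e)) v _) (ib i x v _)) })
            (lookup-flips b ib xs as _ , a)

      -- Gates phase·X^b flip bits in the argument of the diagonal, and their phases cancel.
      par-conj : ∀ {M⁻ M⁺} (b : I → Vec Bool N → Bool) (u⁻ u⁺ : I → Vec Bool N → Bool → Amp) →
                 (∀ i v r c → ent (M⁻ i v) r c ≋ mono (u⁻ i v) (b i v) r c) →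
                 (∀ i v r c → ent (M⁺ i v) r c ≋ mono (u⁺ i v) (b i v) r c) →
                 (∀ i v r → u⁻ i v r ⊠ u⁺ i v (r xor b i v) ≋ 1A) →
                 IndepAll M⁺ → (∀ i → Indep (b i) (t i)) → (∀ i → Indep (u⁺ i) (t i)) →
                 ∀ xs → Apart xs → ∀ χ ψ → par M⁻ xs (diag χ (par M⁺ xs ψ)) ≈ψ diag (λ v → χ (flips b xs v)) ψ
      par-conj b u⁻ u⁺ e⁻ e⁺ inv iM⁺ ib iu [] _ χ ψ = ≈ψ-refl
      par-conj {M⁻} {M⁺} b u⁻ u⁺ e⁻ e⁺ inv iM⁺ ib iu (x ∷ xs) (a ∷ as) χ ψ =
        -- The gate `M⁺ x` moves inside `par M⁺ xs`, so the induction hypothesis applies to the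
        -- state `op (M⁺ x) (t x) ψ`. What remains is the pair of gates at `t x`, whose flips undo
        -- each other.
        ≈ψ-trans (op-congʳ (par-congʳ xs (diag-cong (λ _ → ≋-refl) (par-op-comm xs a (iM⁺ x) (λ i → iM⁺ i x) ψ))))
          (≈ψ-trans (op-congʳ (par-conj b u⁻ u⁺ e⁻ e⁺ inv iM⁺ ib iu xs as χ (op (M⁺ x) (t x) ψ)))
            (λ v → ≋-trans (op-mono (u⁻ x) (b x) (e⁻ x) _ v)
              (≋-trans (⊠-cong ≋-refl (≋-trans (≋-reflexive (diag-apply _ _ _)) (⊠-cong ≋-refl (≋-trans (op-mono (u⁺ x) (b x) (e⁺ x) ψ _) (≋-reflexive (at v))))))
                (≋-trans (cancel (u⁻ x v (lookup v (t x))) _ (u⁺ x v (lookup v (t x) xor b x v)) (ψ v))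
                  (≋-trans (⊠-cong (inv x v (lookup v (t x))) ≋-refl) (≋-trans (⊠-identityˡ _) (≋-reflexive (sym (diag-apply _ ψ v)))))))))
        where
          q : Fin N
          q = t x
          xor-involutive : ∀ r c → (r xor c) xor c ≡ r
          xor-involutive false false = refl
          xor-involutive false true = refl
          xor-involutive true false = refl
          xor-involutive true true = refl
          at : ∀ v → let w = v [ q ]≔ (lookup v q xor b x v) in
               u⁺ x w (lookup w q) ⊠ ψ (w [ q ]≔ (lookup w q xor b x w)) ≡ u⁺ x v (lookup v q xor b x v) ⊠ ψ v
          at v = cong₂ _⊠_ (trans (cong (λ f → f (lookup w q)) (iu x v _)) (cong (u⁺ x v) look))
            (cong ψ (trans (cong₂ (λ r c → w [ q ]≔ (r xor c)) look (ib x v _))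
              (trans (cong (w [ q ]≔_) (xor-involutive (lookup v q) (b x v)))
                (trans (VecP.[]≔-idempotent v q) (VecP.[]≔-lookup v q)))))
            where
              w : Vec Bool N
              w = v [ q ]≔ (lookup v q xor b x v)
              look : lookup w q ≡ lookup v q xor b x v
              look = VecP.lookup∘update q v _
          cancel : ∀ a c d y → a ⊠ (c ⊠ (d ⊠ y)) ≋ (a ⊠ d) ⊠ (c ⊠ y)
          cancel = solveA 4 (λ a c d y → a :* (c :* (d :* y)) := (a :* d) :* (c :* y)) ≋-refl

-- Matrix words for the switched gates, and the placed gates as operators.

module GateMatrices where
  open Amplitudes
  open Operators
  open CommutativeRing Amp-ring using () renaming (*-identityʳ to ⊠-identityʳ; +-identityʳ to ⊞-identityʳ)

  private variable
    N : ℕ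

  I₂ HM TM₂ : Mat
  I₂ = mat 0 1ω 0ω 0ω 1ω
  HM = mat 1 1ω 1ω 1ω (negω 1ω)
  TM₂ = mat 0 1ω 0ω 0ω ωω

  XM : Bool → Mat
  XM b = if b then mat 0 0ω 1ω 1ω 0ω else I₂

  -- Gates are listed in the order of application.
  seq : List Mat → Mat
  seq [] = I₂
  seq (M ∷ Ms) = seq Ms ⊙ M

  -- On the Bloch sphere, T X T† = (X + Y)/√2, and conjugation by H S H fixes X and sends Y to Z. So
  -- B = H S H T carries X to (X + Z)/√2 = H. The word applies B⁻¹, then X^τ, then B, with S† and T†
  -- as powers of T.
  programmableH : Bool → List Mat
  programmableH τ = HM ∷ replicate 6 TM₂ ++ HM ∷ replicate 7 TM₂ ++ XM τ ∷ TM₂ ∷ HM ∷ TM₂ ∷ TM₂ ∷ HM ∷ []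

  HM^ : Bool → Mat
  HM^ b = if b then HM else I₂

  -- The relative-phase Toffoli gate is (-iX)^{f∧p}, a group commutator of X^p and
  -- T X^f T† conjugated by H.
  toffoli toffoli⁻¹ : Bool → Bool → List Mat
  toffoli f p = HM ∷ XM p ∷ replicate 7 TM₂ ++ XM f ∷ TM₂ ∷ XM p ∷ replicate 7 TM₂ ++ XM f ∷ TM₂ ∷ HM ∷ []
  toffoli⁻¹ f p = HM ∷ replicate 7 TM₂ ++ XM f ∷ TM₂ ∷ XM p ∷ replicate 7 TM₂ ++ XM f ∷ TM₂ ∷ XM p ∷ HM ∷ []

  iA -iA : Amp
  iA = (0 , mulω (mulω 1ω))
  -iA = negA iA

  T†M S†M : Mat
  T†M = mat 0 1ω 0ω 0ω (negω (mulω (mulω (mulω 1ω))))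
  S†M = mat 0 1ω 0ω 0ω (negω (mulω (mulω 1ω)))

  ent-ext : ∀ {A B} → ent A false false ≋ ent B false false → ent A false true ≋ ent B false true →
            ent A true false ≋ ent B true false → ent A true true ≋ ent B true true → A ≈M B
  ent-ext p q r s .entry false false = p
  ent-ext p q r s .entry false true = q
  ent-ext p q r s .entry true false = r
  ent-ext p q r s .entry true true = s

  opaque
    unfolding _≋_ _*ω_ _⊙_

    ⊙-identityʳ : ∀ A → A ⊙ I₂ ≈M A
    ⊙-identityʳ A .entry r c = ≋-trans {ent (A ⊙ I₂) r c} {ent A r false ⊠ ent I₂ false c ⊞ ent A r true ⊠ ent I₂ true c} {ent A r c} (ent-⊙ A I₂ r c) (pick c)
      where
        pick : ∀ c → ent A r false ⊠ ent I₂ false c ⊞ ent A r true ⊠ ent I₂ true c ≋ ent A r c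
        pick false = ≋-trans {ent A r false ⊠ 1A ⊞ ent A r true ⊠ 0A} {ent A r false ⊞ 0A}
          (⊞-cong {ent A r false ⊠ 1A} {ent A r false} {ent A r true ⊠ 0A} {0A} (⊠-identityʳ (ent A r false)) (⊠-zeroʳ (ent A r true))) (⊞-identityʳ (ent A r false))
        pick true = ≋-trans {ent A r false ⊠ 0A ⊞ ent A r true ⊠ 1A} {0A ⊞ ent A r true}
          (⊞-cong {ent A r false ⊠ 0A} {0A} {ent A r true ⊠ 1A} {ent A r true} (⊠-zeroʳ (ent A r false)) (⊠-identityʳ (ent A r true))) (⊞-identityˡ (ent A r true))

    T⁷ : seq (replicate 7 TM₂) ≈M T†M
    T⁷ = ent-ext {seq (replicate 7 TM₂)} {T†M} refl refl refl refl

    T⁶ : seq (replicate 6 TM₂) ≈M S†M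
    T⁶ = ent-ext {seq (replicate 6 TM₂)} {S†M} refl refl refl refl

    programmableH-product : ∀ τ → seq (HM ∷ S†M ∷ HM ∷ T†M ∷ XM τ ∷ TM₂ ∷ HM ∷ TM₂ ∷ TM₂ ∷ HM ∷ []) ≈M HM^ τ
    programmableH-product false = ent-ext {seq (HM ∷ S†M ∷ HM ∷ T†M ∷ XM false ∷ TM₂ ∷ HM ∷ TM₂ ∷ TM₂ ∷ HM ∷ [])} {HM^ false} refl refl refl refl
    programmableH-product true = ent-ext {seq (HM ∷ S†M ∷ HM ∷ T†M ∷ XM true ∷ TM₂ ∷ HM ∷ TM₂ ∷ TM₂ ∷ HM ∷ [])} {HM^ true} refl refl refl refl

    toffoli-product : ∀ f p r c → ent (seq (HM ∷ XM p ∷ T†M ∷ XM f ∷ TM₂ ∷ XM p ∷ T†M ∷ XM f ∷ TM₂ ∷ HM ∷ [])) r c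
                                ≋ mono (λ _ → if f ∧ p then -iA else 1A) (f ∧ p) r c
    toffoli-product false false false false = refl
    toffoli-product false false false true = refl
    toffoli-product false false true false = refl
    toffoli-product false false true true = refl
    toffoli-product false true false false = refl
    toffoli-product false true false true = refl
    toffoli-product false true true false = refl
    toffoli-product false true true true = refl
    toffoli-product true false false false = refl
    toffoli-product true false false true = refl
    toffoli-product true false true false = refl
    toffoli-product true false true true = refl
    toffoli-product true true false false = refl
    toffoli-product true true false true = refl
    toffoli-product true true true false = refl
    toffoli-product true true true true = refl

    toffoli⁻¹-product : ∀ f p r c → ent (seq (HM ∷ T†M ∷ XM f ∷ TM₂ ∷ XM p ∷ T†M ∷ XM f ∷ TM₂ ∷ XM p ∷ HM ∷ [])) r c
                                  ≋ mono (λ _ → if f ∧ p then iA else 1A) (f ∧ p) r c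
    toffoli⁻¹-product false false false false = refl
    toffoli⁻¹-product false false false true = refl
    toffoli⁻¹-product false false true false = refl
    toffoli⁻¹-product false false true true = refl
    toffoli⁻¹-product false true false false = refl
    toffoli⁻¹-product false true false true = refl
    toffoli⁻¹-product false true true false = refl
    toffoli⁻¹-product false true true true = refl
    toffoli⁻¹-product true false false false = refl
    toffoli⁻¹-product true false false true = refl
    toffoli⁻¹-product true false true false = refl
    toffoli⁻¹-product true false true true = refl
    toffoli⁻¹-product true true false false = refl
    toffoli⁻¹-product true true false true = refl
    toffoli⁻¹-product true true true false = refl
    toffoli⁻¹-product true true true true = refl

  seq-++ : ∀ Ms Ns → seq (Ms ++ Ns) ≈M seq Ns ⊙ seq Ms
  seq-++ [] Ns = ≈M-sym (⊙-identityʳ (seq Ns))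
  seq-++ (M ∷ Ms) Ns = ≈M-trans (⊙-cong (seq-++ Ms Ns) (≈M-refl {M})) (⊙-assoc (seq Ns) (seq Ms) M)

  -- Rewriting of gate words: a block such as T⁷ is replaced by the single matrix that it equals, so
  -- that the products which are compared entry by entry through computation stay short.
  data _⟶_ : List Mat → List Mat → Set where
    keep : ∀ {Ns} → Ns ⟶ Ns
    next : ∀ {M Ns Ns′} → Ns ⟶ Ns′ → (M ∷ Ns) ⟶ (M ∷ Ns′)
    merge : ∀ Ms {N Ns Ns′} → seq Ms ≈M N → Ns ⟶ Ns′ → (Ms ++ Ns) ⟶ (N ∷ Ns′)

  ⟶-sound : ∀ {Ms Ns} → Ms ⟶ Ns → seq Ms ≈M seq Ns
  ⟶-sound keep = ≈M-refl
  ⟶-sound (next {M} s) = ⊙-cong (⟶-sound s) (≈M-refl {M})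
  ⟶-sound (merge Ms {N} {Ns} e s) = ≈M-trans (seq-++ Ms Ns) (⊙-cong (⟶-sound s) e)

  programmableH-merge : ∀ τ → programmableH τ ⟶ (HM ∷ S†M ∷ HM ∷ T†M ∷ XM τ ∷ TM₂ ∷ HM ∷ TM₂ ∷ TM₂ ∷ HM ∷ [])
  programmableH-merge τ = next (merge (replicate 6 TM₂) T⁶ (next (merge (replicate 7 TM₂) T⁷ keep)))

  seq-programmableH : ∀ τ → seq (programmableH τ) ≈M HM^ τ
  seq-programmableH τ = ≈M-trans
    (⟶-sound (programmableH-merge τ))
    (programmableH-product τ)

  toffoli-merge : ∀ f p → toffoli f p ⟶ (HM ∷ XM p ∷ T†M ∷ XM f ∷ TM₂ ∷ XM p ∷ T†M ∷ XM f ∷ TM₂ ∷ HM ∷ [])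
  toffoli-merge f p = next (next (merge (replicate 7 TM₂) T⁷ (next (next (next (merge (replicate 7 TM₂) T⁷ keep))))))

  toffoli⁻¹-merge : ∀ f p → toffoli⁻¹ f p ⟶ (HM ∷ T†M ∷ XM f ∷ TM₂ ∷ XM p ∷ T†M ∷ XM f ∷ TM₂ ∷ XM p ∷ HM ∷ [])
  toffoli⁻¹-merge f p = next (merge (replicate 7 TM₂) T⁷ (next (next (next (merge (replicate 7 TM₂) T⁷ keep)))))

  seq-toffoli : ∀ f p r c → ent (seq (toffoli f p)) r c ≋ mono (λ _ → if f ∧ p then -iA else 1A) (f ∧ p) r c
  seq-toffoli f p r c = ≋-trans (entry (⟶-sound (toffoli-merge f p)) r c) (toffoli-product f p r c)

  seq-toffoli⁻¹ : ∀ f p r c → ent (seq (toffoli⁻¹ f p)) r c ≋ mono (λ _ → if f ∧ p then iA else 1A) (f ∧ p) r c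
  seq-toffoli⁻¹ f p r c = ≋-trans (entry (⟶-sound (toffoli⁻¹-merge f p)) r c) (toffoli⁻¹-product f p r c)

  sgn : Bool → Amp
  sgn b = if b then negA 1A else 1A

  ω^ : ℕ → Amp
  ω^ zero = 1A
  ω^ (suc k) = ωA (ω^ k)

  opaque
    unfolding _≋_ _*ω_ _⊙_

    toffoli-phases : ∀ b → (if b then iA else 1A) ⊠ (if b then -iA else 1A) ≋ 1A
    toffoli-phases false = refl
    toffoli-phases true = refl

    HXH : ∀ b r c → ent (seq (HM ∷ XM b ∷ HM ∷ [])) r c ≋ mono (λ r → sgn (b ∧ r)) false r c
    HXH false false false = refl
    HXH false false true = refl
    HXH false true false = refl
    HXH false true true = refl
    HXH true false false = refl
    HXH true false true = refl
    HXH true true false = refl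
    HXH true true true = refl

    HM^-xor : ∀ a b → HM^ a ⊙ HM^ b ≈M HM^ (a xor b)
    HM^-xor false false = ent-ext {HM^ false ⊙ HM^ false} {I₂} refl refl refl refl
    HM^-xor false true = ent-ext {HM^ false ⊙ HM^ true} {HM} refl refl refl refl
    HM^-xor true false = ent-ext {HM^ true ⊙ HM^ false} {HM} refl refl refl refl
    HM^-xor true true = ent-ext {HM^ true ⊙ HM^ true} {I₂} refl refl refl refl

    XM-mono : ∀ b r c → ent (XM b) r c ≋ mono (λ _ → 1A) b r c
    XM-mono false false false = refl
    XM-mono false false true = refl
    XM-mono false true false = refl
    XM-mono false true true = refl
    XM-mono true false false = refl
    XM-mono true false true = refl
    XM-mono true true false = refl
    XM-mono true true true = refl

    TM-mono : ∀ r c → ent TM₂ r c ≋ mono (λ r → if r then ω^ 1 else 1A) false r c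
    TM-mono false false = refl
    TM-mono false true = refl
    TM-mono true false = refl
    TM-mono true true = refl

    T⁵-mono : ∀ r c → ent (seq (replicate 5 TM₂)) r c ≋ mono (λ r → if r then ω^ 5 else 1A) false r c
    T⁵-mono false false = refl
    T⁵-mono false true = refl
    T⁵-mono true false = refl
    T⁵-mono true true = refl

    ωA-⊠ : ∀ x → ω^ 1 ⊠ x ≋ ωA x
    ωA-⊠ (k , x) = from≡ {k} {k} {ωω *ω x} {mulω x} refl (sym (mulω-* x))

    sgn-T⁵ : sgn true ⊠ ω^ 5 ≋ ω^ 1
    sgn-T⁵ = refl

    sgn-xor : ∀ a b → sgn (a xor b) ≋ sgn a ⊠ sgn b
    sgn-xor false false = refl
    sgn-xor false true = refl
    sgn-xor true false = refl
    sgn-xor true true = refl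

  opaque
    unfolding _≋_

    neg-⊠ : ∀ k x → (k , negω 1ω) ⊠ x ≋ (k , 1ω) ⊠ ⊟ x
    neg-⊠ k (l , x) = from≡ {k + l} {k + l} {negω 1ω *ω x} {1ω *ω negω x} refl (trans (sym (-‿distribˡ-* 1ω x)) (-‿distribʳ-* 1ω x))

    div√2-⊠ : ∀ x → (1 , 1ω) ⊠ x ≋ div√2 x
    div√2-⊠ (k , x) = from≡ {suc k} {suc k} {1ω *ω x} {x} refl (*ω-identityˡ x)

    pH-rule : ∀ {g} (q : Fin N) ψ v → applyPlaced {g} (pH q) ψ v ≡
              div√2 (ψ (v [ q ]≔ false) ⊞ (if lookup v q then ⊟ (ψ (v [ q ]≔ true)) else ψ (v [ q ]≔ true)))
    pH-rule q ψ v = refl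

  pH-op : ∀ {g} (q : Fin N) ψ → applyPlaced {g} (pH q) ψ ≈ψ op (λ _ → HM) q ψ
  pH-op {g = g} q ψ v = ≋-sym (op-by (λ _ → HM) q ψ v (≋-trans (pick (lookup v q) (ψ (v [ q ]≔ false)) (ψ (v [ q ]≔ true)))
    (≋-trans (div√2-⊠ _) (≋-reflexive (sym (pH-rule {g = g} q ψ v))))))
    where
      pick : ∀ b x y → row HM b x y ≋ (1 , 1ω) ⊠ (x ⊞ (if b then ⊟ y else y))
      pick false x y = ≋-sym (⊠-distribˡ (1 , 1ω) x y)
      pick true x y = ≋-trans (⊞-cong ≋-refl (neg-⊠ 1 y)) (≋-sym (⊠-distribˡ (1 , 1ω) x (⊟ y)))

  X-op : ∀ (b : Vec Bool N → Bool) q ψ → op (λ v → XM (b v)) q ψ ≈ψ λ v → ψ (v [ q ]≔ (lookup v q xor b v))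
  X-op b q ψ v = ≋-trans (op-mono (λ _ _ → 1A) b (λ v → XM-mono (b v)) ψ v) (⊠-identityˡ _)

  pT-op : ∀ {g} (q : Fin N) ψ → applyPlaced {g} (pT q) ψ ≈ψ op (λ _ → TM₂) q ψ
  pT-op q ψ v = ≋-sym (≋-trans (op-mono (λ _ r → if r then ω^ 1 else 1A) (λ _ → false) (λ _ → TM-mono) ψ v)
    (≋-trans (⊠-cong ≋-refl (≋-reflexive (cong ψ same))) (pick (lookup v q))))
    where
      xor-false : ∀ x → x xor false ≡ x
      xor-false false = refl
      xor-false true = refl
      same : v [ q ]≔ (lookup v q xor false) ≡ v
      same = trans (cong (v [ q ]≔_) (xor-false _)) (VecP.[]≔-lookup v q)
      pick : ∀ b → (if b then ω^ 1 else 1A) ⊠ ψ v ≋ (if b then ωA (ψ v) else ψ v)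
      pick false = ⊠-identityˡ _
      pick true = ωA-⊠ _

  pTof-op : ∀ k (cs : Vec (Fin N) (suc k)) t ψ → applyPlaced (pTof k cs t) ψ ≈ψ op (λ v → XM (allOn cs v)) t ψ
  pTof-op k cs t ψ = ≈ψ-sym (X-op (allOn cs) t ψ)

  fanPerm-update : ∀ {k} b (ts : Vec (Fin N) k) t x v → All (t ≢_) (Vec.toList ts) →
                   fanPerm b ts (v [ t ]≔ x) ≡ fanPerm b ts v [ t ]≔ x
  fanPerm-update b [] t x v [] = refl
  fanPerm-update b (s ∷ ts) t x v (t≢s ∷ t∉) rewrite fanPerm-update b ts t x v t∉ =
    trans (cong (λ y → (fanPerm b ts v [ t ]≔ x) [ s ]≔ (y xor b)) (VecP.lookup∘update′ (λ e → t≢s (sym e)) (fanPerm b ts v) x))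
      (VecP.[]≔-commutes (fanPerm b ts v) t s t≢s)

  lookup-fanPerm : ∀ {k} b (ts : Vec (Fin N) k) t v → All (t ≢_) (Vec.toList ts) → lookup (fanPerm b ts v) t ≡ lookup v t
  lookup-fanPerm b [] t v [] = refl
  lookup-fanPerm b (s ∷ ts) t v (t≢s ∷ t∉) = trans (VecP.lookup∘update′ t≢s (fanPerm b ts v) _) (lookup-fanPerm b ts t v t∉)

  -- `fanPerm` updates the head target last, while the fold updates it first. Distinct targets make
  -- the order immaterial, and since `c` is not a target every factor reads the same control bit.
  fan-op : ∀ {k} c (ts : Vec (Fin N) k) → All (c ≢_) (Vec.toList ts) → AllPairs _≢_ (Vec.toList ts) → ∀ ψ v →
           ψ (fanPerm (lookup v c) ts v) ≋ foldr (λ t → op (λ v → XM (lookup v c)) t) ψ (Vec.toList ts) v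
  fan-op c [] _ _ ψ v = ≋-refl
  fan-op c (t ∷ ts) (c≢t ∷ c∉) (t∉ ∷ ps) ψ v = ≋-sym (≋-trans (X-op (λ v → lookup v c) t _ v)
    (≋-trans (≋-sym (fan-op c ts c∉ ps ψ w)) (≋-reflexive (cong ψ eq))))
    where
      w = v [ t ]≔ (lookup v t xor lookup v c)
      eq : fanPerm (lookup w c) ts w ≡ fanPerm (lookup v c) ts v [ t ]≔ (lookup (fanPerm (lookup v c) ts v) t xor lookup v c)
      eq rewrite VecP.lookup∘update′ c≢t v (lookup v t xor lookup v c)
         | fanPerm-update (lookup v c) ts t (lookup v t xor lookup v c) v t∉
         | lookup-fanPerm (lookup v c) ts t v t∉ = refl

  pF-op : ∀ {g} k c (ts : Vec (Fin N) (suc k)) → AllPairs _≢_ (c ∷ Vec.toList ts) → ∀ ψ →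
          applyPlaced {g} (pF k c ts) ψ ≈ψ foldr (λ t → op (λ v → XM (lookup v c)) t) ψ (Vec.toList ts)
  pF-op k c ts (c∉ ∷ ps) ψ v = fan-op c ts c∉ ps ψ v

-- The universal circuit: layers, qubit layout and disjointness of supports.

module UniversalCircuit where
  -- The function `key` recovers from an element the block that contains it, so blocks with
  -- different indices are disjoint without comparing them in pairs.
  unique-concatMap : ∀ {A I : Set} (F : I → List A) (key : A → I) →
                     (∀ i → Unique (F i)) → (∀ i → All (λ x → key x ≡ i) (F i)) →
                     ∀ {xs} → Unique xs → Unique (concatMap F xs)
  unique-concatMap F key u k [] = []
  unique-concatMap F key u k {x ∷ xs} (x∉ ∷ uxs) =
    UniqueP.++⁺ (u x) (unique-concatMap F key u k uxs)
      (λ { {z} (z∈x , z∈xs) → disjoint xs x∉ (All.lookup (k x) z∈x) z∈xs })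
    where
      disjoint : ∀ ys → All (x ≢_) ys → ∀ {z} → key z ≡ x → z ∈ concatMap F ys → ⊥
      disjoint (y ∷ ys) (x≢y ∷ ns) {z} e z∈ with MembP.∈-++⁻ (F y) z∈
      ... | inj₁ p = x≢y (trans (sym e) (All.lookup (k y) p))
      ... | inj₂ p = disjoint ys ns e p

  concatMap-map : ∀ {A B C : Set} (f : B → List C) (g : A → B) xs → concatMap f (map g xs) ≡ concatMap (λ x → f (g x)) xs
  concatMap-map f g [] = refl
  concatMap-map f g (x ∷ xs) = cong (f (g x) ++_) (concatMap-map f g xs)

  pairs : ∀ n → List (Fin n × Fin n)
  pairs n = cartesianProduct (allFin n) (allFin n)

  pairs-unique : ∀ n → Unique (pairs n)
  pairs-unique n = UniqueP.cartesianProduct⁺ (UniqueP.allFin⁺ n) (UniqueP.allFin⁺ n)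

  -- VKind and CKind are the layers whose targets are the data qubits and the qubits r.
  data VKind : Bool → Set where
    vH vT vτ vτ′ : ∀ {g} → VKind g
    vR : VKind true

  data CKind : Set where
    rH rT rF rE rP rV : CKind

  -- The layers with one gate for each pair (j, i). `rV` also has the cells r as targets, but
  -- consists of n fanout gates, each on a whole row, and so is placed differently.
  data PKind : Set where
    kH kT kF kE kP : PKind

  data Kind (g : Bool) : Set where
    onV : VKind g → Kind g
    onC : CKind → Kind g
    copyV diagT : Kind g

  conjugateH : ∀ {g} → VKind g → List (VKind g)
  conjugateH k = vH ∷ replicate 6 vT ++ vH ∷ replicate 7 vT ++ k ∷ vT ∷ vH ∷ vT ∷ vT ∷ vH ∷ []

  toffoliKinds toffoli⁻¹Kinds : List CKind
  toffoliKinds = rH ∷ rP ∷ replicate 7 rT ++ rF ∷ rT ∷ rP ∷ replicate 7 rT ++ rF ∷ rT ∷ rH ∷ []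
  toffoli⁻¹Kinds = rH ∷ replicate 7 rT ++ rF ∷ rT ∷ rP ∷ replicate 7 rT ++ rF ∷ rT ∷ rP ∷ rH ∷ []

  -- Hadamard gates around a target turn X into Z. In the first case the fanout gate becomes
  -- controlled Z gates between v j and each r j i, whose signs multiply to that of v j ∧ parity. In
  -- the second the Toffoli gate gives the sign of v j ∧ conjunction.
  combineKinds : ∀ g → List (Kind g)
  combineKinds false = map onC (rH ∷ rV ∷ rH ∷ [])
  combineKinds true = map onV (vH ∷ vR ∷ vH ∷ [])

  -- Five T gates: a T gate is encoded as a target controlled by itself, so combining
  -- already contributes Z = T⁴, and T⁹ = T.
  blockKinds : ∀ g → List (Kind g)
  blockKinds g = map onV (conjugateH vτ) ++ copyV ∷ map onC toffoliKinds ++ replicate 5 diagT ++ onC rE ∷ combineKinds g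
    ++ onC rE ∷ map onC toffoli⁻¹Kinds ++ copyV ∷ map onV (conjugateH vτ′)

  module Circuits (n′ d : ℕ) where

    n rows m a N : ℕ
    n = suc n′
    rows = 2 + (n + n)
    m = d * (rows * n)
    a = (n + n) * n
    N = n + (m + a)

    -- v: data; for level l and target j with control i: τ and τ′ switch the Hadamard
    -- gates, f and e are the rows of the gate matrix; p i j is the copy of v i
    -- used by target j; r j i receives (f j i ∧ v i) xor e j i, where e supplies the
    -- neutral element of the conjunction for unused controls.
    data Lab : Set where
      v : Fin n → Lab
      τ τ′ : Fin d → Fin n → Lab
      f e : Fin d → Fin n → Fin n → Lab
      p r : Fin n → Fin n → Lab

    encRow : Fin d → Fin rows → Fin n → Fin m
    encRow l ρ i = combine l (combine ρ i)

    encAddr : Fin m → Fin N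
    encAddr x = n ↑ʳ (x ↑ˡ a)

    ancAddr : Fin a → Fin N
    ancAddr x = n ↑ʳ (m ↑ʳ x)

    rowF rowE : Fin n → Fin rows
    rowF j = suc (suc (j ↑ˡ n))
    rowE j = suc (suc (n ↑ʳ j))

    labRow : Fin d → Fin rows → Fin n → Lab
    labRow l zero i = τ l i
    labRow l (suc zero) i = τ′ l i
    labRow l (suc (suc ρ)) i = [ (λ j → f l j i) , (λ j → e l j i) ]′ (splitAt n ρ)

    labAncRow : Fin (n + n) → Fin n → Lab
    labAncRow ρ i = [ (λ j → p j i) , (λ j → r j i) ]′ (splitAt n ρ)

    labEnc : Fin m → Lab
    labEnc x = uncurry (λ l y → uncurry (labRow l) (remQuot {rows} n y)) (remQuot {d} (rows * n) x)

    labAnc : Fin a → Lab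
    labAnc x = uncurry labAncRow (remQuot {n + n} n x)

    -- The left inverse of `addr`. Qubits are then distinct as soon as their labels are, which
    -- constructors decide, and no arithmetic on positions is needed.
    lab : Fin N → Lab
    lab q = [ v , (λ x → [ labEnc , labAnc ]′ (splitAt m x)) ]′ (splitAt n q)

    labEnc-encRow : ∀ l ρ i → labEnc (encRow l ρ i) ≡ labRow l ρ i
    labEnc-encRow l ρ i = trans
      (cong (uncurry (λ l y → uncurry (labRow l) (remQuot {rows} n y))) (FinP.remQuot-combine {d} {rows * n} l (combine ρ i)))
      (cong (uncurry (labRow l)) (FinP.remQuot-combine {rows} {n} ρ i))

    lab-encAddr : ∀ x → lab (encAddr x) ≡ labEnc x
    lab-encAddr x = trans (cong [ v , (λ x → [ labEnc , labAnc ]′ (splitAt m x)) ]′ (FinP.splitAt-↑ʳ n (m + a) (x ↑ˡ a)))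
      (cong [ labEnc , labAnc ]′ (FinP.splitAt-↑ˡ m x a))

    lab-ancAddr : ∀ x → lab (ancAddr x) ≡ labAnc x
    lab-ancAddr x = trans (cong [ v , (λ x → [ labEnc , labAnc ]′ (splitAt m x)) ]′ (FinP.splitAt-↑ʳ n (m + a) (m ↑ʳ x)))
      (cong [ labEnc , labAnc ]′ (FinP.splitAt-↑ʳ m a x))

    labAnc-combine : ∀ ρ i → labAnc (combine ρ i) ≡ labAncRow ρ i
    labAnc-combine ρ i = cong (uncurry labAncRow) (FinP.remQuot-combine {n + n} {n} ρ i)

    opaque
      addr : Lab → Fin N
      addr (v i) = i ↑ˡ (m + a)
      addr (τ l i) = encAddr (encRow l zero i)
      addr (τ′ l i) = encAddr (encRow l (suc zero) i)
      addr (f l j i) = encAddr (encRow l (rowF j) i)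
      addr (e l j i) = encAddr (encRow l (rowE j) i)
      addr (p i j) = ancAddr (combine (i ↑ˡ n) j)
      addr (r j i) = ancAddr (combine (n ↑ʳ j) i)

      lab-addr : ∀ λb → lab (addr λb) ≡ λb
      lab-addr (v i) = cong [ v , (λ x → [ labEnc , labAnc ]′ (splitAt m x)) ]′ (FinP.splitAt-↑ˡ n i (m + a))
      lab-addr (τ l i) = trans (lab-encAddr (encRow l zero i)) (labEnc-encRow l zero i)
      lab-addr (τ′ l i) = trans (lab-encAddr (encRow l (suc zero) i)) (labEnc-encRow l (suc zero) i)
      lab-addr (f l j i) = trans (lab-encAddr (encRow l (rowF j) i)) (trans (labEnc-encRow l (rowF j) i)
        (cong [ (λ j → f l j i) , (λ j → e l j i) ]′ (FinP.splitAt-↑ˡ n j n)))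
      lab-addr (e l j i) = trans (lab-encAddr (encRow l (rowE j) i)) (trans (labEnc-encRow l (rowE j) i)
        (cong [ (λ j → f l j i) , (λ j → e l j i) ]′ (FinP.splitAt-↑ʳ n n j)))
      lab-addr (p j i) = trans (lab-ancAddr (combine (j ↑ˡ n) i)) (trans (labAnc-combine (j ↑ˡ n) i)
        (cong [ (λ j → p j i) , (λ j → r j i) ]′ (FinP.splitAt-↑ˡ n j n)))
      lab-addr (r j i) = trans (lab-ancAddr (combine (n ↑ʳ j) i)) (trans (labAnc-combine (n ↑ʳ j) i)
        (cong [ (λ j → p j i) , (λ j → r j i) ]′ (FinP.splitAt-↑ʳ n n j)))

    addr-injective : ∀ {x y} → addr x ≡ addr y → x ≡ y
    addr-injective {x} {y} q = trans (sym (lab-addr x)) (trans (cong lab q) (lab-addr y))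

    apart : ∀ {x y} → x ≢ y → addr x ≢ addr y
    apart ne q = ne (addr-injective q)

    pV rowR : Fin n → Vec (Fin N) n
    pV i = Vec.tabulate (λ j → addr (p i j))
    rowR j = Vec.tabulate (λ i → addr (r j i))

    cnot : ∀ {g} → Lab → Lab → Placed g N
    cnot c t = pF 0 (addr c) (addr t ∷ [])

    gateV : ∀ {g} → VKind g → Fin d → Fin n → Placed g N
    gateV vH l i = pH (addr (v i))
    gateV vT l i = pT (addr (v i))
    gateV vτ l i = cnot (τ l i) (v i)
    gateV vτ′ l i = cnot (τ′ l i) (v i)
    gateV vR l j = pTof n′ (rowR j) (addr (v j))

    gateP gateRV gateD : ∀ {g} → Fin n → Placed g N
    gateP i = pF n′ (addr (v i)) (pV i)
    gateRV j = pF n′ (addr (v j)) (rowR j)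
    gateD i = pT (addr (r i i))

    gateC : ∀ {g} → PKind → Fin d → Fin n × Fin n → Placed g N
    gateC kH l (j , i) = pH (addr (r j i))
    gateC kT l (j , i) = pT (addr (r j i))
    gateC kF l (j , i) = cnot (f l j i) (r j i)
    gateC kE l (j , i) = cnot (e l j i) (r j i)
    gateC kP l (j , i) = cnot (p i j) (r j i)

    keyV : Lab → Fin n
    keyV (v i) = i
    keyV (τ l i) = i
    keyV (τ′ l i) = i
    keyV (f l j i) = j
    keyV (e l j i) = j
    keyV (p j i) = j
    keyV (r j i) = j

    -- The indices of `p` are exchanged: `p i j` is stored under the data qubit i that it copies,
    -- but the gate that reads it belongs to target j.
    keyC : Lab → Fin n × Fin n
    keyC (v i) = i , i
    keyC (τ l i) = i , i
    keyC (τ′ l i) = i , i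
    keyC (f l j i) = j , i
    keyC (e l j i) = j , i
    keyC (p i j) = j , i
    keyC (r j i) = j , i

    module _ {g : Bool} {I : Set} (G : I → Placed g N) (labs : I → List Lab) (key : Lab → I)
             (supp : ∀ i → support (G i) ≡ map addr (labs i))
             (u : ∀ i → Unique (labs i)) (k : ∀ i → All (λ x → key x ≡ i) (labs i)) where

      gates-unique : ∀ {xs} → Unique xs → Unique (concatMap support (map G xs))
      gates-unique {xs} uxs = subst Unique (sym (trans (concatMap-map support G xs) (ListP.concatMap-cong supp xs)))
        (unique-concatMap (λ i → map addr (labs i)) (λ q → key (lab q))
          (λ i → UniqueP.map⁺ addr-injective (u i))
          (λ i → AllP.map⁺ (All.map (λ {x} kx → trans (cong key (lab-addr x)) kx) (k i))) uxs)

    row-supp : ∀ (F : Fin n → Lab) → Vec.toList (Vec.tabulate (λ i → addr (F i))) ≡ map addr (tabulate F)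
    row-supp F = trans (toList-tabulate (λ i → addr (F i))) (sym (ListP.map-tabulate F addr))
      where
        toList-tabulate : ∀ {A : Set} {k} (h : Fin k → A) → Vec.toList (Vec.tabulate h) ≡ tabulate h
        toList-tabulate {k = zero} h = refl
        toList-tabulate {k = suc k} h = cong (h zero ∷_) (toList-tabulate (λ i → h (suc i)))

    r-injective : ∀ {j i i′} → r j i ≡ r j i′ → i ≡ i′
    r-injective refl = refl

    p-injective : ∀ {j i i′} → p j i ≡ p j i′ → i ≡ i′
    p-injective refl = refl

    row-unique : ∀ c {F : Fin n → Lab} → (∀ {i i′} → F i ≡ F i′ → i ≡ i′) → (∀ i → c ≢ F i) → Unique (c ∷ tabulate F)
    row-unique c inj ne = AllP.tabulate⁺ ne ∷ UniqueP.tabulate⁺ inj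

    labsV : ∀ {g} → VKind g → Fin d → Fin n → List Lab
    labsV vH l i = v i ∷ []
    labsV vT l i = v i ∷ []
    labsV vτ l i = τ l i ∷ v i ∷ []
    labsV vτ′ l i = τ′ l i ∷ v i ∷ []
    labsV vR l i = v i ∷ tabulate (r i)

    gateV-unique : ∀ {g} (k : VKind g) l → Unique (concatMap support (map (gateV k l) (allFin n)))
    gateV-unique k l = gates-unique (gateV k l) (labsV k l) keyV (supp k) (u k) (ky k) (UniqueP.allFin⁺ n)
      where
        supp : ∀ {g} (k : VKind g) i → support (gateV k l i) ≡ map addr (labsV k l i)
        supp vH i = refl
        supp vT i = refl
        supp vτ i = refl
        supp vτ′ i = refl
        supp vR i = cong (addr (v i) ∷_) (row-supp (r i))
        u : ∀ {g} (k : VKind g) i → Unique (labsV k l i)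
        u vH i = [] ∷ []
        u vT i = [] ∷ []
        u vτ i = ((λ ()) ∷ []) ∷ [] ∷ []
        u vτ′ i = ((λ ()) ∷ []) ∷ [] ∷ []
        u vR i = row-unique (v i) {r i} r-injective (λ _ ())
        ky : ∀ {g} (k : VKind g) i → All (λ x → keyV x ≡ i) (labsV k l i)
        ky vH i = refl ∷ []
        ky vT i = refl ∷ []
        ky vτ i = refl ∷ refl ∷ []
        ky vτ′ i = refl ∷ refl ∷ []
        ky vR i = refl ∷ AllP.tabulate⁺ {f = r i} (λ _ → refl)

    gateP-unique : ∀ {g} → Unique (concatMap support (map (gateP {g}) (allFin n)))
    gateP-unique = gates-unique gateP (λ i → v i ∷ tabulate (p i)) keyV (λ i → cong (addr (v i) ∷_) (row-supp (p i)))
      (λ i → row-unique (v i) {p i} p-injective (λ _ ())) (λ i → refl ∷ AllP.tabulate⁺ {f = p i} (λ _ → refl)) (UniqueP.allFin⁺ n)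

    gateRV-unique : ∀ {g} → Unique (concatMap support (map (gateRV {g}) (allFin n)))
    gateRV-unique = gates-unique gateRV (λ i → v i ∷ tabulate (r i)) keyV (λ i → cong (addr (v i) ∷_) (row-supp (r i)))
      (λ i → row-unique (v i) {r i} r-injective (λ _ ())) (λ i → refl ∷ AllP.tabulate⁺ {f = r i} (λ _ → refl)) (UniqueP.allFin⁺ n)

    gateD-unique : ∀ {g} → Unique (concatMap support (map (gateD {g}) (allFin n)))
    gateD-unique = gates-unique gateD (λ i → r i i ∷ []) keyV (λ i → refl) (λ i → [] ∷ []) (λ i → refl ∷ []) (UniqueP.allFin⁺ n)

    labsC : PKind → Fin d → Fin n × Fin n → List Lab
    labsC kH l (j , i) = r j i ∷ []
    labsC kT l (j , i) = r j i ∷ []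
    labsC kF l (j , i) = f l j i ∷ r j i ∷ []
    labsC kE l (j , i) = e l j i ∷ r j i ∷ []
    labsC kP l (j , i) = p i j ∷ r j i ∷ []

    gateC-unique : ∀ {g} k l → Unique (concatMap support (map (gateC {g} k l) (pairs n)))
    gateC-unique k l = gates-unique (gateC k l) (labsC k l) keyC (supp k) (u k) (ky k) (pairs-unique n)
      where
        supp : ∀ k i → support (gateC k l i) ≡ map addr (labsC k l i)
        supp kH i = refl
        supp kT i = refl
        supp kF i = refl
        supp kE i = refl
        supp kP i = refl
        u : ∀ k i → Unique (labsC k l i)
        u kH i = [] ∷ []
        u kT i = [] ∷ []
        u kF i = ((λ ()) ∷ []) ∷ [] ∷ []
        u kE i = ((λ ()) ∷ []) ∷ [] ∷ []
        u kP i = ((λ ()) ∷ []) ∷ [] ∷ []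
        ky : ∀ k i → All (λ x → keyC x ≡ i) (labsC k l i)
        ky kH i = refl ∷ []
        ky kT i = refl ∷ []
        ky kF i = refl ∷ refl ∷ []
        ky kE i = refl ∷ refl ∷ []
        ky kP i = refl ∷ refl ∷ []

    layerV : ∀ {g} → VKind g → Fin d → Layer g N
    layerV k l = map (gateV k l) (allFin n) , gateV-unique k l

    layerP layerD : ∀ {g} → Layer g N
    layerP = map gateP (allFin n) , gateP-unique
    layerD = map gateD (allFin n) , gateD-unique

    layerC : ∀ {g} → CKind → Fin d → Layer g N
    layerC rH l = map (gateC kH l) (pairs n) , gateC-unique kH l
    layerC rT l = map (gateC kT l) (pairs n) , gateC-unique kT l
    layerC rF l = map (gateC kF l) (pairs n) , gateC-unique kF l
    layerC rE l = map (gateC kE l) (pairs n) , gateC-unique kE l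
    layerC rP l = map (gateC kP l) (pairs n) , gateC-unique kP l
    layerC rV l = map gateRV (allFin n) , gateRV-unique

    layer : ∀ {g} → Kind g → Fin d → Layer g N
    layer (onV k) l = layerV k l
    layer (onC k) l = layerC k l
    layer copyV l = layerP
    layer diagT l = layerD

    opaque
      block : ∀ g → Fin d → Circuit g N
      block g l = map (λ k → layer k l) (blockKinds g)

      block-≡ : ∀ g l → block g l ≡ map (λ k → layer k l) (blockKinds g)
      block-≡ g l = refl

    circuit : ∀ g → Circuit g N
    circuit g = concatMap (block g) (allFin d)

-- The operator of one block: a diagonal operator between two switched Hadamard layers.

module BlockAction where
  open Amplitudes
  open Operators
  open GateMatrices
  open UniversalCircuit

  private variable
    N : ℕ
    g : Bool

  applyPlaced-cong : ∀ (G : Placed g N) {ψ φ} → ψ ≈ψ φ → applyPlaced G ψ ≈ψ applyPlaced G φ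
  applyPlaced-cong {g} (pH q) e = ≈ψ-trans (pH-op {g = g} q _) (≈ψ-trans (op-cong (λ _ → ≈M-refl) e) (≈ψ-sym (pH-op {g = g} q _)))
  applyPlaced-cong {g} (pT q) e = ≈ψ-trans (pT-op {g = g} q _) (≈ψ-trans (op-cong (λ _ → ≈M-refl) e) (≈ψ-sym (pT-op {g = g} q _)))
  applyPlaced-cong (pF k c ts) e v = e _
  applyPlaced-cong (pTof k cs t) e v = e _

  gates-cong : ∀ (Gs : List (Placed g N)) {ψ φ} → ψ ≈ψ φ → foldr applyPlaced ψ Gs ≈ψ foldr applyPlaced φ Gs
  gates-cong [] e = e
  gates-cong (G ∷ Gs) e = applyPlaced-cong G (gates-cong Gs e)

  run-cong : ∀ (C : Circuit g N) {ψ φ} → ψ ≈ψ φ → run C ψ ≈ψ run C φ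
  run-cong [] e = e
  run-cong (Λ ∷ C) e = run-cong C (gates-cong (proj₁ Λ) e)

  run-++ : ∀ (C D : Circuit g N) ψ → run (C ++ D) ψ ≡ run D (run C ψ)
  run-++ [] D ψ = refl
  run-++ (Λ ∷ C) D ψ = run-++ C D (applyLayer Λ ψ)

  ∏ : {I : Set} → List I → (I → Amp) → Amp
  ∏ xs F = foldr (λ i → F i ⊠_) 1A xs

  ∏-cong : ∀ {I : Set} {F G : I → Amp} (xs : List I) → (∀ i → F i ≋ G i) → ∏ xs F ≋ ∏ xs G
  ∏-cong [] e = ≋-refl
  ∏-cong (x ∷ xs) e = ⊠-cong (e x) (∏-cong xs e)

  ∏-++ : ∀ {I : Set} (F : I → Amp) xs ys → ∏ (xs ++ ys) F ≋ ∏ xs F ⊠ ∏ ys F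
  ∏-++ F [] ys = ≋-sym (⊠-identityˡ _)
  ∏-++ F (x ∷ xs) ys = ≋-trans (⊠-cong ≋-refl (∏-++ F xs ys)) (≋-sym (⊠-assoc _ _ _))

  ∏-map : ∀ {I J : Set} (F : J → Amp) (h : I → J) xs → ∏ (map h xs) F ≡ ∏ xs (λ i → F (h i))
  ∏-map F h [] = refl
  ∏-map F h (x ∷ xs) = cong (F (h x) ⊠_) (∏-map F h xs)

  ∏-cartesian : ∀ {I J : Set} (F : I × J → Amp) xs (ys : List J) → ∏ (cartesianProduct xs ys) F ≋ ∏ xs (λ i → ∏ ys (λ j → F (i , j)))
  ∏-cartesian F [] ys = ≋-refl
  ∏-cartesian F (x ∷ xs) ys = ≋-trans (∏-++ F (map (x ,_) ys) (cartesianProduct xs ys))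
    (⊠-cong (≋-reflexive (∏-map F (x ,_) ys)) (∏-cartesian F xs ys))

  ⊠-interchange : ∀ a b c d → (a ⊠ b) ⊠ (c ⊠ d) ≋ (a ⊠ c) ⊠ (b ⊠ d)
  ⊠-interchange a b c d = ≋-trans (⊠-assoc a b (c ⊠ d)) (≋-trans (⊠-cong ≋-refl
    (≋-trans (≋-sym (⊠-assoc b c d)) (≋-trans (⊠-cong (⊠-comm b c) ≋-refl) (⊠-assoc c b d)))) (≋-sym (⊠-assoc a c (b ⊠ d))))

  ∏-⊠ : ∀ {I : Set} (F G : I → Amp) xs → ∏ xs F ⊠ ∏ xs G ≋ ∏ xs (λ i → F i ⊠ G i)
  ∏-⊠ F G [] = ⊠-identityˡ _
  ∏-⊠ F G (x ∷ xs) = ≋-trans (⊠-interchange (F x) (∏ xs F) (G x) (∏ xs G)) (⊠-cong ≋-refl (∏-⊠ F G xs))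

  -- Without unbounded Toffoli gates a target has a single control, and parity suffices.
  comb : Bool → {I : Set} → List I → (I → Bool) → Bool
  comb false xs h = foldr (λ i → h i xor_) false xs
  comb true xs h = foldr (λ i → h i ∧_) true xs

  comb-cong : ∀ g {I : Set} (xs : List I) {h h′ : I → Bool} → (∀ i → h i ≡ h′ i) → comb g xs h ≡ comb g xs h′
  comb-cong false [] e = refl
  comb-cong false (x ∷ xs) e = cong₂ _xor_ (e x) (comb-cong false xs e)
  comb-cong true [] e = refl
  comb-cong true (x ∷ xs) e = cong₂ _∧_ (e x) (comb-cong true xs e)

  ∏-sgn : ∀ {I : Set} b (h : I → Bool) xs → ∏ xs (λ i → sgn (b ∧ h i)) ≋ sgn (b ∧ comb false xs h)
  ∏-sgn b h [] = ≋-reflexive (cong sgn (sym (BoolP.∧-zeroʳ b)))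
  ∏-sgn b h (x ∷ xs) = ≋-trans (⊠-cong ≋-refl (∏-sgn b h xs))
    (≋-trans (≋-sym (sgn-xor (b ∧ h x) (b ∧ comb false xs h))) (≋-reflexive (cong sgn (sym (BoolP.∧-distribˡ-xor b (h x) _)))))

  allOn-tabulate : ∀ {k} (F : Fin k → Fin N) w → allOn (Vec.tabulate F) w ≡ comb true (tabulate F) (lookup w)
  allOn-tabulate {k = zero} F w = refl
  allOn-tabulate {k = suc k} F w = cong (lookup w (F zero) ∧_) (allOn-tabulate (λ i → F (suc i)) w)

  comb-map : ∀ g {I J : Set} (h : J → Bool) (F : I → J) xs → comb g (map F xs) h ≡ comb g xs (λ i → h (F i))
  comb-map false h F [] = refl
  comb-map false h F (x ∷ xs) = cong (h (F x) xor_) (comb-map false h F xs)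
  comb-map true h F [] = refl
  comb-map true h F (x ∷ xs) = cong (h (F x) ∧_) (comb-map true h F xs)

  module Folding {N : ℕ} {I : Set} (t : I → Fin N) where
    open Parallel t

    opaque
      unfolding Parallel.par

      par-gates : ∀ (G : I → Placed g N) {M : I → Vec Bool N → Mat} → (∀ i φ → applyPlaced (G i) φ ≈ψ op (M i) (t i) φ) →
                  ∀ xs ψ → foldr applyPlaced ψ (map G xs) ≈ψ par M xs ψ
      par-gates G e [] ψ = ≈ψ-refl
      par-gates G {M} e (x ∷ xs) ψ = ≈ψ-trans (e x _) (op-congʳ (par-gates G e xs ψ))

      par-++ : ∀ (M : I → Vec Bool N → Mat) xs ys ψ → par M (xs ++ ys) ψ ≡ par M xs (par M ys ψ)
      par-++ M xs ys ψ = ListP.foldr-++ _ ψ xs ys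

      par-id : ∀ {M : I → Vec Bool N → Mat} → (∀ i v r c → ent (M i v) r c ≋ mono (λ _ → 1A) false r c) → ∀ xs ψ → par M xs ψ ≈ψ ψ
      par-id e [] ψ = ≈ψ-refl
      par-id e (x ∷ xs) ψ = ≈ψ-trans (op-id (e x) _) (par-id e xs ψ)

    IndepAll-seq : ∀ {K : Set} (M : K → I → Vec Bool N → Mat) → (∀ k → IndepAll (M k)) → ∀ ks → IndepAll (λ i w → seq (map (λ k → M k i w) ks))
    IndepAll-seq M ind ks i j w b = cong seq (ListP.map-cong (λ k → ind k i j w b) ks)

    -- Each layer of the run has the same targets `xs` and controls outside them, so `par-fuse`
    -- applies repeatedly and leaves one gate word per target.
    run-seq : ∀ {K : Set} (Λ : K → Layer g N) (M : K → I → Vec Bool N → Mat) → (∀ k → IndepAll (M k)) → ∀ xs → Apart xs →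
              (∀ k ψ → applyLayer (Λ k) ψ ≈ψ par (M k) xs ψ) →
              ∀ ks ψ → run (map Λ ks) ψ ≈ψ par (λ i w → seq (map (λ k → M k i w) ks)) xs ψ
    run-seq Λ M ind xs ap e [] ψ = ≈ψ-sym (par-id (λ i v → XM-mono false) xs ψ)
    run-seq Λ M ind xs ap e (k ∷ ks) ψ = ≈ψ-trans (run-seq Λ M ind xs ap e ks (applyLayer (Λ k) ψ))
      (≈ψ-trans (par-congʳ xs (e k ψ)) (par-fuse xs ap (IndepAll-seq M ind ks) (ind k) ψ))

  opaque
    unfolding Parallel.par

    par-rows : ∀ {I J : Set} (t : I × J → Fin N) (M : I × J → Vec Bool N → Mat) (G : I → Placed g N) (ys : List J) →
               (∀ i φ → applyPlaced (G i) φ ≈ψ Parallel.par t M (map (i ,_) ys) φ) →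
               ∀ xs ψ → foldr applyPlaced ψ (map G xs) ≈ψ Parallel.par t M (cartesianProduct xs ys) ψ
    par-rows t M G ys e [] ψ = ≈ψ-refl
    par-rows t M G ys e (x ∷ xs) ψ = ≈ψ-trans (e x _)
      (≈ψ-trans (Parallel.par-congʳ t (map (x ,_) ys) (par-rows t M G ys e xs ψ))
        (λ w → ≋-reflexive (cong (λ φ → φ w) (sym (Folding.par-++ t M (map (x ,_) ys) (cartesianProduct xs ys) ψ)))))

  module BlockSemantics (n′ d : ℕ) where
    open Circuits n′ d renaming (N to Nq; v to vᵇ; τ to τᵇ; τ′ to τ′ᵇ; f to fᵇ; e to eᵇ; p to pᵇ; r to rᵇ)

    _at_ : Vec Bool Nq → Lab → Bool
    w at x = lookup w (addr x)

    at-update : ∀ {x y} → x ≢ y → ∀ w b → (w [ addr y ]≔ b) at x ≡ w at x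
    at-update ne w b = VecP.lookup∘update′ (apart ne) w b

    tV tD : Fin n → Fin Nq
    tV i = addr (vᵇ i)
    tD i = addr (rᵇ i i)

    tC tP : Fin n × Fin n → Fin Nq
    tC (j , i) = addr (rᵇ j i)
    tP (i , j) = addr (pᵇ i j)

    module V = Parallel tV
    module C = Parallel tC
    module P = Parallel tP
    module D = Parallel tD

    apart-unique : ∀ {I : Set} (F : I → Lab) → (∀ {i j} → F i ≡ F j → i ≡ j) → ∀ {xs} → Unique xs → AllPairs (λ i j → addr (F i) ≢ addr (F j)) xs
    apart-unique F inj u = AllPairs.map (λ ne → apart (λ e → ne (inj e))) u

    apartV : V.Apart (allFin n)
    apartV = apart-unique vᵇ (λ { refl → refl }) (UniqueP.allFin⁺ n)

    apartD : D.Apart (allFin n)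
    apartD = apart-unique (λ i → rᵇ i i) (λ { refl → refl }) (UniqueP.allFin⁺ n)

    apartC : C.Apart (pairs n)
    apartC = apart-unique (λ x → rᵇ (proj₁ x) (proj₂ x)) (λ { refl → refl }) (pairs-unique n)

    apartP : P.Apart (pairs n)
    apartP = apart-unique (λ x → pᵇ (proj₁ x) (proj₂ x)) (λ { refl → refl }) (pairs-unique n)

    matV : VKind g → Fin d → Fin n → Vec Bool Nq → Mat
    matV vH l i w = HM
    matV vT l i w = TM₂
    matV vτ l i w = XM (w at τᵇ l i)
    matV vτ′ l i w = XM (w at τ′ᵇ l i)
    matV vR l j w = XM (comb true (allFin n) (λ i → w at rᵇ j i))

    matC : CKind → Fin d → Fin n × Fin n → Vec Bool Nq → Mat
    matC rH l x w = HM
    matC rT l x w = TM₂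
    matC rF l (j , i) w = XM (w at fᵇ l j i)
    matC rE l (j , i) w = XM (w at eᵇ l j i)
    matC rP l (j , i) w = XM (w at pᵇ i j)
    matC rV l (j , i) w = XM (w at vᵇ j)

    matP : Fin n × Fin n → Vec Bool Nq → Mat
    matP (i , j) w = XM (w at vᵇ i)

    indepV : ∀ (k : VKind g) l → V.IndepAll (matV k l)
    indepV vH l i j w b = refl
    indepV vT l i j w b = refl
    indepV vτ l i j w b = cong XM (at-update (λ ()) w b)
    indepV vτ′ l i j w b = cong XM (at-update (λ ()) w b)
    indepV vR l i j w b = cong XM (comb-cong true (allFin n) (λ k → at-update (λ ()) w b))

    indepC : ∀ k l → C.IndepAll (matC k l)
    indepC rH l i j w b = refl
    indepC rT l i j w b = refl
    indepC rF l i j w b = cong XM (at-update (λ ()) w b)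
    indepC rE l i j w b = cong XM (at-update (λ ()) w b)
    indepC rP l i j w b = cong XM (at-update (λ ()) w b)
    indepC rV l i j w b = cong XM (at-update (λ ()) w b)

    opaque
      unfolding Parallel.par

      -- Splits a single placed fanout gate into the n members of row i of a family indexed by
      -- pairs, so that fanout layers fit the same calculus as layers of CNOTs.
      fan-row : ∀ c (t : Fin n × Fin n → Fin Nq) (F : Fin n → Lab) i → (∀ j → t (i , j) ≡ addr (F j)) → Unique (c ∷ tabulate F) →
                ∀ {M : Fin n × Fin n → Vec Bool Nq → Mat} → (∀ j w → M (i , j) w ≡ XM (w at c)) → ∀ φ →
                applyPlaced {g} (pF n′ (addr c) (Vec.tabulate (λ j → addr (F j)))) φ ≈ψ Parallel.par t M (map (i ,_) (allFin n)) φ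
      fan-row {g} c t F i et u {M} eM φ = ≈ψ-trans (pF-op {g = g} n′ (addr c) (Vec.tabulate (λ j → addr (F j)))
          (subst Unique (cong (addr c ∷_) (sym (row-supp F))) (UniqueP.map⁺ addr-injective u)) φ)
        (λ w → ≋-trans (≋-reflexive (cong (λ qs → foldr (λ t → op (λ v → XM (v at c)) t) φ qs w) (trans (row-supp F) (trans (cong (map addr) (sym (ListP.map-tabulate (λ j → j) F))) refl))))
          (fold (allFin n) w))
        where
          fold : ∀ xs → foldr (λ t → op (λ v → XM (v at c)) t) φ (map addr (map F xs)) ≈ψ Parallel.par t M (map (i ,_) xs) φ
          fold [] = ≈ψ-refl
          fold (x ∷ xs) rewrite et x = op-cong (λ v → subst (XM (v at c) ≈M_) (sym (eM x v)) ≈M-refl) (fold xs)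

    cnot-op : ∀ c t → c ≢ t → ∀ φ → applyPlaced {g} (cnot c t) φ ≈ψ op (λ w → XM (w at c)) (addr t) φ
    cnot-op {g} c t ne φ = pF-op {g = g} 0 (addr c) (addr t ∷ []) ((apart ne ∷ []) ∷ [] ∷ []) φ

    layerV-par : ∀ (k : VKind g) l ψ → applyLayer (layerV k l) ψ ≈ψ V.par (matV k l) (allFin n) ψ
    layerV-par k l ψ = Folding.par-gates tV (gateV k l) (gate k) (allFin n) ψ
      where
        gate : ∀ (k : VKind g) i φ → applyPlaced (gateV k l i) φ ≈ψ op (matV k l i) (tV i) φ
        gate {g} vH i φ = pH-op {g = g} _ φ
        gate {g} vT i φ = pT-op {g = g} _ φ
        gate {g} vτ i φ = cnot-op {g = g} (τᵇ l i) (vᵇ i) (λ ()) φ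
        gate {g} vτ′ i φ = cnot-op {g = g} (τ′ᵇ l i) (vᵇ i) (λ ()) φ
        gate vR j φ = ≈ψ-trans (pTof-op n′ (rowR j) (tV j) φ) (op-cong (λ w → subst (λ b → XM (allOn (rowR j) w) ≈M XM b) (eq w) ≈M-refl) ≈ψ-refl)
          where
            eq : ∀ w → allOn (rowR j) w ≡ comb true (allFin n) (λ i → w at rᵇ j i)
            eq w = trans (allOn-tabulate (λ i → addr (rᵇ j i)) w)
              (trans (cong (λ xs → comb true xs (lookup w)) (sym (ListP.map-tabulate (λ i → i) (λ i → addr (rᵇ j i)))))
                (comb-map true (lookup w) (λ i → addr (rᵇ j i)) (allFin n)))

    layerC-par : ∀ k l ψ → applyLayer (layerC {g} k l) ψ ≈ψ C.par (matC k l) (pairs n) ψ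
    layerC-par {g} rH l ψ = Folding.par-gates tC (gateC kH l) (λ _ → pH-op {g = g} _) (pairs n) ψ
    layerC-par {g} rT l ψ = Folding.par-gates tC (gateC kT l) (λ _ → pT-op {g = g} _) (pairs n) ψ
    layerC-par {g} rF l ψ = Folding.par-gates tC (gateC kF l) (λ { (j , i) → cnot-op {g = g} (fᵇ l j i) (rᵇ j i) (λ ()) }) (pairs n) ψ
    layerC-par {g} rE l ψ = Folding.par-gates tC (gateC kE l) (λ { (j , i) → cnot-op {g = g} (eᵇ l j i) (rᵇ j i) (λ ()) }) (pairs n) ψ
    layerC-par {g} rP l ψ = Folding.par-gates tC (gateC kP l) (λ { (j , i) → cnot-op {g = g} (pᵇ i j) (rᵇ j i) (λ ()) }) (pairs n) ψ
    layerC-par {g} rV l ψ = par-rows tC (matC rV l) gateRV (allFin n)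
      (λ j → fan-row {g = g} (vᵇ j) tC (rᵇ j) j (λ _ → refl) (row-unique (vᵇ j) {rᵇ j} r-injective (λ _ ())) (λ _ _ → refl)) (allFin n) ψ

    layerP-par : ∀ ψ → applyLayer (layerP {g}) ψ ≈ψ P.par matP (pairs n) ψ
    layerP-par {g} ψ = par-rows tP matP gateP (allFin n)
      (λ i → fan-row {g = g} (vᵇ i) tP (pᵇ i) i (λ _ → refl) (row-unique (vᵇ i) {pᵇ i} p-injective (λ _ ())) (λ _ _ → refl)) (allFin n) ψ

    layerD-par : ∀ ψ → applyLayer (layerD {g}) ψ ≈ψ D.par (λ _ _ → TM₂) (allFin n) ψ
    layerD-par {g} ψ = Folding.par-gates tD gateD (λ _ → pT-op {g = g} _) (allFin n) ψ

    opaque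
      kindRun : Fin d → List (Kind g) → State Nq → State Nq
      kindRun l ks ψ = run (map (λ k → layer k l) ks) ψ

      kindRun-++ : ∀ l (ks ks′ : List (Kind g)) ψ → kindRun l (ks ++ ks′) ψ ≡ kindRun l ks′ (kindRun l ks ψ)
      kindRun-++ l ks ks′ ψ = trans (cong (λ C → run C ψ) (ListP.map-++ (λ k → layer k l) ks ks′)) (run-++ (map (λ k → layer k l) ks) _ ψ)

      kindRun-cong : ∀ l (ks : List (Kind g)) {ψ φ} → ψ ≈ψ φ → kindRun l ks ψ ≈ψ kindRun l ks φ
      kindRun-cong l ks = run-cong (map (λ k → layer k l) ks)

      runV : ∀ l (ks : List (VKind g)) ψ → kindRun l (map onV ks) ψ ≈ψ V.par (λ i w → seq (map (λ k → matV k l i w) ks)) (allFin n) ψ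
      runV l ks ψ w = ≋-trans (≋-reflexive (cong (λ C → run C ψ w) (sym (ListP.map-∘ ks))))
        (Folding.run-seq tV (λ k → layerV k l) (λ k → matV k l) (λ k → indepV k l) (allFin n) apartV (λ k → layerV-par k l) ks ψ w)

      runC : ∀ l (ks : List CKind) ψ → kindRun {g} l (map onC ks) ψ ≈ψ C.par (λ x w → seq (map (λ k → matC k l x w) ks)) (pairs n) ψ
      runC {g} l ks ψ w = ≋-trans (≋-reflexive (cong (λ C → run C ψ w) (sym (ListP.map-∘ ks))))
        (Folding.run-seq tC (λ k → layerC {g} k l) (λ k → matC k l) (λ k → indepC k l) (pairs n) apartC (λ k → layerC-par {g} k l) ks ψ w)

      runP : ∀ l ψ → kindRun {g} l (copyV ∷ []) ψ ≈ψ P.par matP (pairs n) ψ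
      runP {g} l ψ = layerP-par {g} ψ

      runE : ∀ l ψ → kindRun {g} l (onC rE ∷ []) ψ ≈ψ C.par (matC rE l) (pairs n) ψ
      runE {g} l ψ = layerC-par {g} rE l ψ

      runT : ∀ l k ψ → kindRun {g} l (replicate k diagT) ψ ≈ψ D.par (λ i w → seq (map (λ _ → TM₂) (replicate {A = Kind g} k diagT))) (allFin n) ψ
      runT {g} l k ψ w = ≋-trans (≋-reflexive (cong (λ C → run C ψ w) (eq k)))
        (Folding.run-seq tD {K = Kind g} (λ k → layerD {g}) (λ _ _ _ → TM₂) (λ _ _ _ _ _ → refl) (allFin n) apartD (λ _ → layerD-par {g})
          (replicate k diagT) ψ w)
        where
          eq : ∀ k → map (λ κ → layer {g} κ l) (replicate k diagT) ≡ map (λ _ → layerD {g}) (replicate {A = Kind g} k diagT)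
          eq zero = refl
          eq (suc k) = cong (layerD ∷_) (eq k)

    kindRun-then : ∀ l (ks ks′ : List (Kind g)) {ψ φ} → kindRun l ks ψ ≈ψ φ → kindRun l (ks ++ ks′) ψ ≈ψ kindRun l ks′ φ
    kindRun-then l ks ks′ {ψ} e w = ≋-trans (≋-reflexive (cong (λ φ → φ w) (kindRun-++ l ks ks′ ψ))) (kindRun-cong l ks′ e w)

    runH : ∀ l (k : VKind g) (lb : Fin n → Lab) → (∀ i w → matV k l i w ≡ XM (w at lb i)) →
           ∀ ψ → kindRun l (map onV (conjugateH k)) ψ ≈ψ V.par (λ i w → HM^ (w at lb i)) (allFin n) ψ
    runH l k lb ek ψ = ≈ψ-trans (runV l (conjugateH k) ψ) (V.par-cong (allFin n) (λ i w → step i w) ≈ψ-refl)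
      where
        step : ∀ i w → seq (map (λ k → matV k l i w) (conjugateH k)) ≈M HM^ (w at lb i)
        step i w rewrite ek i w = seq-programmableH (w at lb i)

    module AtLevel (g : Bool) (l : Fin d) where

      χcomb χE χT : Vec Bool Nq → Amp
      χcomb w = ∏ (allFin n) (λ j → sgn ((w at vᵇ j) ∧ comb g (allFin n) (λ i → w at rᵇ j i)))

      E F : Fin n × Fin n → Vec Bool Nq → Bool
      E (j , i) w = w at eᵇ l j i
      F (j , i) w = (w at fᵇ l j i) ∧ (w at pᵇ i j)

      Pᵛ : Fin n × Fin n → Vec Bool Nq → Bool
      Pᵛ (i , j) w = w at vᵇ i

      flipE flipF flipP : Vec Bool Nq → Vec Bool Nq
      flipE = C.flips E (pairs n)
      flipF = C.flips F (pairs n)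
      flipP = P.flips Pᵛ (pairs n)

      χE w = χcomb (flipE w)
      χT w = ∏ (allFin n) (λ j → if w at rᵇ j j then ω^ 5 else 1A)

      χblock : Vec Bool Nq → Amp
      χblock w = χE (flipF (flipP w)) ⊠ χT (flipF (flipP w))

      runComb : ∀ g ψ → kindRun l (combineKinds g) ψ ≈ψ diag (λ w → ∏ (allFin n) (λ j → sgn ((w at vᵇ j) ∧ comb g (allFin n) (λ i → w at rᵇ j i)))) ψ
      -- Each pair (j, i) contributes a sign; grouping the product by rows turns the signs of row j
      -- into the sign of its parity.
      runComb false ψ = ≈ψ-trans (runC {false} l (rH ∷ rV ∷ rH ∷ []) ψ)
        (≈ψ-trans (C.par-diag (λ { (j , i) w r → sgn ((w at vᵇ j) ∧ r) }) (pairs n) (λ { (j , i) w → HXH (w at vᵇ j) }) ψ)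
          (diag-cong (λ w → ≋-trans (∏-cartesian _ (allFin n) (allFin n)) (∏-cong (allFin n) (λ j → ∏-sgn (w at vᵇ j) (λ i → w at rᵇ j i) (allFin n)))) ≈ψ-refl))
      runComb true ψ = ≈ψ-trans (runV {true} l (vH ∷ vR ∷ vH ∷ []) ψ)
        (≈ψ-trans (V.par-diag (λ j w r → sgn (comb true (allFin n) (λ i → w at rᵇ j i) ∧ r)) (allFin n)
                    (λ j w → HXH (comb true (allFin n) (λ i → w at rᵇ j i))) ψ)
          (diag-cong (λ w → ∏-cong (allFin n) (λ j → ≋-reflexive (cong sgn (BoolP.∧-comm _ (w at vᵇ j))))) ≈ψ-refl))

      indepE : C.IndepAll E
      indepE i j w b = at-update (λ ()) w b

      indepF : C.IndepAll F
      indepF i j w b = cong₂ _∧_ (at-update (λ ()) w b) (at-update (λ ()) w b)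

      indepPᵛ : P.IndepAll Pᵛ
      indepPᵛ i j w b = at-update (λ ()) w b

      indepXE : C.IndepAll (λ x w → XM (E x w))
      indepXE i j w b = cong XM (indepE i j w b)

      runEcombE : ∀ ψ → kindRun l (onC rE ∷ combineKinds g ++ onC rE ∷ []) ψ ≈ψ diag χE ψ
      runEcombE ψ = ≈ψ-trans (kindRun-then l (onC rE ∷ []) (combineKinds g ++ onC rE ∷ []) (runE {g} l ψ))
        (≈ψ-trans (kindRun-then l (combineKinds g) (onC rE ∷ []) (runComb g _))
          (≈ψ-trans (runE {g} l _)
            (C.par-conj E (λ _ _ _ → 1A) (λ _ _ _ → 1A) (λ x w → XM-mono (E x w)) (λ x w → XM-mono (E x w))
              (λ _ _ _ → ⊠-identityˡ 1A) indepXE (λ x → indepE x x) (λ _ _ _ → refl) (pairs n) apartC χcomb ψ)))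

      runT⁵ : ∀ ψ → kindRun {g} l (replicate 5 diagT) ψ ≈ψ diag χT ψ
      runT⁵ ψ = ≈ψ-trans (runT {g} l 5 ψ) (D.par-diag (λ _ _ r → if r then ω^ 5 else 1A) (allFin n) (λ _ _ → T⁵-mono) ψ)

      toffoliMat toffoli⁻¹Mat : Fin n × Fin n → Vec Bool Nq → Mat
      toffoliMat x w = seq (map (λ k → matC k l x w) toffoliKinds)
      toffoli⁻¹Mat x w = seq (map (λ k → matC k l x w) toffoli⁻¹Kinds)

      runToffoliConj : ∀ χ ψ → C.par toffoli⁻¹Mat (pairs n) (diag χ (C.par toffoliMat (pairs n) ψ)) ≈ψ diag (λ w → χ (flipF w)) ψ
      runToffoliConj χ ψ = C.par-conj F (λ x w _ → if F x w then iA else 1A) (λ x w _ → if F x w then -iA else 1A)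
        (λ { (j , i) w → seq-toffoli⁻¹ (w at fᵇ l j i) (w at pᵇ i j) }) (λ { (j , i) w → seq-toffoli (w at fᵇ l j i) (w at pᵇ i j) })
        (λ x w _ → toffoli-phases (F x w)) (Folding.IndepAll-seq tC (λ k → matC k l) (λ k → indepC k l) toffoliKinds)
        (λ x → indepF x x) (λ x w b → cong (λ c _ → if c then -iA else 1A) (indepF x x w b)) (pairs n) apartC χ ψ

      combKinds rest₂ rest₁ innerKinds : List (Kind g)
      combKinds = onC rE ∷ combineKinds g ++ onC rE ∷ []
      rest₂ = combKinds ++ map onC toffoli⁻¹Kinds
      -- The T gates must precede the rows e. For a flip with target j over 𝓕′, the diagonal bit e j
      -- j is 1, since j is not a control of itself; adding it first would set off the T gates on r
      -- j j.
      rest₁ = replicate 5 diagT ++ rest₂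
      innerKinds = map onC toffoliKinds ++ rest₁

      run₁ : ∀ ψ → kindRun l innerKinds ψ ≈ψ kindRun l rest₁ (C.par toffoliMat (pairs n) ψ)
      run₁ ψ = kindRun-then l (map onC toffoliKinds) rest₁ (runC {g} l toffoliKinds ψ)

      run₂ : ∀ ψ → kindRun l rest₁ ψ ≈ψ kindRun l rest₂ (diag χT ψ)
      run₂ ψ = kindRun-then l (replicate 5 diagT) rest₂ (runT⁵ ψ)

      run₃ : ∀ ψ → kindRun l rest₂ ψ ≈ψ kindRun l (map onC toffoli⁻¹Kinds) (diag χE ψ)
      run₃ ψ = kindRun-then l combKinds (map onC toffoli⁻¹Kinds) (runEcombE ψ)

      run₄ : ∀ ψ → kindRun l (map onC toffoli⁻¹Kinds) ψ ≈ψ C.par toffoli⁻¹Mat (pairs n) ψ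
      run₄ ψ = runC {g} l toffoli⁻¹Kinds ψ

      χdiag : Vec Bool Nq → Amp
      χdiag w = χE w ⊠ χT w

      runInner : ∀ ψ → kindRun l innerKinds ψ ≈ψ diag (λ w → χdiag (flipF w)) ψ
      runInner ψ = ≈ψ-trans (run₁ ψ) (≈ψ-trans (run₂ ψ₁) (≈ψ-trans (run₃ (diag χT ψ₁))
        (≈ψ-trans (run₄ (diag χE (diag χT ψ₁))) (≈ψ-trans (C.par-congʳ (pairs n) (diag-fuse χE χT ψ₁)) (runToffoliConj χdiag ψ)))))
        where
          ψ₁ = C.par toffoliMat (pairs n) ψ

      runCopied : ∀ ψ → kindRun l (copyV ∷ innerKinds ++ copyV ∷ []) ψ ≈ψ diag χblock ψ
      runCopied ψ =
        ≈ψ-trans (kindRun-then l (copyV ∷ []) (innerKinds ++ copyV ∷ []) (runP {g} l ψ))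
        (≈ψ-trans (kindRun-then l innerKinds (copyV ∷ []) (runInner (P.par matP (pairs n) ψ)))
        (≈ψ-trans (runP {g} l (diag (λ w → χdiag (flipF w)) (P.par matP (pairs n) ψ)))
          (P.par-conj Pᵛ (λ _ _ _ → 1A) (λ _ _ _ → 1A) (λ x w → XM-mono (Pᵛ x w)) (λ x w → XM-mono (Pᵛ x w))
            (λ _ _ _ → ⊠-identityˡ 1A) (λ i j w b → cong XM (indepPᵛ i j w b)) (λ x → indepPᵛ x x) (λ _ _ _ → refl) (pairs n) apartP
            (λ w → χdiag (flipF w)) ψ)))

      -- A reassociation that exhibits the nesting of the conjugations. It holds by computation once
      -- g is known, because then `combineKinds g` is a concrete list.
      blockKinds-split : blockKinds g ≡ map onV (conjugateH vτ) ++ (copyV ∷ innerKinds ++ copyV ∷ []) ++ map onV (conjugateH vτ′)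
      blockKinds-split = cong (map onV (conjugateH vτ) ++_) (cong (copyV ∷_) (split g))
        where
          split : ∀ g → map onC toffoliKinds ++ replicate 5 diagT ++ onC rE ∷ combineKinds g ++ onC rE ∷ map onC toffoli⁻¹Kinds ++ copyV ∷ map onV (conjugateH vτ′)
                      ≡ ((map onC toffoliKinds ++ replicate 5 diagT ++ (onC rE ∷ combineKinds g ++ onC rE ∷ []) ++ map onC toffoli⁻¹Kinds) ++ copyV ∷ []) ++ map onV (conjugateH vτ′)
          split false = refl
          split true = refl

      midKinds preKinds postKinds : List (Kind g)
      midKinds = copyV ∷ innerKinds ++ copyV ∷ []
      preKinds = map onV (conjugateH vτ)
      postKinds = map onV (conjugateH vτ′)

      Hτ Hτ′ : State Nq → State Nq
      Hτ = V.par (λ i w → HM^ (w at τᵇ l i)) (allFin n)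
      Hτ′ = V.par (λ i w → HM^ (w at τ′ᵇ l i)) (allFin n)

      runPre : ∀ ψ → kindRun l (preKinds ++ midKinds ++ postKinds) ψ ≈ψ kindRun l (midKinds ++ postKinds) (Hτ ψ)
      runPre ψ = kindRun-then l preKinds (midKinds ++ postKinds) (runH {g} l vτ (τᵇ l) (λ _ _ → refl) ψ)

      runMid : ∀ ψ → kindRun l (midKinds ++ postKinds) ψ ≈ψ kindRun l postKinds (diag χblock ψ)
      runMid ψ = kindRun-then l midKinds postKinds (runCopied ψ)

      runPost : ∀ ψ → kindRun l postKinds ψ ≈ψ Hτ′ ψ
      runPost ψ = runH {g} l vτ′ (τ′ᵇ l) (λ _ _ → refl) ψ

      opaque
        unfolding kindRun block

        block-kindRun : ∀ ψ → run (block g l) ψ ≡ kindRun l (blockKinds g) ψ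
        block-kindRun ψ = refl

      split-kindRun : ∀ ψ → kindRun l (blockKinds g) ψ ≡ kindRun l (preKinds ++ midKinds ++ postKinds) ψ
      split-kindRun ψ = cong (λ ks → kindRun l ks ψ) blockKinds-split

      run-block : ∀ ψ → run (block g l) ψ ≈ψ Hτ′ (diag χblock (Hτ ψ))
      run-block ψ = subst (_≈ψ Hτ′ (diag χblock (Hτ ψ))) (sym (trans (block-kindRun ψ) (split-kindRun ψ))) rest
        where
          rest : kindRun l (preKinds ++ midKinds ++ postKinds) ψ ≈ψ Hτ′ (diag χblock (Hτ ψ))
          rest = ≈ψ-trans (runPre ψ) (≈ψ-trans (runMid (Hτ ψ)) (runPost (diag χblock (Hτ ψ))))

-- Every layer as Hadamard gates, a diagonal operator and Hadamard gates.

module LayerNormalForm where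
  open Amplitudes
  open Operators
  open GateMatrices
  open BlockAction

  private variable
    n : ℕ
    g : Bool

  infix 4 _==_
  _==_ : Fin n → Fin n → Bool
  i == j = does (i FinP.≟ j)

  ==-refl : ∀ (i : Fin n) → (i == i) ≡ true
  ==-refl i = dec-true (i FinP.≟ i) refl

  ==-≢ : ∀ {i j : Fin n} → i ≢ j → (i == j) ≡ false
  ==-≢ {i = i} {j} ne = dec-false (i FinP.≟ j) ne

  ==-true : ∀ {i j : Fin n} → (i == j) ≡ true → i ≡ j
  ==-true {i = i} {j} e with i FinP.≟ j
  ... | yes p = p
  ... | no _ with () ← e

  data Ctl : Bool → ℕ → Set where
    one  : Fin n → Ctl g n
    many : List (Fin n) → Ctl true n

  ctlList : Ctl g n → List (Fin n)
  ctlList (one c) = c ∷ []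
  ctlList (many cs) = cs

  value : Ctl g n → Vec Bool n → Bool
  value k v = comb true (ctlList k) (lookup v)

  elem : Fin n → List (Fin n) → Bool
  elem i [] = false
  elem i (c ∷ cs) = (i == c) ∨ elem i cs

  mask : Ctl g n → Fin n → Bool
  mask k i = elem i (ctlList k)

  -- Single-target pieces of a layer. A fanout gate contributes one `aX` per target, all with the
  -- same control.
  data Atom (g : Bool) (n : ℕ) : Set where
    aH aT : Fin n → Atom g n
    aX    : Fin n → Ctl g n → Atom g n

  target : Atom g n → Fin n
  target (aH q) = q
  target (aT q) = q
  target (aX t k) = t

  supp : Atom g n → List (Fin n)
  supp (aH q) = q ∷ []
  supp (aT q) = q ∷ []
  supp (aX t k) = t ∷ ctlList k

  applyAtom : Atom g n → State n → State n
  applyAtom (aH q) = op (λ _ → HM) q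
  applyAtom (aT q) = op (λ _ → TM₂) q
  applyAtom (aX t k) = op (λ v → XM (value k v)) t

  before after : Atom g n → Fin n → Bool
  before (aH q) i = i == q
  before (aT q) i = false
  before (aX t k) i = i == t
  after (aH q) i = false
  after (aT q) i = false
  after (aX t k) i = i == t

  phase : Atom g n → Vec Bool n → Amp
  phase (aH q) v = 1A
  phase (aT q) v = if lookup v q then ω^ 1 else 1A
  phase (aX t k) v = sgn (lookup v t ∧ value k v)

  -- Weaker than disjointness of supports, because the pieces of a fanout gate share their control.
  -- A shared control does no harm: both pieces are diagonal in it.
  Fresh : Atom g n → Atom g n → Set
  Fresh A B = target A ∉ supp B × target B ∉ supp A

  Proper : Atom g n → Set
  Proper (aH q) = ⊤
  Proper (aT q) = ⊤
  Proper (aX t k) = t ∉ ctlList k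

  comb-update : ∀ g (cs : List (Fin n)) {q} → q ∉ cs → ∀ v b → comb g cs (lookup (v [ q ]≔ b)) ≡ comb g cs (lookup v)
  comb-update false [] q∉ v b = refl
  comb-update false (c ∷ cs) q∉ v b = cong₂ _xor_ (VecP.lookup∘update′ (λ e → q∉ (here (sym e))) v b) (comb-update false cs (λ p → q∉ (there p)) v b)
  comb-update true [] q∉ v b = refl
  comb-update true (c ∷ cs) q∉ v b = cong₂ _∧_ (VecP.lookup∘update′ (λ e → q∉ (here (sym e))) v b) (comb-update true cs (λ p → q∉ (there p)) v b)

  phase-indep : ∀ (A : Atom g n) {q} → q ∉ supp A → ∀ v b → phase A (v [ q ]≔ b) ≋ phase A v
  phase-indep (aH _) q∉ v b = ≋-refl
  phase-indep (aT _) q∉ v b = ≋-reflexive (cong (λ c → if c then ω^ 1 else 1A) (VecP.lookup∘update′ (λ e → q∉ (here (sym e))) v b))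
  phase-indep (aX t k) q∉ v b = ≋-reflexive (cong₂ (λ c c′ → sgn (c ∧ c′)) (VecP.lookup∘update′ (λ e → q∉ (here (sym e))) v b)
    (comb-update true (ctlList k) (λ p → q∉ (there p)) v b))

  -- Selections are added with xor, in accordance with H² = 1 and `H^-xor`.
  befores afters : List (Atom g n) → Fin n → Bool
  befores As i = foldr (λ A → before A i xor_) false As
  afters As i = foldr (λ A → after A i xor_) false As

  phases : List (Atom g n) → Vec Bool n → Amp
  phases As v = ∏ As (λ A → phase A v)

  before-other : ∀ (A : Atom g n) {i} → i ≢ target A → before A i ≡ false
  before-other (aH q) ne = ==-≢ ne
  before-other (aT q) ne = refl
  before-other (aX t k) ne = ==-≢ ne

  after-other : ∀ (A : Atom g n) {i} → i ≢ target A → after A i ≡ false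
  after-other (aH q) ne = refl
  after-other (aT q) ne = refl
  after-other (aX t k) ne = ==-≢ ne

  target∈supp : ∀ (A : Atom g n) → target A ∈ supp A
  target∈supp (aH q) = here refl
  target∈supp (aT q) = here refl
  target∈supp (aX t k) = here refl

  ZM : Bool → Mat
  ZM b = mat 0 1ω 0ω 0ω (if b then negω 1ω else 1ω)

  opaque
    unfolding _≋_ _*ω_ _⊙_

    HZH : ∀ b → HM ⊙ (ZM b ⊙ HM) ≈M XM b
    HZH false = ent-ext {HM ⊙ (ZM false ⊙ HM)} {XM false} refl refl refl refl
    HZH true = ent-ext {HM ⊙ (ZM true ⊙ HM)} {XM true} refl refl refl refl

    ZM-mono : ∀ b r c → ent (ZM b) r c ≋ mono (λ r → sgn (r ∧ b)) false r c
    ZM-mono false false false = refl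
    ZM-mono false false true = refl
    ZM-mono false true false = refl
    ZM-mono false true true = refl
    ZM-mono true false false = refl
    ZM-mono true false true = refl
    ZM-mono true true false = refl
    ZM-mono true true true = refl

  diag-op : ∀ {M : Vec Bool n → Mat} {q} (u : Vec Bool n → Bool → Amp) → (∀ v r c → ent (M v) r c ≋ mono (u v) false r c) →
            ∀ ψ → op M q ψ ≈ψ diag (λ v → u v (lookup v q)) ψ
  diag-op {M = M} {q} u e ψ v = ≋-trans (op-mono u (λ _ → false) e ψ v)
    (≋-trans (⊠-cong ≋-refl (≋-reflexive (cong ψ (trans (cong (v [ q ]≔_) (BoolP.xor-identityʳ _)) (VecP.[]≔-lookup v q)))))
      (≋-reflexive (sym (diag-apply _ ψ v))))

  module _ {n : ℕ} where
    open Parallel {n} (λ (i : Fin n) → i)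

    H^ : (Fin n → Bool) → State n → State n
    H^ s = par (λ i _ → HM^ (s i)) (allFin n)

    apart-id : Apart (allFin n)
    apart-id = UniqueP.allFin⁺ n

    HM^-false : ∀ {b} → b ≡ false → ∀ r c → ent (HM^ b) r c ≋ mono (λ _ → 1A) false r c
    HM^-false refl = XM-mono false

    HM^-cong : ∀ {b b′} → b ≡ b′ → HM^ b ≈M HM^ b′
    HM^-cong refl = ≈M-refl

    H^-id : ∀ {s} → (∀ i → s i ≡ false) → ∀ ψ → H^ s ψ ≈ψ ψ
    H^-id e ψ = Folding.par-id (λ i → i) (λ i v → HM^-false (e i)) (allFin n) ψ

    H^-xor : ∀ s s′ ψ → H^ s (H^ s′ ψ) ≈ψ H^ (λ i → s i xor s′ i) ψ
    H^-xor s s′ ψ = ≈ψ-trans (par-fuse (allFin n) apart-id (λ _ _ _ _ → refl) (λ _ _ _ _ → refl) ψ)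
      (par-cong (allFin n) (λ i v → HM^-xor (s i) (s′ i)) ≈ψ-refl)

    H^-ext : ∀ {s s′} → (∀ i → s i ≡ s′ i) → ∀ ψ → H^ s ψ ≈ψ H^ s′ ψ
    H^-ext e ψ = par-cong (allFin n) (λ i v → HM^-cong (e i)) ≈ψ-refl

    H^-cong : ∀ s {ψ φ} → ψ ≈ψ φ → H^ s ψ ≈ψ H^ s φ
    H^-cong s = par-congʳ (allFin n)

    H^-comm : ∀ s s′ ψ → H^ s (H^ s′ ψ) ≈ψ H^ s′ (H^ s ψ)
    H^-comm s s′ ψ = ≈ψ-trans (H^-xor s s′ ψ) (≈ψ-trans (H^-ext (λ i → BoolP.xor-comm (s i) (s′ i)) ψ) (≈ψ-sym (H^-xor s′ s ψ)))

    H^-diag : ∀ {s χ} → (∀ i → (∀ v b → χ (v [ i ]≔ b) ≋ χ v) ⊎ s i ≡ false) → ∀ ψ → H^ s (diag χ ψ) ≈ψ diag χ (H^ s ψ)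
    H^-diag {s} {χ} h ψ = par-diag-comm (allFin n) (λ i → Sum.map₂ (λ e v → HM^-false e) (h i)) ψ

    opaque
      unfolding Parallel.par

      par-single : ∀ (q : Fin n) xs → q ∈ xs → Unique xs → ∀ ψ → par (λ i _ → HM^ (i == q)) xs ψ ≈ψ op (λ _ → HM) q ψ
      par-single q (x ∷ xs) (here refl) (q∉ ∷ _) ψ = ≈ψ-trans (op-cong (λ v → HM^-cong (==-refl q)) (none xs q∉)) ≈ψ-refl
        where
          none : ∀ ys → All (q ≢_) ys → par (λ i _ → HM^ (i == q)) ys ψ ≈ψ ψ
          none [] [] = ≈ψ-refl
          none (y ∷ ys) (ne ∷ nes) = ≈ψ-trans (op-id (λ v → HM^-false (==-≢ (λ e → ne (sym e)))) _) (none ys nes)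
      par-single q (x ∷ xs) (there q∈) (x∉ ∷ u) ψ =
        ≈ψ-trans (op-id (λ v → HM^-false (==-≢ (All.lookup x∉ q∈))) _) (par-single q xs q∈ u ψ)

    H^-single : ∀ q ψ → H^ (_== q) ψ ≈ψ op (λ _ → HM) q ψ
    H^-single q ψ = par-single q (allFin n) (MembP.∈-allFin q) (UniqueP.allFin⁺ n) ψ

    diag-one : ∀ (ψ : State n) → diag (λ _ → 1A) ψ ≈ψ ψ
    diag-one ψ v = ≋-trans (≋-reflexive (diag-apply _ ψ v)) (⊠-identityˡ _)

    atom-normal : ∀ (A : Atom g n) → Proper A → ∀ ψ → applyAtom A ψ ≈ψ H^ (after A) (diag (phase A) (H^ (before A) ψ))
    atom-normal (aH q) _ ψ = ≈ψ-sym (≈ψ-trans (H^-id (λ _ → refl) _) (≈ψ-trans (diag-one _) (H^-single q ψ)))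
    atom-normal (aT q) _ ψ = ≈ψ-sym (≈ψ-trans (H^-id (λ _ → refl) _) (≈ψ-trans (diag-cong (λ _ → ≋-refl) (H^-id (λ _ → refl) ψ))
      (≈ψ-sym (diag-op (λ _ r → if r then ω^ 1 else 1A) (λ _ → TM-mono) ψ))))
    atom-normal (aX t k) t∉ ψ = ≈ψ-sym (≈ψ-trans (H^-single t _) (≈ψ-trans (op-cong (λ _ → ≈M-refl {HM}) (≈ψ-trans (diag-cong (λ _ → ≋-refl) (H^-single t ψ))
        (≈ψ-trans (≈ψ-sym (diag-op (λ v r → sgn (r ∧ value k v)) (λ v → ZM-mono (value k v)) _))
          (op-fuse (λ _ _ → refl) ψ))))
      (≈ψ-trans (op-fuse (λ v b → cong (λ c → ZM c ⊙ HM) (comb-update true (ctlList k) t∉ v b)) ψ)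
        (op-cong (λ v → HZH (value k v)) ≈ψ-refl))))

    open DecMemb (FinP._≟_ {n}) using (_∈?_)

    phases-indep : ∀ (As : List (Atom g n)) {q} → All (λ A → q ∉ supp A) As → ∀ v b → phases As (v [ q ]≔ b) ≋ phases As v
    phases-indep [] [] v b = ≋-refl
    phases-indep (A ∷ As) (q∉ ∷ qs) v b = ⊠-cong (phase-indep A q∉ v b) (phases-indep As qs v b)

    afters-other : ∀ (As : List (Atom g n)) {i} → All (λ A → i ≢ target A) As → afters As i ≡ false
    afters-other [] [] = refl
    afters-other (A ∷ As) (ne ∷ nes) = cong₂ _xor_ (after-other A ne) (afters-other As nes)

    -- Induction on the atoms. The Hadamard gates before A commute with those after the tail; they
    -- pass the phases of the tail, which do not read the target of A; and the Hadamard gates after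
    -- the tail pass the phase of A, since no target of the tail lies in the support of A.
    layer-normal : ∀ (As : List (Atom g n)) → AllPairs Fresh As → All Proper As → ∀ ψ →
                   foldr applyAtom ψ As ≈ψ H^ (afters As) (diag (phases As) (H^ (befores As) ψ))
    layer-normal [] [] [] ψ = ≈ψ-sym (≈ψ-trans (H^-id (λ _ → refl) _) (≈ψ-trans (diag-one _) (H^-id (λ _ → refl) ψ)))
    layer-normal (A ∷ As) (fresh ∷ fs) (pr ∷ prs) ψ =
      ≈ψ-trans (atom-normal A pr (foldr applyAtom ψ As))
      (≈ψ-trans (H^-cong a (diag-cong (λ _ → ≋-refl) (H^-cong b (layer-normal As fs prs ψ))))
      (≈ψ-trans (H^-cong a (diag-cong (λ _ → ≋-refl) (H^-comm b as _)))
      (≈ψ-trans (H^-cong a (diag-cong (λ _ → ≋-refl) (H^-cong as (H^-diag move₁ (H^ bs ψ)))))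
      (≈ψ-trans (H^-cong a (≈ψ-sym (H^-diag move₂ (diag (phases As) (H^ b (H^ bs ψ))))))
      (≈ψ-trans (H^-xor a as _)
        (H^-cong (λ i → a i xor as i) (≈ψ-trans (diag-fuse (phase A) (phases As) _) (diag-cong (λ _ → ≋-refl) (H^-xor b bs ψ)))))))))
      where
        a b as bs : Fin n → Bool
        a = after A
        b = before A
        as = afters As
        bs = befores As
        move₁ : ∀ i → (∀ v c → phases As (v [ i ]≔ c) ≋ phases As v) ⊎ b i ≡ false
        move₁ i with i FinP.≟ target A
        ... | yes refl = inj₁ (phases-indep As (All.map proj₁ fresh))
        ... | no ne = inj₂ (before-other A ne)
        move₂ : ∀ i → (∀ v c → phase A (v [ i ]≔ c) ≋ phase A v) ⊎ as i ≡ false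
        move₂ i with i ∈? supp A
        ... | no i∉ = inj₁ (phase-indep A i∉)
        ... | yes i∈ = inj₂ (afters-other As (All.map (λ { (_ , t∉) refl → t∉ i∈ }) fresh))

-- Encoding the diagonal part of a layer by the bit matrices f and e.

module GateColumns where
  open Amplitudes
  open Operators
  open GateMatrices
  open BlockAction
  open LayerNormalForm

  private variable
    n : ℕ
    g : Bool

  -- The membership witness makes the list nonempty: the conjunction over an empty list would be
  -- true.
  comb-false : ∀ g {I : Set} (xs : List I) {h : I → Bool} {x} → x ∈ xs → (∀ i → h i ≡ false) → comb g xs h ≡ false
  comb-false false {I} xs {h} x∈ z = go xs
    where
      go : ∀ (ys : List I) → comb false ys h ≡ false
      go [] = refl
      go (y ∷ ys) = cong₂ _xor_ (z y) (go ys)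
  comb-false true (x ∷ xs) {h} x∈ z = cong (_∧ comb true xs h) (z x)

  xor-single : ∀ (xs : List (Fin n)) {h : Fin n → Bool} {c} → c ∈ xs → Unique xs → (∀ i → i ≢ c → h i ≡ false) → comb false xs h ≡ h c
  xor-single (x ∷ xs) {h} {c} (here refl) (c∉ ∷ _) z = trans (cong (h c xor_) (none xs c∉)) (BoolP.xor-identityʳ _)
    where
      none : ∀ ys → All (c ≢_) ys → comb false ys h ≡ false
      none [] [] = refl
      none (y ∷ ys) (ne ∷ nes) = cong₂ _xor_ (z y (λ e → ne (sym e))) (none ys nes)
  xor-single (x ∷ xs) {h} {c} (there c∈) (x∉ ∷ u) z = trans (cong (_xor comb false xs h) (z x (All.lookup x∉ c∈))) (xor-single xs c∈ u z)

  ≡-by-⇔ : ∀ {a b} → (a ≡ true → b ≡ true) → (b ≡ true → a ≡ true) → a ≡ b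
  ≡-by-⇔ {false} {false} f h = refl
  ≡-by-⇔ {false} {true} f h = h refl
  ≡-by-⇔ {true} {b} f h = sym (f refl)

  ∧-intro : ∀ {I : Set} (xs : List I) {h : I → Bool} → (∀ {i} → i ∈ xs → h i ≡ true) → comb true xs h ≡ true
  ∧-intro [] f = refl
  ∧-intro (x ∷ xs) f rewrite f (here refl) = ∧-intro xs (λ p → f (there p))

  ∧-elim : ∀ {I : Set} (xs : List I) {h : I → Bool} → comb true xs h ≡ true → ∀ {i} → i ∈ xs → h i ≡ true
  ∧-elim (x ∷ xs) {h} e (here refl) with h x
  ... | true = refl
  ∧-elim (x ∷ xs) {h} e (there p) with h x
  ... | true = ∧-elim xs e p

  elem-∈ : ∀ (i : Fin n) cs → elem i cs ≡ true → i ∈ cs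
  elem-∈ i (c ∷ cs) e with i == c in eq
  ... | true = here (==-true eq)
  ... | false = there (elem-∈ i cs e)

  ∈-elem : ∀ {i : Fin n} {cs} → i ∈ cs → elem i cs ≡ true
  ∈-elem {i = i} {c ∷ cs} (here refl) = cong (_∨ elem i cs) (==-refl i)
  ∈-elem {i = i} {c ∷ cs} (there p) = trans (cong ((i == c) ∨_) (∈-elem p)) (BoolP.∨-zeroʳ _)

  -- Positions outside the mask are filled with the neutral element, 0 for parity and 1 for
  -- conjunction. For g = false a single position remains, and the parity of one bit is that bit.
  comb-masked : ∀ (k : Ctl g n) v → comb g (allFin n) (λ i → (mask k i ∧ lookup v i) xor (g ∧ not (mask k i))) ≡ value k v
  comb-masked {false} (one c) v = trans
    (xor-single (allFin _) (MembP.∈-allFin c) (UniqueP.allFin⁺ _) (λ i ne → cong (λ b → ((b ∨ false) ∧ lookup v i) xor false) (==-≢ ne)))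
    (trans (cong (λ b → ((b ∨ false) ∧ lookup v c) xor false) (==-refl c)) (trans (BoolP.xor-identityʳ _) (sym (BoolP.∧-identityʳ _))))
  comb-masked {true} {n} k v = ≡-by-⇔
    (λ e → ∧-intro (ctlList k) (λ {i} i∈ → on (mask k i) (lookup v i) (∈-elem i∈) (∧-elim (allFin n) e (MembP.∈-allFin i))))
    (λ e → ∧-intro (allFin n) (λ {i} _ → back (mask k i) (lookup v i) (λ m → ∧-elim (ctlList k) e (elem-∈ i (ctlList k) m))))
    where
      on : ∀ m x → m ≡ true → (m ∧ x) xor not m ≡ true → x ≡ true
      on true true refl e = refl
      back : ∀ m x → (m ≡ true → x ≡ true) → (m ∧ x) xor not m ≡ true
      back false x f = refl
      back true x f rewrite f refl = refl

  -- Only the row of the target is nonzero. A T gate sets the diagonal entry of f, which a proper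
  -- flip never sets because its target is not one of its controls; so the diagonal tells the two
  -- apart.
  colF colE : Atom g n → Fin n → Fin n → Bool
  colF (aH q) j i = false
  colF (aT q) j i = (j == q) ∧ (i == q)
  colF (aX t k) j i = (j == t) ∧ mask k i
  colE (aH q) j i = false
  colE {g} (aT q) j i = (j == q) ∧ (g ∧ not (i == q))
  colE {g} (aX t k) j i = (j == t) ∧ (g ∧ not (mask k i))

  colFs colEs : List (Atom g n) → Fin n → Fin n → Bool
  colFs As j i = foldr (λ A → colF A j i xor_) false As
  colEs As j i = foldr (λ A → colE A j i xor_) false As

  -- The phase that a block produces for target j from the rows `f` and `e`: the sign from the
  -- combination of its cells, and five T gates on the diagonal cell, which holds `f j ∧ v j`.
  column : Bool → (Fin n → Bool) → (Fin n → Bool) → Fin n → Vec Bool n → Amp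
  column {n} g f e j v = sgn (lookup v j ∧ comb g (allFin n) (λ i → (f i ∧ lookup v i) xor e i)) ⊠ (if f j ∧ lookup v j then ω^ 5 else 1A)

  column-cong : ∀ g {f f′ e e′ : Fin n → Bool} j v → (∀ i → f i ≡ f′ i) → (∀ i → e i ≡ e′ i) → column g f e j v ≡ column g f′ e′ j v
  column-cong {n} g j v ef ee = cong₂ (λ a b → sgn (lookup v j ∧ a) ⊠ (if b ∧ lookup v j then ω^ 5 else 1A))
    (comb-cong g (allFin n) (λ i → cong₂ (λ a b → (a ∧ lookup v i) xor b) (ef i) (ee i))) (ef j)

  -- A zero row is silent for conjunction too, as the conjunction of at least one 0 is 0. Idle
  -- qubits and targets of Hadamard gates therefore need no switch of their own.
  column-zero : ∀ g {f e : Fin n → Bool} j v → (∀ i → f i ≡ false) → (∀ i → e i ≡ false) → column g f e j v ≋ 1A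
  column-zero {n} g {f} {e} j v zf ze = ≋-trans (≋-reflexive (column-cong g j v zf ze))
    (≋-trans (⊠-cong (≋-reflexive (cong (λ b → sgn (lookup v j ∧ b)) (comb-false g (allFin n) (MembP.∈-allFin j) (λ _ → refl)))) ≋-refl)
      (≋-trans (⊠-identityʳ _) (≋-reflexive (cong sgn (BoolP.∧-zeroʳ (lookup v j))))))
    where
      ⊠-identityʳ : ∀ x → x ⊠ 1A ≋ x
      ⊠-identityʳ x = ≋-trans (⊠-comm x 1A) (⊠-identityˡ x)

  colF-other : ∀ (A : Atom g n) {j} → j ≢ target A → ∀ i → colF A j i ≡ false
  colF-other (aH q) ne i = refl
  colF-other (aT q) ne i = cong (_∧ _) (==-≢ ne)
  colF-other (aX t k) ne i = cong (_∧ _) (==-≢ ne)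

  colE-other : ∀ (A : Atom g n) {j} → j ≢ target A → ∀ i → colE A j i ≡ false
  colE-other (aH q) ne i = refl
  colE-other (aT q) ne i = cong (_∧ _) (==-≢ ne)
  colE-other (aX t k) ne i = cong (_∧ _) (==-≢ ne)

  cols-other : ∀ (c : Atom g n → Fin n → Fin n → Bool) → (∀ A {j} → j ≢ target A → ∀ i → c A j i ≡ false) →
               ∀ As {j} → All (λ A → j ≢ target A) As → ∀ i → foldr (λ A → c A j i xor_) false As ≡ false
  cols-other c h [] [] i = refl
  cols-other c h (A ∷ As) (ne ∷ nes) i = cong₂ _xor_ (h A ne i) (cols-other c h As nes i)

  ∏-one : ∀ {I : Set} {F : I → Amp} xs → (∀ i → F i ≋ 1A) → ∏ xs F ≋ 1A
  ∏-one [] e = ≋-refl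
  ∏-one (x ∷ xs) e = ≋-trans (⊠-cong (e x) (∏-one xs e)) (⊠-identityˡ _)

  ∏-single : ∀ (xs : List (Fin n)) {F : Fin n → Amp} {c} → c ∈ xs → Unique xs → (∀ i → i ≢ c → F i ≋ 1A) → ∏ xs F ≋ F c
  ∏-single (x ∷ xs) {F} {c} (here refl) (c∉ ∷ _) e = ≋-trans (⊠-cong ≋-refl (none xs c∉)) (≋-trans (⊠-comm _ _) (⊠-identityˡ _))
    where
      none : ∀ ys → All (c ≢_) ys → ∏ ys F ≋ 1A
      none [] [] = ≋-refl
      none (y ∷ ys) (ne ∷ nes) = ≋-trans (⊠-cong (e y (λ q → ne (sym q))) (none ys nes)) (⊠-identityˡ _)
  ∏-single (x ∷ xs) (there c∈) (x∉ ∷ u) e = ≋-trans (⊠-cong (e x (All.lookup x∉ c∈)) (∏-single xs c∈ u e)) (⊠-identityˡ _)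

  columns-atom : ∀ (A : Atom g n) → Proper A → ∀ v → ∏ (allFin n) (λ j → column g (colF A j) (colE A j) j v) ≋ phase A v
  columns-atom {g} {n} A pr v = ≋-trans
    (∏-single (allFin n) (MembP.∈-allFin (target A)) (UniqueP.allFin⁺ n)
      (λ j ne → column-zero g j v (colF-other A ne) (colE-other A ne)))
    (at A pr)
    where
      at : ∀ (A : Atom g n) → Proper A → column g (colF A (target A)) (colE A (target A)) (target A) v ≋ phase A v
      at (aH q) _ = column-zero g q v (λ _ → refl) (λ _ → refl)
      at (aT q) _ = ≋-trans (≋-reflexive (cong₂ (λ a b → sgn (lookup v q ∧ a) ⊠ (if b ∧ lookup v q then ω^ 5 else 1A))
          (trans (comb-cong g (allFin n) (λ i → cong₂ (λ a b → (a ∧ lookup v i) xor b)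
                   (trans (cong (_∧ (i == q)) (==-refl q)) (sym (BoolP.∨-identityʳ _)))
                   (trans (cong (_∧ (g ∧ not (i == q))) (==-refl q)) (cong (λ b → g ∧ not b) (sym (BoolP.∨-identityʳ (i == q)))))))
            (comb-masked {g} (one q) v))
          (trans (cong (_∧ (q == q)) (==-refl q)) (==-refl q))))
        (bits (lookup v q))
        where
          bits : ∀ b → sgn (b ∧ (b ∧ true)) ⊠ (if b then ω^ 5 else 1A) ≋ (if b then ω^ 1 else 1A)
          bits false = ⊠-identityˡ _
          bits true = sgn-T⁵
      at (aX t k) t∉ = ≋-trans (≋-reflexive (cong₂ (λ a b → sgn (lookup v t ∧ a) ⊠ (if b ∧ lookup v t then ω^ 5 else 1A))
          (trans (comb-cong g (allFin n) (λ i → cong₂ (λ a b → (a ∧ lookup v i) xor b)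
                   (cong (_∧ mask k i) (==-refl t)) (cong (_∧ (g ∧ not (mask k i))) (==-refl t))))
            (comb-masked k v))
          (trans (cong (_∧ mask k t) (==-refl t)) (off (mask k t) (λ m → t∉ (elem-∈ t (ctlList k) m))))))
        (≋-trans (⊠-comm _ _) (⊠-identityˡ _))
        where
          off : ∀ b → (b ≡ true → ⊥) → b ≡ false
          off false f = refl
          off true f = ⊥-elim (f refl)

  -- The atoms of a layer have distinct targets, so for each j at most one of them has a nonzero row
  -- j, and the xor of the rows is the row of that atom.
  columns-phases : ∀ (As : List (Atom g n)) → AllPairs Fresh As → All Proper As → ∀ v →
                   ∏ (allFin n) (λ j → column g (colFs As j) (colEs As j) j v) ≋ phases As v
  columns-phases {g} {n} [] [] [] v = ∏-one (allFin n) (λ j → column-zero g j v (λ _ → refl) (λ _ → refl))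
  columns-phases {g} {n} (A ∷ As) (fresh ∷ fs) (pr ∷ prs) v = ≋-trans (∏-cong (allFin n) split)
    (≋-trans (≋-sym (∏-⊠ _ _ (allFin n))) (⊠-cong (columns-atom A pr v) (columns-phases As fs prs v)))
    where
      split : ∀ j → column g (colFs (A ∷ As) j) (colEs (A ∷ As) j) j v
                  ≋ column g (colF A j) (colE A j) j v ⊠ column g (colFs As j) (colEs As j) j v
      split j with j FinP.≟ target A
      ... | yes refl = ≋-trans (≋-reflexive (column-cong g {f′ = colF A j} {e′ = colE A j} j v
              (λ i → trans (cong (colF A j i xor_) (cols-other colF colF-other As others i)) (BoolP.xor-identityʳ _))
              (λ i → trans (cong (colE A j i xor_) (cols-other colE colE-other As others i)) (BoolP.xor-identityʳ _))))
            (≋-trans (≋-trans (≋-sym (⊠-identityˡ _)) (⊠-comm _ _))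
              (⊠-cong ≋-refl (≋-sym (column-zero g j v (cols-other colF colF-other As others) (cols-other colE colE-other As others)))))
        where
          others : All (λ B → target A ≢ target B) As
          others = All.map (λ {B} → λ { (t∉ , _) e → t∉ (subst (_∈ supp B) (sym e) (target∈supp B)) }) fresh
      ... | no ne = ≋-trans (≋-reflexive (column-cong g j v
              (λ i → cong (_xor colFs As j i) (colF-other A ne i)) (λ i → cong (_xor colEs As j i) (colE-other A ne i))))
            (≋-trans (≋-sym (⊠-identityˡ _)) (⊠-cong (≋-sym (column-zero g j v (colF-other A ne) (colE-other A ne))) ≋-refl))

  atomsOf : Placed g n → List (Atom g n)
  atomsOf (pH q) = aH q ∷ []
  atomsOf (pT q) = aT q ∷ []
  atomsOf (pF k c ts) = map (λ t → aX t (one c)) (Vec.toList ts)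
  atomsOf (pTof k cs t) = aX t (many (Vec.toList cs)) ∷ []

  allOn-toList : ∀ {k} (cs : Vec (Fin n) k) v → allOn cs v ≡ comb true (Vec.toList cs) (lookup v)
  allOn-toList [] v = refl
  allOn-toList (c ∷ cs) v = cong (lookup v c ∧_) (allOn-toList cs v)

  atoms-cong : ∀ (As : List (Atom g n)) {ψ φ} → ψ ≈ψ φ → foldr applyAtom ψ As ≈ψ foldr applyAtom φ As
  atoms-cong [] e = e
  atoms-cong (aH q ∷ As) e = op-cong (λ _ → ≈M-refl) (atoms-cong As e)
  atoms-cong (aT q ∷ As) e = op-cong (λ _ → ≈M-refl) (atoms-cong As e)
  atoms-cong (aX t k ∷ As) e = op-cong (λ _ → ≈M-refl) (atoms-cong As e)

  gate-atoms : ∀ (G : Placed g n) → Unique (support G) → ∀ ψ → applyPlaced G ψ ≈ψ foldr applyAtom ψ (atomsOf G)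
  gate-atoms {g} (pH q) u ψ = pH-op {g = g} q ψ
  gate-atoms {g} (pT q) u ψ = pT-op {g = g} q ψ
  gate-atoms {g} {n} (pF k c ts) u ψ = ≈ψ-trans (pF-op {g = g} k c ts u ψ) (fold (Vec.toList ts))
    where
      fold : ∀ ts → foldr (λ t → op (λ v → XM (lookup v c)) t) ψ ts ≈ψ foldr applyAtom ψ (map (λ t → aX {g} t (one c)) ts)
      fold [] = ≈ψ-refl
      fold (t ∷ ts) = op-cong (λ v → XM-≡ (sym (BoolP.∧-identityʳ _))) (fold ts)
        where
          XM-≡ : ∀ {a b} → a ≡ b → XM a ≈M XM b
          XM-≡ refl = ≈M-refl
  gate-atoms (pTof k cs t) u ψ = ≈ψ-trans (pTof-op k cs t ψ) (op-cong (λ v → XM-≡ (allOn-toList cs v)) ≈ψ-refl)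
    where
      XM-≡ : ∀ {a b} → a ≡ b → XM a ≈M XM b
      XM-≡ refl = ≈M-refl

  layerAtoms : List (Placed g n) → List (Atom g n)
  layerAtoms = concatMap atomsOf

  unique-++ : ∀ {A : Set} (xs : List A) {ys} → Unique (xs ++ ys) → Unique xs × Unique ys × (∀ {z} → z ∈ xs → z ∉ ys)
  unique-++ [] u = [] , u , λ ()
  unique-++ (x ∷ xs) (x∉ ∷ u) with unique-++ xs u
  ... | u₁ , u₂ , dis = (AllP.++⁻ˡ xs x∉ ∷ u₁) , u₂ , λ { (here refl) z∈ → All.lookup (AllP.++⁻ʳ xs x∉) z∈ refl ; (there p) → dis p }

  layer-atoms : ∀ (Gs : List (Placed g n)) → Unique (concatMap support Gs) → ∀ ψ → foldr applyPlaced ψ Gs ≈ψ foldr applyAtom ψ (layerAtoms Gs)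
  layer-atoms [] u ψ = ≈ψ-refl
  layer-atoms (G ∷ Gs) u ψ with unique-++ (support G) u
  ... | uG , uGs , _ = ≈ψ-trans (gate-atoms G uG _) (≈ψ-trans (atoms-cong (atomsOf G) (layer-atoms Gs uGs ψ))
      (λ v → ≋-reflexive (cong (λ φ → φ v) (sym (ListP.foldr-++ applyAtom ψ (atomsOf G) (layerAtoms Gs))))))

  Within : List (Fin n) → Atom g n → Set
  Within qs A = ∀ q → q ∈ supp A → q ∈ qs

  atoms-within : ∀ (G : Placed g n) → All (Within (support G)) (atomsOf G)
  atoms-within (pH q) = (λ _ p → p) ∷ []
  atoms-within (pT q) = (λ _ p → p) ∷ []
  atoms-within (pF k c ts) = AllP.map⁺ (All.tabulate (λ { t∈ _ (here refl) → there t∈ ; t∈ _ (there (here refl)) → here refl }))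
  atoms-within (pTof k cs t) = (λ _ p → p) ∷ []

  layer-within : ∀ (Gs : List (Placed g n)) → All (Within (concatMap support Gs)) (layerAtoms Gs)
  layer-within [] = []
  layer-within (G ∷ Gs) = AllP.++⁺ (All.map (λ f q p → MembP.∈-++⁺ˡ (f q p)) (atoms-within G)) (All.map (λ f q p → MembP.∈-++⁺ʳ (support G) (f q p)) (layer-within Gs))

  gate-good : ∀ (G : Placed g n) → Unique (support G) → AllPairs Fresh (atomsOf G) × All Proper (atomsOf G)
  gate-good (pH q) u = ([] ∷ []) , (tt ∷ [])
  gate-good (pT q) u = ([] ∷ []) , (tt ∷ [])
  gate-good {g} (pF k c ts) (c∉ ∷ u) = AllPairsP.map⁺ (fresh (Vec.toList ts) c∉ u) , AllP.map⁺ (All.map (λ { ne (here e) → ne (sym e) }) c∉)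
    where
      fresh : ∀ ts → All (c ≢_) ts → Unique ts → AllPairs (λ s t → Fresh {g} (aX s (one c)) (aX t (one c))) ts
      fresh [] [] [] = []
      fresh (t ∷ ts) (c≢t ∷ c∉) (t∉ ∷ u) = All.zipWith (λ { (t≢s , c≢s) →
          (λ { (here e) → t≢s e ; (there (here e)) → c≢t (sym e) }) , (λ { (here e) → t≢s (sym e) ; (there (here e)) → c≢s (sym e) }) }) (t∉ , c∉)
        ∷ fresh ts c∉ u
  gate-good (pTof k cs t) (t∉ ∷ u) = ([] ∷ []) , ((λ p → All.lookup t∉ p refl) ∷ [])

  layer-good : ∀ (Gs : List (Placed g n)) → Unique (concatMap support Gs) → AllPairs Fresh (layerAtoms Gs) × All Proper (layerAtoms Gs)
  layer-good [] u = [] , []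
  layer-good (G ∷ Gs) u with unique-++ (support G) u
  ... | uG , uGs , dis with gate-good G uG | layer-good Gs uGs
  ...   | f₁ , p₁ | f₂ , p₂ = AllPairsP.++⁺ f₁ f₂ (All.map (λ {A} inG → All.map (λ {B} inGs →
          (λ t∈ → dis (inG _ (target∈supp A)) (inGs _ t∈)) , (λ t∈ → dis (inG _ t∈) (inGs _ (target∈supp B)))) (layer-within Gs)) (atoms-within G))
        , AllP.++⁺ p₁ p₂

  layer-applies : ∀ (Λ : Layer g n) ψ → let As = layerAtoms (proj₁ Λ) in
                  applyLayer Λ ψ ≈ψ H^ (afters As) (diag (phases As) (H^ (befores As) ψ))
  layer-applies (Gs , u) ψ = ≈ψ-trans (layer-atoms Gs u ψ)
    (layer-normal (layerAtoms Gs) (proj₁ (layer-good Gs u)) (proj₂ (layer-good Gs u)) ψ)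

-- Restriction to the code space with fixed encoding and zero ancillas; universality.

module UniversalityProof where
  open Amplitudes
  open Operators
  open GateMatrices
  open UniversalCircuit
  open BlockAction
  open LayerNormalForm
  open GateColumns

  opaque
    unfolding _≋_

    ≈ψ-≈S : ∀ {N} {ψ φ : State N} → ψ ≈ψ φ → ψ ≈S φ
    ≈ψ-≈S e = e

  basis-≡ : ∀ {N} {v w : Vec Bool N} → v ≡ w → basis v w ≡ 1A
  basis-≡ {v = v} {w} e with VecP.≡-dec BoolP._≟_ v w
  ... | yes _ = refl
  ... | no ne = ⊥-elim (ne e)

  basis-≢ : ∀ {N} {v w : Vec Bool N} → v ≢ w → basis v w ≡ 0A
  basis-≢ {v = v} {w} ne with VecP.≡-dec BoolP._≟_ v w
  ... | yes e = ⊥-elim (ne e)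
  ... | no _ = refl

  module TensorProduct {n m : ℕ} (x : Vec Bool m) (a : ℕ) where

    zeros : Vec Bool a
    zeros = Vec.replicate a false

    tensor : State n → State (n + (m + a))
    tensor ψ = tensorOut ψ x a

    take-drop-++ : ∀ {k l} (y : Vec Bool k) (r : Vec Bool l) → Vec.take k (y Vec.++ r) ≡ y × Vec.drop k (y Vec.++ r) ≡ r
    take-drop-++ {k} y r = VecP.++-injective (Vec.take k (y Vec.++ r)) y (VecP.take++drop≡id k (y Vec.++ r))

    tensor-on : ∀ ψ y → tensor ψ (y Vec.++ (x Vec.++ zeros)) ≡ ψ y
    tensor-on ψ y with VecP.≡-dec BoolP._≟_ (Vec.take m (Vec.drop n (y Vec.++ (x Vec.++ zeros)))) x
                     | VecP.≡-dec BoolP._≟_ (Vec.drop m (Vec.drop n (y Vec.++ (x Vec.++ zeros)))) zeros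
    ... | yes _ | yes _ = cong ψ (proj₁ (take-drop-++ y (x Vec.++ zeros)))
    ... | no ne | _ = ⊥-elim (ne (trans (cong (Vec.take m) (proj₂ (take-drop-++ y (x Vec.++ zeros)))) (proj₁ (take-drop-++ x zeros))))
    ... | yes _ | no ne = ⊥-elim (ne (trans (cong (Vec.drop m) (proj₂ (take-drop-++ y (x Vec.++ zeros)))) (proj₂ (take-drop-++ x zeros))))

    tensor-off : ∀ ψ (y : Vec Bool n) r → r ≢ x Vec.++ zeros → tensor ψ (y Vec.++ r) ≡ 0A
    tensor-off ψ y r r≢ with VecP.≡-dec BoolP._≟_ (Vec.take m (Vec.drop n (y Vec.++ r))) x | VecP.≡-dec BoolP._≟_ (Vec.drop m (Vec.drop n (y Vec.++ r))) zeros
    ... | yes p | yes q = ⊥-elim (r≢ (trans (sym (proj₂ (take-drop-++ y r))) (trans (sym (VecP.take++drop≡id m (Vec.drop n (y Vec.++ r)))) (cong₂ Vec._++_ p q))))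
    ... | no _ | _ = refl
    ... | yes _ | no _ = refl

    -- A basis vector splits as y followed by the other qubits, and `tensor ψ` lives on a single
    -- value of these. The second hypothesis is the claim that encoding and ancilla qubits are
    -- restored.
    on-tensor : ∀ {ψ : State n} {φ : State (n + (m + a))} →
                (∀ y → φ (y Vec.++ (x Vec.++ zeros)) ≋ ψ y) → (∀ y r → r ≢ x Vec.++ zeros → φ (y Vec.++ r) ≋ 0A) → φ ≈ψ tensor ψ
    on-tensor {ψ} {φ} on off w = subst (λ w → φ w ≋ tensor ψ w) (VecP.take++drop≡id n w) (case (VecP.≡-dec BoolP._≟_ (Vec.drop n w) (x Vec.++ zeros)))
      where
        case : Dec (Vec.drop n w ≡ x Vec.++ zeros) → φ (Vec.take n w Vec.++ Vec.drop n w) ≋ tensor ψ (Vec.take n w Vec.++ Vec.drop n w)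
        case (yes p) = subst (λ r → φ (Vec.take n w Vec.++ r) ≋ tensor ψ (Vec.take n w Vec.++ r)) (sym p)
          (≋-trans (on (Vec.take n w)) (≋-reflexive (sym (tensor-on ψ (Vec.take n w)))))
        case (no ne) = ≋-trans (off (Vec.take n w) (Vec.drop n w) ne) (≋-reflexive (sym (tensor-off ψ (Vec.take n w) (Vec.drop n w) ne)))

    tensor-cong : ∀ {ψ φ} → ψ ≈ψ φ → tensor ψ ≈ψ tensor φ
    tensor-cong {ψ} {φ} e = on-tensor (λ y → ≋-trans (≋-reflexive (tensor-on ψ y)) (e y)) (λ y r ne → ≋-reflexive (tensor-off ψ y r ne))

    tensor-basis : ∀ y → basis (y Vec.++ (x Vec.++ zeros)) ≈ψ tensor (basis y)
    tensor-basis y = on-tensor on off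
      where
        on : ∀ y′ → basis (y Vec.++ (x Vec.++ zeros)) (y′ Vec.++ (x Vec.++ zeros)) ≋ basis y y′
        on y′ with VecP.≡-dec BoolP._≟_ y y′
        ... | yes p = ≋-reflexive (basis-≡ (cong (Vec._++ (x Vec.++ zeros)) p))
        ... | no ne = ≋-reflexive (basis-≢ (λ p → ne (VecP.++-injectiveˡ y y′ p)))
        off : ∀ y′ r → r ≢ x Vec.++ zeros → basis (y Vec.++ (x Vec.++ zeros)) (y′ Vec.++ r) ≋ 0A
        off y′ r ne = ≋-reflexive (basis-≢ (λ p → ne (sym (VecP.++-injectiveʳ y y′ p))))

    -- A diagonal operator moves no amplitude out of the code space, so restoring the ancillas comes
    -- for free and only the values of χ on the code space count.
    tensor-diag : ∀ χ ψ → diag χ (tensor ψ) ≈ψ tensor (diag (λ y → χ (y Vec.++ (x Vec.++ zeros))) ψ)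
    tensor-diag χ ψ = on-tensor
      (λ y → ≋-trans (≋-reflexive (diag-apply χ (tensor ψ) (y Vec.++ (x Vec.++ zeros))))
        (≋-trans (⊠-cong ≋-refl (≋-reflexive (tensor-on ψ y))) (≋-reflexive (sym (diag-apply _ ψ y)))))
      (λ y r ne → ≋-trans (≋-reflexive (diag-apply χ (tensor ψ) (y Vec.++ r)))
        (≋-trans (⊠-cong ≋-refl (≋-reflexive (tensor-off ψ y r ne))) (⊠-zeroʳ _)))

    tensor-op : ∀ {M : Vec Bool (n + (m + a)) → Mat} {M′ : Vec Bool n → Mat} i → (∀ y → M (y Vec.++ (x Vec.++ zeros)) ≡ M′ y) →
                ∀ ψ → op M (i ↑ˡ (m + a)) (tensor ψ) ≈ψ tensor (op M′ i ψ)
    tensor-op {M} {M′} i eM ψ = on-tensor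
      (λ y → let r = x Vec.++ zeros in op-by M (i ↑ˡ (m + a)) (tensor ψ) (y Vec.++ r) (≋-trans
        (≋-reflexive (row-cong (eM y) (VecP.lookup-++ˡ y r i)
          (trans (cong (tensor ψ) (VecP.[]≔-++-↑ˡ y r i)) (tensor-on ψ (y [ i ]≔ false)))
          (trans (cong (tensor ψ) (VecP.[]≔-++-↑ˡ y r i)) (tensor-on ψ (y [ i ]≔ true)))))
        (≋-reflexive (sym (op-apply M′ i ψ y)))))
      (λ y r ne → op-by M (i ↑ˡ (m + a)) (tensor ψ) (y Vec.++ r) (≋-trans
        (≋-reflexive (row-cong {A = M (y Vec.++ r)} {l = lookup (y Vec.++ r) (i ↑ˡ (m + a))} refl refl
          (trans (cong (tensor ψ) (VecP.[]≔-++-↑ˡ y r i)) (tensor-off ψ (y [ i ]≔ false) r ne))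
          (trans (cong (tensor ψ) (VecP.[]≔-++-↑ˡ y r i)) (tensor-off ψ (y [ i ]≔ true) r ne))))
        (≋-trans (⊞-cong (⊠-zeroʳ _) (⊠-zeroʳ _)) (⊞-identityˡ 0A))))

  -- Past the end of the circuit the layer is empty. Its code consists of zeros, so circuits of
  -- depth less than d are padded with levels that act as the identity.
  layerAt : ∀ {g n} → ℕ → Circuit g n → Layer g n
  layerAt k [] = [] , []
  layerAt zero (Λ ∷ C) = Λ
  layerAt (suc k) (Λ ∷ C) = layerAt k C

  run-layerAt : ∀ {g n} d (C : Circuit g n) → length C ≤ d → ∀ ψ → run (tabulate {n = d} (λ l → layerAt (toℕ l) C)) ψ ≡ run C ψ
  run-layerAt zero [] _ ψ = refl
  run-layerAt (suc d) [] _ ψ = run-layerAt d [] z≤n ψ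
  run-layerAt (suc d) (Λ ∷ C) (s≤s h) ψ = run-layerAt d C h (applyLayer Λ ψ)

  module Universality (n′ d : ℕ) (g : Bool) where
    open Circuits n′ d renaming (N to Nq; v to vᵇ; τ to τᵇ; τ′ to τ′ᵇ; f to fᵇ; e to eᵇ; p to pᵇ; r to rᵇ)
    open BlockSemantics n′ d

    codeRow : (Fin d → List (Atom g n)) → Fin d → Fin rows → Fin n → Bool
    codeRow As l zero i = befores (As l) i
    codeRow As l (suc zero) i = afters (As l) i
    codeRow As l (suc (suc ρ)) i = [ (λ j → colFs (As l) j i) , (λ j → colEs (As l) j i) ]′ (splitAt n ρ)

    encode : (Fin d → List (Atom g n)) → Vec Bool m
    encode As = Vec.tabulate (λ q → uncurry (λ l y → uncurry (codeRow As l) (remQuot {rows} n y)) (remQuot {d} (rows * n) q))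

    lookup-encode : ∀ As l ρ i → lookup (encode As) (encRow l ρ i) ≡ codeRow As l ρ i
    lookup-encode As l ρ i = trans (VecP.lookup∘tabulate _ (encRow l ρ i)) (trans
      (cong (uncurry (λ l y → uncurry (codeRow As l) (remQuot {rows} n y))) (FinP.remQuot-combine {d} {rows * n} l (combine ρ i)))
      (cong (uncurry (codeRow As l)) (FinP.remQuot-combine {rows} {n} ρ i)))

    opaque
      unfolding addr

      addr-v : ∀ i → addr (vᵇ i) ≡ i ↑ˡ (m + a)
      addr-v i = refl

      at-v : ∀ (y : Vec Bool n) r i → (y Vec.++ r) at vᵇ i ≡ lookup y i
      at-v y r i = VecP.lookup-++ˡ y r i

      at-encAddr : ∀ (y : Vec Bool n) (x : Vec Bool m) (z : Vec Bool a) q → lookup (y Vec.++ (x Vec.++ z)) (encAddr q) ≡ lookup x q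
      at-encAddr y x z q = trans (VecP.lookup-++ʳ y (x Vec.++ z) (q ↑ˡ a)) (VecP.lookup-++ˡ x z q)

      at-ancAddr : ∀ (y : Vec Bool n) (x : Vec Bool m) (z : Vec Bool a) q → lookup (y Vec.++ (x Vec.++ z)) (ancAddr q) ≡ lookup z q
      at-ancAddr y x z q = trans (VecP.lookup-++ʳ y (x Vec.++ z) (m ↑ʳ q)) (VecP.lookup-++ʳ x z q)

      at-τ : ∀ (y : Vec Bool n) (x : Vec Bool m) (z : Vec Bool a) l i → (y Vec.++ (x Vec.++ z)) at τᵇ l i ≡ lookup x (encRow l zero i)
      at-τ y x z l i = at-encAddr y x z (encRow l zero i)

      at-τ′ : ∀ (y : Vec Bool n) (x : Vec Bool m) (z : Vec Bool a) l i → (y Vec.++ (x Vec.++ z)) at τ′ᵇ l i ≡ lookup x (encRow l (suc zero) i)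
      at-τ′ y x z l i = at-encAddr y x z (encRow l (suc zero) i)

      at-f : ∀ (y : Vec Bool n) (x : Vec Bool m) (z : Vec Bool a) l j i → (y Vec.++ (x Vec.++ z)) at fᵇ l j i ≡ lookup x (encRow l (rowF j) i)
      at-f y x z l j i = at-encAddr y x z (encRow l (rowF j) i)

      at-e : ∀ (y : Vec Bool n) (x : Vec Bool m) (z : Vec Bool a) l j i → (y Vec.++ (x Vec.++ z)) at eᵇ l j i ≡ lookup x (encRow l (rowE j) i)
      at-e y x z l j i = at-encAddr y x z (encRow l (rowE j) i)

      at-p : ∀ (y : Vec Bool n) (x : Vec Bool m) (z : Vec Bool a) i j → (y Vec.++ (x Vec.++ z)) at pᵇ i j ≡ lookup z (combine (i ↑ˡ n) j)
      at-p y x z i j = at-ancAddr y x z (combine (i ↑ˡ n) j)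

      at-r : ∀ (y : Vec Bool n) (x : Vec Bool m) (z : Vec Bool a) j i → (y Vec.++ (x Vec.++ z)) at rᵇ j i ≡ lookup z (combine (n ↑ʳ j) i)
      at-r y x z j i = at-ancAddr y x z (combine (n ↑ʳ j) i)

    module WithCode (As : Fin d → List (Atom g n)) where
      x : Vec Bool m
      x = encode As

      open TensorProduct {n} {m} x a

      Y : Vec Bool n → Vec Bool Nq
      Y y = y Vec.++ (x Vec.++ zeros)

      Y-v : ∀ y i → Y y at vᵇ i ≡ lookup y i
      Y-v y i = at-v y (x Vec.++ zeros) i

      Y-τ : ∀ y l i → Y y at τᵇ l i ≡ befores (As l) i
      Y-τ y l i = trans (at-τ y x zeros l i) (lookup-encode As l zero i)

      Y-τ′ : ∀ y l i → Y y at τ′ᵇ l i ≡ afters (As l) i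
      Y-τ′ y l i = trans (at-τ′ y x zeros l i) (lookup-encode As l (suc zero) i)

      Y-f : ∀ y l j i → Y y at fᵇ l j i ≡ colFs (As l) j i
      Y-f y l j i = trans (at-f y x zeros l j i) (trans (lookup-encode As l (rowF j) i)
        (cong [ (λ j → colFs (As l) j i) , (λ j → colEs (As l) j i) ]′ (FinP.splitAt-↑ˡ n j n)))

      Y-e : ∀ y l j i → Y y at eᵇ l j i ≡ colEs (As l) j i
      Y-e y l j i = trans (at-e y x zeros l j i) (trans (lookup-encode As l (rowE j) i)
        (cong [ (λ j → colFs (As l) j i) , (λ j → colEs (As l) j i) ]′ (FinP.splitAt-↑ʳ n n j)))

      Y-p : ∀ y i j → Y y at pᵇ i j ≡ false
      Y-p y i j = trans (at-p y x zeros i j) (VecP.lookup-replicate {n = a} (combine (i ↑ˡ n) j) false)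

      Y-r : ∀ y j i → Y y at rᵇ j i ≡ false
      Y-r y j i = trans (at-r y x zeros j i) (VecP.lookup-replicate {n = a} (combine (n ↑ʳ j) i) false)

      opaque
        unfolding Parallel.par

        -- On the code space the switch bits are constants read from the encoding, so the switched
        -- Hadamard gates become a fixed selection of Hadamard gates on the data.
        tensor-H : ∀ (lb : Fin n → Lab) (s : Fin n → Bool) → (∀ y i → Y y at lb i ≡ s i) → ∀ xs ψ →
                   V.par (λ i w → HM^ (w at lb i)) xs (tensor ψ) ≈ψ tensor (Parallel.par (λ i → i) (λ i _ → HM^ (s i)) xs ψ)
        tensor-H lb s es [] ψ = ≈ψ-refl
        tensor-H lb s es (i ∷ xs) ψ = ≈ψ-trans (op-cong (λ _ → ≈M-refl) (tensor-H lb s es xs ψ))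
          (subst (λ q → op (λ w → HM^ (w at lb i)) q (tensor φ) ≈ψ tensor (op (λ _ → HM^ (s i)) i φ)) (sym (addr-v i))
            (tensor-op i (λ y → cong HM^ (es y i)) φ))
          where
            φ : State n
            φ = Parallel.par (λ i → i) (λ i _ → HM^ (s i)) xs ψ

      module AtL (l : Fin d) where
        open AtLevel g l

        ∈pairs : ∀ j i → (j , i) ∈ pairs n
        ∈pairs j i = MembP.∈-cartesianProduct⁺ (MembP.∈-allFin j) (MembP.∈-allFin i)

        flipE-r : ∀ w j i → flipE w at rᵇ j i ≡ (w at rᵇ j i) xor (w at eᵇ l j i)
        flipE-r w j i = All.lookup (C.lookup-flips E indepE (pairs n) apartC w) (∈pairs j i)

        flipF-r : ∀ w j i → flipF w at rᵇ j i ≡ (w at rᵇ j i) xor ((w at fᵇ l j i) ∧ (w at pᵇ i j))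
        flipF-r w j i = All.lookup (C.lookup-flips F indepF (pairs n) apartC w) (∈pairs j i)

        flipP-p : ∀ w i j → flipP w at pᵇ i j ≡ (w at pᵇ i j) xor (w at vᵇ i)
        flipP-p w i j = All.lookup (P.lookup-flips Pᵛ indepPᵛ (pairs n) apartP w) (∈pairs i j)

        flipE-other : ∀ w lb → (∀ j i → lb ≢ rᵇ j i) → flipE w at lb ≡ w at lb
        flipE-other w lb ne = C.lookup-flips-other E (pairs n) w (addr lb) (All.universal (λ (j , i) → apart (ne j i)) (pairs n))

        flipF-other : ∀ w lb → (∀ j i → lb ≢ rᵇ j i) → flipF w at lb ≡ w at lb
        flipF-other w lb ne = C.lookup-flips-other F (pairs n) w (addr lb) (All.universal (λ (j , i) → apart (ne j i)) (pairs n))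

        flipP-other : ∀ w lb → (∀ i j → lb ≢ pᵇ i j) → flipP w at lb ≡ w at lb
        flipP-other w lb ne = P.lookup-flips-other Pᵛ (pairs n) w (addr lb) (All.universal (λ (i , j) → apart (ne i j)) (pairs n))

        -- Copies and cells start at 0, by `Y-p` and `Y-r`, so adding v i to a copy yields v i
        -- itself and adding the conjunction to a cell yields the conjunction itself.
        flips-r : ∀ y j i → flipF (flipP (Y y)) at rᵇ j i ≡ colFs (As l) j i ∧ lookup y i
        flips-r y j i = trans (flipF-r (flipP (Y y)) j i) (cong₂ _xor_
          (trans (flipP-other (Y y) (rᵇ j i) (λ _ _ ())) (Y-r y j i))
          (cong₂ _∧_ (trans (flipP-other (Y y) (fᵇ l j i) (λ _ _ ())) (Y-f y l j i))
            (trans (flipP-p (Y y) i j) (cong₂ _xor_ (Y-p y i j) (Y-v y i)))))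

        flips-other : ∀ y lb → (∀ j i → lb ≢ rᵇ j i) → (∀ i j → lb ≢ pᵇ i j) → flipF (flipP (Y y)) at lb ≡ Y y at lb
        flips-other y lb nr np = trans (flipF-other (flipP (Y y)) lb nr) (flipP-other (Y y) lb np)

        χblock-columns : ∀ y → χblock (Y y) ≋ ∏ (allFin n) (λ j → column g (colFs (As l) j) (colEs (As l) j) j y)
        χblock-columns y = ≋-trans (∏-⊠ _ _ (allFin n)) (∏-cong (allFin n) (λ j → ⊠-cong (≋-reflexive (cong sgn (cong₂ _∧_
            (trans (flipE-other w₂ (vᵇ j) (λ _ _ ())) (trans (flips-other y (vᵇ j) (λ _ _ ()) (λ _ _ ())) (Y-v y j)))
            (comb-cong g (allFin n) (λ i → trans (flipE-r w₂ j i) (cong₂ _xor_ (flips-r y j i)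
              (trans (flips-other y (eᵇ l j i) (λ _ _ ()) (λ _ _ ())) (Y-e y l j i))))))))
          (≋-reflexive (cong (λ b → if b then ω^ 5 else 1A) (flips-r y j j)))))
          where
            w₂ = flipF (flipP (Y y))

      module LevelTensor (Λ : Fin d → Layer g n) (eΛ : ∀ l → As l ≡ layerAtoms (proj₁ (Λ l))) (l : Fin d) where
        open AtLevel g l

        aft bef : Fin n → Bool
        aft = afters (As l)
        bef = befores (As l)

        χ-phases : ∀ y → χblock (Y y) ≋ phases (As l) y
        χ-phases y = ≋-trans (AtL.χblock-columns l y) (subst (λ A → ∏ (allFin n) (λ j → column g (colFs A j) (colEs A j) j y) ≋ phases A y) (sym (eΛ l))
          (columns-phases (layerAtoms (proj₁ (Λ l))) (proj₁ (layer-good (proj₁ (Λ l)) (proj₂ (Λ l)))) (proj₂ (layer-good (proj₁ (Λ l)) (proj₂ (Λ l)))) y))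

        applied : ∀ ψ → H^ aft (diag (phases (As l)) (H^ bef ψ)) ≈ψ applyLayer (Λ l) ψ
        applied ψ = subst (λ A → H^ (afters A) (diag (phases A) (H^ (befores A) ψ)) ≈ψ applyLayer (Λ l) ψ) (sym (eΛ l)) (≈ψ-sym (layer-applies (Λ l) ψ))

        Hτ-tensor : ∀ ψ → Hτ (tensor ψ) ≈ψ tensor (H^ bef ψ)
        Hτ-tensor ψ = tensor-H (τᵇ l) bef (λ y i → Y-τ y l i) (allFin n) ψ

        Hτ′-tensor : ∀ ψ → Hτ′ (tensor ψ) ≈ψ tensor (H^ aft ψ)
        Hτ′-tensor ψ = tensor-H (τ′ᵇ l) aft (λ y i → Y-τ′ y l i) (allFin n) ψ

        Hτ′-cong : ∀ {ψ φ} → ψ ≈ψ φ → Hτ′ ψ ≈ψ Hτ′ φ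
        Hτ′-cong = V.par-congʳ (allFin n)

        diag-tensor : ∀ ψ → diag χblock (tensor ψ) ≈ψ tensor (diag (phases (As l)) ψ)
        diag-tensor ψ = ≈ψ-trans (tensor-diag χblock ψ) (tensor-cong (diag-cong χ-phases ≈ψ-refl))

        block-tensor : ∀ ψ → run (block g l) (tensor ψ) ≈ψ tensor (applyLayer (Λ l) ψ)
        block-tensor ψ = ≈ψ-trans (run-block (tensor ψ))
          (≈ψ-trans (Hτ′-cong (≈ψ-trans (diag-cong (λ _ → ≋-refl) (Hτ-tensor ψ)) (diag-tensor (H^ bef ψ))))
            (≈ψ-trans (Hτ′-tensor (diag (phases (As l)) (H^ bef ψ))) (tensor-cong (applied ψ))))

      -- After each block the state is again in the code space, which is why all levels can use the
      -- same ancillas.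
      blocks-tensor : ∀ (Λ : Fin d → Layer g n) → (∀ l → As l ≡ layerAtoms (proj₁ (Λ l))) → ∀ ls ψ →
                      run (concatMap (block g) ls) (tensor ψ) ≈ψ tensor (run (map Λ ls) ψ)
      blocks-tensor Λ eΛ [] ψ = ≈ψ-refl
      blocks-tensor Λ eΛ (l ∷ ls) ψ = subst (_≈ψ tensor (run (map Λ ls) (applyLayer (Λ l) ψ))) (sym (run-++ (block g l) (concatMap (block g) ls) (tensor ψ)))
        (≈ψ-trans (run-cong (concatMap (block g) ls) (LevelTensor.block-tensor Λ eΛ l ψ)) (blocks-tensor Λ eΛ ls (applyLayer (Λ l) ψ)))

    universal : UniversalFor n d m a (circuit g)
    universal C C≤d = encode As , λ y → ≈ψ-≈S (≈ψ-trans (run-cong (circuit g) (tensor-basis y))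
        (≈ψ-trans (blocks-tensor Λ (λ _ → refl) (allFin d) (basis y))
          (tensor-cong (λ v → ≋-reflexive (cong (λ φ → φ v) (trans (cong (λ C → run C (basis y)) (ListP.map-tabulate (λ l → l) Λ)) (run-layerAt d C C≤d (basis y))))))))
      where
        Λ : Fin d → Layer g n
        Λ l = layerAt (toℕ l) C
        As : Fin d → List (Atom g n)
        As l = layerAtoms (proj₁ (Λ l))
        open WithCode As
        open TensorProduct {n} {m} (encode As) a

-- Structured programs and their compilation to Turing machines.

module StructuredMachines where
  open Defs using (L; S; R)

  record Mem : Set where
    constructor mem
    field
      ih  : ℕ
      wk  : ℕ → Bool
      wh  : ℕ
      out : List Bool
  open Mem public

  record Act : Set where
    constructor act
    field
      wr    : Bool
      wm im : Move
      ou    : Maybe Bool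
  open Act public

  apply : List Bool → Act → Mem → Mem
  apply w α μ = mem (moveI (suc (length w)) (im α) (ih μ)) (λ j → if j ≡ᵇ wh μ then wr α else wk μ j)
                    (moveW (wm α) (wh μ)) (out μ ++ maybe (λ b → b ∷ []) [] (ou α))

  -- Structured machine programs; every program returns a truth value through its
  -- exit, so that tests need no storage.
  infixr 5 _⨾_
  data Cmd : Set where
    prim : (Maybe Bool → Bool → Act × Bool) → Cmd
    _⨾_  : Cmd → Cmd → Cmd
    ite  : Cmd → Cmd → Cmd → Cmd
    loop : Cmd → Cmd

  -- The head bound is checked at each primitive, so a derivation certifies the space of the whole
  -- run. A loop that ends always returns false, since false is what ends it.
  data Exec (w : List Bool) (s : ℕ) : Cmd → Mem → Bool → Mem → Set where
    prim  : ∀ {f μ} → wh μ ≤ s → let r = f (readIn w (ih μ)) (wk μ (wh μ)) in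
            Exec w s (prim f) μ (proj₂ r) (apply w (proj₁ r) μ)
    seq   : ∀ {c c′ μ μ′ μ″ b b′} → Exec w s c μ b μ′ → Exec w s c′ μ′ b′ μ″ → Exec w s (c ⨾ c′) μ b′ μ″
    iteT  : ∀ {c c₁ c₂ μ μ′ μ″ b} → Exec w s c μ true μ′ → Exec w s c₁ μ′ b μ″ → Exec w s (ite c c₁ c₂) μ b μ″
    iteF  : ∀ {c c₁ c₂ μ μ′ μ″ b} → Exec w s c μ false μ′ → Exec w s c₂ μ′ b μ″ → Exec w s (ite c c₁ c₂) μ b μ″
    again : ∀ {c μ μ′ μ″ b} → Exec w s c μ true μ′ → Exec w s (loop c) μ′ b μ″ → Exec w s (loop c) μ b μ″
    break : ∀ {c μ μ′} → Exec w s c μ false μ′ → Exec w s (loop c) μ false μ′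

  size : Cmd → ℕ
  size (prim f) = 1
  size (c ⨾ c′) = size c + size c′
  size (ite c c₁ c₂) = size c + (size c₁ + size c₂)
  size (loop c) = size c

  entryState : ∀ c → Fin (size c)
  entryState (prim f) = zero
  entryState (c ⨾ c′) = entryState c ↑ˡ size c′
  entryState (ite c c₁ c₂) = entryState c ↑ˡ (size c₁ + size c₂)
  entryState (loop c) = entryState c

  instr : ∀ {Q} → Maybe (Fin Q) → Act → Instr Q
  instr q α = record { next = q ; write = wr α ; wmove = wm α ; imove = im α ; out = ou α }

  Table : ℕ → ℕ → Set
  Table k Q = Fin k → Maybe Bool → Bool → Instr Q

  -- Written with continuations: `emb` places the states of the program in the machine, and `exit`
  -- gives the successor for each truth value. Composition adds no states, and the result of a test
  -- lives in the control state alone.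
  compile : ∀ {Q} c → (Fin (size c) → Fin Q) → (Bool → Maybe (Fin Q)) → Table (size c) Q
  compile (prim f) emb exit q i x = instr (exit (proj₂ (f i x))) (proj₁ (f i x))
  compile (c ⨾ c′) emb exit q =
    [ compile c (λ q → emb (q ↑ˡ size c′)) (λ _ → just (emb (size c ↑ʳ entryState c′)))
    , compile c′ (λ q → emb (size c ↑ʳ q)) exit ]′ (splitAt (size c) q)
  compile (ite c c₁ c₂) emb exit q =
    [ compile c (λ q → emb (q ↑ˡ (size c₁ + size c₂)))
        (λ b → just (emb (size c ↑ʳ (if b then entryState c₁ ↑ˡ size c₂ else size c₁ ↑ʳ entryState c₂))))
    , (λ q → [ compile c₁ (λ q → emb (size c ↑ʳ (q ↑ˡ size c₂))) exit
             , compile c₂ (λ q → emb (size c ↑ʳ (size c₁ ↑ʳ q))) exit ]′ (splitAt (size c₁) q)) ]′ (splitAt (size c) q)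
  compile (loop c) emb exit = compile c emb (λ b → if b then just (emb (entryState c)) else exit false)

  module Machine (M : TM) (w : List Bool) (s : ℕ) where

    open TM M using (Q; δ)

    config : Maybe (Fin Q) → Mem → Config Q
    config q μ = record { state = q ; ihead = ih μ ; work = wk μ ; whead = wh μ ; output = out μ }

    data Reach : Maybe (Fin Q) → Mem → Maybe (Fin Q) → Mem → Set where
      stop : ∀ {q μ} → Reach q μ q μ
      step : ∀ {q μ q₁ μ₁ q₂ μ₂} → wh μ ≤ s → stepTM M w (config (just q) μ) ≡ config q₁ μ₁ → Reach q₁ μ₁ q₂ μ₂ → Reach (just q) μ q₂ μ₂

    Reach-trans : ∀ {q μ q₁ μ₁ q₂ μ₂} → Reach q μ q₁ μ₁ → Reach q₁ μ₁ q₂ μ₂ → Reach q μ q₂ μ₂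
    Reach-trans stop ρ = ρ
    Reach-trans (step h e ρ) ρ′ = step h e (Reach-trans ρ ρ′)

    -- Agreement is required pointwise, because the table of a composite program matches those of
    -- its parts only after rewriting with `splitAt`.
    Follows : ∀ {k} → (Fin k → Fin Q) → Table k Q → Set
    Follows emb tbl = ∀ q i x → δ (emb q) i x ≡ tbl q i x

    exec-reach : ∀ {c μ b μ′} → Exec w s c μ b μ′ → ∀ emb exit → Follows emb (compile c emb exit) →
                 Reach (just (emb (entryState c))) μ (exit b) μ′
    exec-reach {prim f} {μ} (prim h) emb exit fl =
      step h (cong next (fl zero (readIn w (ih μ)) (wk μ (wh μ)))) stop
      where
        next : Instr Q → Config Q
        next ins = record
          { state = Instr.next ins
          ; ihead = moveI (suc (length w)) (Instr.imove ins) (ih μ)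
          ; work = λ j → if j ≡ᵇ wh μ then Instr.write ins else wk μ j
          ; whead = moveW (Instr.wmove ins) (wh μ)
          ; output = out μ ++ maybe (λ b → b ∷ []) [] (Instr.out ins) }
    exec-reach {c ⨾ c′} (seq x y) emb exit fl =
      Reach-trans (exec-reach x _ _ (λ q i x → trans (fl _ i x) (cong (λ r → pick r i x) (FinP.splitAt-↑ˡ (size c) q (size c′)))))
        (exec-reach y _ _ (λ q i x → trans (fl _ i x) (cong (λ r → pick r i x) (FinP.splitAt-↑ʳ (size c) (size c′) q))))
      where
        pick = [ compile c (λ q → emb (q ↑ˡ size c′)) (λ _ → just (emb (size c ↑ʳ entryState c′)))
               , compile c′ (λ q → emb (size c ↑ʳ q)) exit ]′
    exec-reach {ite c c₁ c₂} e emb exit fl = go e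
      where
        inner = λ q → [ compile c₁ (λ q → emb (size c ↑ʳ (q ↑ˡ size c₂))) exit
                      , compile c₂ (λ q → emb (size c ↑ʳ (size c₁ ↑ʳ q))) exit ]′ (splitAt (size c₁) q)
        pick = [ compile c (λ q → emb (q ↑ˡ (size c₁ + size c₂)))
                   (λ b → just (emb (size c ↑ʳ (if b then entryState c₁ ↑ˡ size c₂ else size c₁ ↑ʳ entryState c₂))))
               , inner ]′
        fl₀ : Follows (λ q → emb (q ↑ˡ (size c₁ + size c₂))) (compile c _ _)
        fl₀ q i x = trans (fl _ i x) (cong (λ r → pick r i x) (FinP.splitAt-↑ˡ (size c) q (size c₁ + size c₂)))
        flʳ : ∀ q i x → δ (emb (size c ↑ʳ q)) i x ≡ inner q i x
        flʳ q i x = trans (fl _ i x) (cong (λ r → pick r i x) (FinP.splitAt-↑ʳ (size c) (size c₁ + size c₂) q))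
        pick₂ = [ compile c₁ (λ q → emb (size c ↑ʳ (q ↑ˡ size c₂))) exit
                , compile c₂ (λ q → emb (size c ↑ʳ (size c₁ ↑ʳ q))) exit ]′
        go : ∀ {μ b μ′} → Exec w s (ite c c₁ c₂) μ b μ′ → Reach (just (emb (entryState c ↑ˡ (size c₁ + size c₂)))) μ (exit b) μ′
        go (iteT x y) = Reach-trans (exec-reach x _ _ fl₀)
          (exec-reach y _ _ (λ q i x → trans (flʳ _ i x) (cong (λ r → pick₂ r i x) (FinP.splitAt-↑ˡ (size c₁) q (size c₂)))))
        go (iteF x y) = Reach-trans (exec-reach x _ _ fl₀)
          (exec-reach y _ _ (λ q i x → trans (flʳ _ i x) (cong (λ r → pick₂ r i x) (FinP.splitAt-↑ʳ (size c₁) (size c₂) q))))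
    exec-reach {loop c} (again x y) emb exit fl = Reach-trans (exec-reach x emb _ fl) (exec-reach {loop c} y emb exit fl)
    exec-reach {loop c} (break x) emb exit fl = exec-reach x emb _ fl

    -- Turns a path into a number of steps: `t₀` counts the steps made so far, and the last
    -- hypothesis accumulates the head bound for all earlier times. The bound at a new configuration
    -- comes from the next step or, at the end, from the hypothesis on μ′.
    reach-configAt : ∀ {q μ q′ μ′} → Reach q μ q′ μ′ → wh μ′ ≤ s → ∀ t₀ → configAt M w t₀ ≡ config q μ →
                     (∀ t → t ≤ t₀ → Config.whead (configAt M w t) ≤ s) →
                     Σ ℕ λ t₁ → (configAt M w t₁ ≡ config q′ μ′) × (∀ t → t ≤ t₁ → Config.whead (configAt M w t) ≤ s)
    reach-configAt stop h t₀ e below = t₀ , e , below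
    reach-configAt (step {μ₁ = μ₁} {q₂ = q₂} hμ es ρ) h t₀ e below = reach-configAt ρ h (suc t₀) e′ below′
      where
        e′ = trans (cong (stepTM M w) e) es
        head-≤ : ∀ {q μ q′ μ′} → Reach q μ q′ μ′ → wh μ′ ≤ s → wh μ ≤ s
        head-≤ stop h = h
        head-≤ (step h _ _) _ = h
        below′ : ∀ t → t ≤ suc t₀ → Config.whead (configAt M w t) ≤ s
        below′ t t≤ with t ℕP.≟ suc t₀
        ... | yes refl = subst (λ c → Config.whead c ≤ s) (sym e′) (head-≤ ρ h)
        ... | no t≢ = below t (ℕP.≤-pred (ℕP.≤∧≢⇒< t≤ t≢))

  machine : Cmd → TM
  machine c = record { Q = size c ; start = entryState c ; δ = compile c (λ q → q) (λ _ → nothing) }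

  initMem : Mem
  initMem = mem 0 (λ _ → false) 0 []

  exec-computes : ∀ {w s c b μ} → Exec w s c initMem b μ → wh μ ≤ s → ComputesInSpace (machine c) w (out μ) s
  exec-computes {w} {s} {c} {b} {μ} ex h
    with Machine.reach-configAt (machine c) w s (Machine.exec-reach (machine c) w s ex (λ q → q) (λ _ → nothing) (λ _ _ _ → refl))
           h 0 refl (λ { .0 z≤n → z≤n })
  ... | t , e , below = t , cong Config.state e , cong Config.output e , below

-- Binary counters on the work tape: reset, increment and equality.

module CounterTape where
  open Defs using (L; S; R)
  open StructuredMachines

  ret : Bool → Cmd
  ret b = prim (λ _ x → act x S S nothing , b)

  go : Move → Cmd
  go μ = prim (λ _ x → act x μ S nothing , true)

  emit : Bool → Cmd
  emit b = prim (λ _ x → act x S S (just b) , true)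

  inRight : Cmd
  inRight = prim (λ _ x → act x S R nothing , true)

  isOne : Maybe Bool → Bool
  isOne (just b) = b
  isOne nothing = false

  inTest : Cmd
  inTest = prim (λ i x → act x S S nothing , isOne i)

  bitTest : Cmd
  bitTest = prim (λ _ x → act x S S nothing , x)

  bitWrite : Bool → Cmd
  bitWrite b = prim (λ _ _ → act b S S nothing , true)

  steps : Move → ℕ → Cmd
  steps μ zero = ret true
  steps μ (suc k) = go μ ⨾ steps μ k

  ≡ᵇ-refl : ∀ k → (k ≡ᵇ k) ≡ true
  ≡ᵇ-refl zero = refl
  ≡ᵇ-refl (suc k) = ≡ᵇ-refl k

  ≡ᵇ-≢ : ∀ {j k} → j ≢ k → (j ≡ᵇ k) ≡ false
  ≡ᵇ-≢ {zero} {zero} ne = ⊥-elim (ne refl)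
  ≡ᵇ-≢ {zero} {suc k} ne = refl
  ≡ᵇ-≢ {suc j} {zero} ne = refl
  ≡ᵇ-≢ {suc j} {suc k} ne = ≡ᵇ-≢ (λ e → ne (cong suc e))

  ≡ᵇ-true : ∀ {j k} → (j ≡ᵇ k) ≡ true → j ≡ k
  ≡ᵇ-true {zero} {zero} e = refl
  ≡ᵇ-true {suc j} {suc k} e = cong suc (≡ᵇ-true e)

  -- The work tape is cut into cells of K = 1 + V bits.  Bit 0 of a cell marks it as
  -- in use; bit 1 + x holds one binary digit of variable x, least significant digit
  -- in cell 1.  Cell 0 is never marked, so it stops leftward scans.
  module Commands (V : ℕ) where

    K : ℕ
    K = suc V

    -- The way back is written twice because the answer of `c` can be remembered only in the control
    -- state.
    onTrack : ℕ → Cmd → Cmd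
    onTrack t c = steps R t ⨾ ite c (steps L t ⨾ ret true) (steps L t ⨾ ret false)

    rd : ℕ → Cmd
    rd t = onTrack t bitTest

    wr′ : ℕ → Bool → Cmd
    wr′ t b = onTrack t (bitWrite b)

    right left : Cmd
    right = steps R K
    left = steps L K

    goLeft : Cmd
    goLeft = loop (left ⨾ rd 0)

    zeroLoop : ℕ → Cmd
    zeroLoop x = loop (ite (rd 0) (wr′ (suc x) false ⨾ right ⨾ ret true) (ret false))

    zero′ : ℕ → Cmd
    zero′ x = right ⨾ zeroLoop x ⨾ goLeft

    -- The carry turns ones into zeros until it meets a zero digit or an unmarked cell. Writing both
    -- mark and digit finishes either case, so a counter grows by a cell without a separate branch.
    incLoop : ℕ → Cmd
    incLoop x = loop (ite (rd 0) (ite (rd (suc x)) (wr′ (suc x) false ⨾ right ⨾ ret true) (ret false)) (ret false))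
                ⨾ wr′ 0 true ⨾ wr′ (suc x) true

    inc′ : ℕ → Cmd
    inc′ x = right ⨾ incLoop x ⨾ goLeft

    eqLoop : ℕ → ℕ → Cmd
    eqLoop x y = loop (ite (rd 0)
      (ite (rd (suc x)) (ite (rd (suc y)) (right ⨾ ret true) (ret false)) (ite (rd (suc y)) (ret false) (right ⨾ ret true))) (ret false))

    -- A loop can return only false, so the verdict is read from the tape: the scan has stopped at a
    -- marked cell exactly when some digit differs.
    eq′ : ℕ → ℕ → Cmd
    eq′ x y = right ⨾ eqLoop x y ⨾ ite (rd 0) (goLeft ⨾ ret false) (goLeft ⨾ ret true)

  module Tape (V : ℕ) (w : List Bool) (s : ℕ) where

    open Commands V

    Grid : Set
    Grid = ℕ → ℕ → Bool

    -- The tape is described by its values, since a step that writes back the bit it has read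
    -- changes the tape as a term but not pointwise; see `keep-bit`.
    record At (h : ℕ) (o : List Bool) (A : Grid) (p : ℕ) (μ : Mem) : Set where
      constructor at
      field
        ih≡ : ih μ ≡ h
        out≡ : out μ ≡ o
        wh≡ : wh μ ≡ p
        wk≡ : ∀ j t → t < K → wk μ (j * K + t) ≡ A j t
    open At

    Triple : Cmd → (Mem → Set) → Bool → (Mem → Set) → Set
    Triple c P b Q = ∀ {μ} → P μ → Σ Mem λ μ′ → Exec w s c μ b μ′ × Q μ′

    seqᵗ : ∀ {c c′ P Q R b b′} → Triple c P b Q → Triple c′ Q b′ R → Triple (c ⨾ c′) P b′ R
    seqᵗ x y p with x p
    ... | _ , e , q with y q
    ...   | _ , e′ , r = _ , seq e e′ , r

    iteᵗ : ∀ {c c₁ c₂ P Q R b} → Triple c P true Q → Triple c₁ Q b R → Triple (ite c c₁ c₂) P b R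
    iteᵗ x y p with x p
    ... | _ , e , q with y q
    ...   | _ , e′ , r = _ , iteT e e′ , r

    iteᶠ : ∀ {c c₁ c₂ P Q R b} → Triple c P false Q → Triple c₂ Q b R → Triple (ite c c₁ c₂) P b R
    iteᶠ x y p with x p
    ... | _ , e , q with y q
    ...   | _ , e′ , r = _ , iteF e e′ , r

    againᵗ : ∀ {c P Q R b} → Triple c P true Q → Triple (loop c) Q b R → Triple (loop c) P b R
    againᵗ x y p with x p
    ... | _ , e , q with y q
    ...   | _ , e′ , r = _ , again e e′ , r

    breakᵗ : ∀ {c P Q} → Triple c P false Q → Triple (loop c) P false Q
    breakᵗ x p with x p
    ... | _ , e , q = _ , break e , q

    mapᵗ : ∀ {c P Q R b} → (∀ {μ} → Q μ → R μ) → Triple c P b Q → Triple c P b R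
    mapᵗ f x p with x p
    ... | _ , e , q = _ , e , f q

    preᵗ : ∀ {c P Q R b} → (∀ {μ} → P μ → Q μ) → Triple c Q b R → Triple c P b R
    preᵗ f x p = x (f p)

    keep-bit : ∀ (μ : Mem) x → (if x ≡ᵇ wh μ then wk μ (wh μ) else wk μ x) ≡ wk μ x
    keep-bit μ x with x ≡ᵇ wh μ in eq
    ... | true = cong (wk μ) (sym (≡ᵇ-true eq))
    ... | false = refl

    module _ {h : ℕ} {o : List Bool} {A : Grid} {p : ℕ} (p≤s : p ≤ s) where

      bound : ∀ {μ} → At h o A p μ → wh μ ≤ s
      bound a = subst (_≤ s) (sym (wh≡ a)) p≤s

      ret-spec : ∀ b → Triple (ret b) (At h o A p) b (At h o A p)
      ret-spec b {μ} a = _ , prim (bound a) ,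
        at (ih≡ a) (trans (ListP.++-identityʳ _) (out≡ a)) (wh≡ a) (λ j t t<K → trans (keep-bit μ _) (wk≡ a j t t<K))

      emit-spec : ∀ b → Triple (emit b) (At h o A p) true (At h (o ++ b ∷ []) A p)
      emit-spec b {μ} a = _ , prim (bound a) ,
        at (ih≡ a) (cong (_++ b ∷ []) (out≡ a)) (wh≡ a) (λ j t t<K → trans (keep-bit μ _) (wk≡ a j t t<K))

      goR-spec : Triple (go R) (At h o A p) true (At h o A (suc p))
      goR-spec {μ} a = _ , prim (bound a) ,
        at (ih≡ a) (trans (ListP.++-identityʳ _) (out≡ a)) (cong suc (wh≡ a)) (λ j t t<K → trans (keep-bit μ _) (wk≡ a j t t<K))

      inRight-spec : suc h ≤ suc (length w) → Triple inRight (At h o A p) true (At (suc h) o A p)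
      inRight-spec h≤ {μ} a = _ , prim (bound a) ,
        at (trans (cong (moveI (suc (length w)) R) (ih≡ a)) (step h≤)) (trans (ListP.++-identityʳ _) (out≡ a)) (wh≡ a)
          (λ j t t<K → trans (keep-bit μ _) (wk≡ a j t t<K))
        where
          step : suc h ≤ suc (length w) → moveI (suc (length w)) R h ≡ suc h
          step le with suc h ≤ᵇ suc (length w) | ℕP.≤⇒≤ᵇ le
          ... | true | _ = refl

      inTest-spec : ∀ {b} → isOne (readIn w h) ≡ b → Triple inTest (At h o A p) b (At h o A p)
      inTest-spec e {μ} a = subst (λ b → Σ Mem λ μ′ → Exec w s inTest μ b μ′ × At h o A p μ′)
        (trans (cong (λ i → isOne (readIn w i)) (ih≡ a)) e)
        (_ , prim (bound a) , at (ih≡ a) (trans (ListP.++-identityʳ _) (out≡ a)) (wh≡ a) (λ j t t<K → trans (keep-bit μ _) (wk≡ a j t t<K)))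

    goL-spec : ∀ {h o A p} → suc p ≤ s → Triple (go L) (At h o A (suc p)) true (At h o A p)
    goL-spec p≤s {μ} a = _ , prim (subst (_≤ s) (sym (wh≡ a)) p≤s) ,
      at (ih≡ a) (trans (ListP.++-identityʳ _) (out≡ a)) (cong (_∸ 1) (wh≡ a)) (λ j t t<K → trans (keep-bit μ _) (wk≡ a j t t<K))

    stepsR-spec : ∀ {h o A} k {p} → p + k ≤ s → Triple (steps R k) (At h o A p) true (At h o A (p + k))
    stepsR-spec {h} {o} {A} zero {p} le = mapᵗ (λ {μ} → subst (λ q → At h o A q μ) (sym (ℕP.+-identityʳ p)))
      (ret-spec (subst (_≤ s) (ℕP.+-identityʳ p) le) true)
    stepsR-spec {h} {o} {A} (suc k) {p} le = seqᵗ (goR-spec (ℕP.≤-trans (ℕP.m≤m+n p (suc k)) le))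
      (mapᵗ (λ {μ} → subst (λ q → At h o A q μ) (sym (ℕP.+-suc p k))) (stepsR-spec k (subst (_≤ s) (ℕP.+-suc p k) le)))

    stepsL-spec : ∀ {h o A} k {p} → p + k ≤ s → Triple (steps L k) (At h o A (p + k)) true (At h o A p)
    stepsL-spec {h} {o} {A} zero {p} le = preᵗ (λ {μ} → subst (λ q → At h o A q μ) (ℕP.+-identityʳ p))
      (ret-spec (subst (_≤ s) (ℕP.+-identityʳ p) le) true)
    stepsL-spec {h} {o} {A} (suc k) {p} le = preᵗ (λ {μ} → subst (λ q → At h o A q μ) (ℕP.+-suc p k))
      (seqᵗ (goL-spec (subst (_≤ s) (ℕP.+-suc p k) le)) (stepsL-spec k (ℕP.≤-trans (ℕP.+-monoʳ-≤ p (ℕP.n≤1+n k)) le)))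

    update : Grid → ℕ → ℕ → Bool → Grid
    update A i t b j t′ = if (j ≡ᵇ i) ∧ (t′ ≡ᵇ t) then b else A j t′

    update-same : ∀ A i t b → update A i t b i t ≡ b
    update-same A i t b rewrite ≡ᵇ-refl i | ≡ᵇ-refl t = refl

    update-cell : ∀ A i t b {j t′} → j ≢ i → update A i t b j t′ ≡ A j t′
    update-cell A i t b ne rewrite ≡ᵇ-≢ ne = refl

    update-track : ∀ A i t b {j t′} → t′ ≢ t → update A i t b j t′ ≡ A j t′
    update-track A i t b {j} {t′} ne rewrite ≡ᵇ-≢ ne with j ≡ᵇ i
    ... | true = refl
    ... | false = refl

    decode : ∀ j i {t t′} → t < K → t′ < K → j * K + t ≡ i * K + t′ → j ≡ i × t ≡ t′
    decode zero zero _ _ e = refl , e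
    decode zero (suc i) {t} {t′} t< _ e = ⊥-elim (ℕP.<-irrefl e (ℕP.<-≤-trans t< (ℕP.≤-trans (ℕP.m≤m+n K (i * K)) (ℕP.m≤m+n (K + i * K) t′))))
    decode (suc j) zero {t} {t′} _ t′< e = ⊥-elim (ℕP.<-irrefl (sym e) (ℕP.<-≤-trans t′< (ℕP.≤-trans (ℕP.m≤m+n K (j * K)) (ℕP.m≤m+n (K + j * K) t))))
    decode (suc j) (suc i) {t} {t′} t< t′< e with decode j i t< t′< (ℕP.+-cancelˡ-≡ K _ _ (trans (sym (ℕP.+-assoc K (j * K) t)) (trans e (ℕP.+-assoc K (i * K) t′))))
    ... | refl , q = refl , q

    write-update : ∀ {h o A i t} b → t < K → i * K + t ≤ s → Triple (bitWrite b) (At h o A (i * K + t)) true (At h o (update A i t b) (i * K + t))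
    write-update {A = A} {i} {t} b t<K le {μ} a = _ , prim (subst (_≤ s) (sym (wh≡ a)) le) ,
      at (ih≡ a) (trans (ListP.++-identityʳ _) (out≡ a)) (wh≡ a) wk′
      where
        wk′ : ∀ j t′ → t′ < K → (if j * K + t′ ≡ᵇ wh μ then b else wk μ (j * K + t′)) ≡ update A i t b j t′
        wk′ j t′ t′< rewrite wh≡ a with j ℕP.≟ i | t′ ℕP.≟ t
        ... | yes refl | yes refl rewrite ≡ᵇ-refl (j * K + t′) = sym (update-same A j t′ b)
        ... | no ne | _ rewrite ≡ᵇ-≢ {j * K + t′} {i * K + t} (λ e → ne (proj₁ (decode j i t′< t<K e))) = trans (wk≡ a j t′ t′<) (sym (update-cell A i t b ne))
        ... | yes _ | no ne rewrite ≡ᵇ-≢ {j * K + t′} {i * K + t} (λ e → ne (proj₂ (decode j i t′< t<K e))) = trans (wk≡ a j t′ t′<) (sym (update-track A i t b ne))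

    test-read : ∀ {h o A i t b} → t < K → i * K + t ≤ s → A i t ≡ b → Triple bitTest (At h o A (i * K + t)) b (At h o A (i * K + t))
    test-read {h} {o} {A} {i} {t} t<K le e {μ} a = subst (λ b → Σ Mem λ μ′ → Exec w s bitTest μ b μ′ × At h o A (i * K + t) μ′)
      (trans (cong (wk μ) (wh≡ a)) (trans (wk≡ a i t t<K) e))
      (_ , prim (subst (_≤ s) (sym (wh≡ a)) le) , at (ih≡ a) (trans (ListP.++-identityʳ _) (out≡ a)) (wh≡ a) (λ j t t<K → trans (keep-bit μ _) (wk≡ a j t t<K)))

    record Cell (h : ℕ) (o : List Bool) (A : Grid) (i : ℕ) (μ : Mem) : Set where
      constructor inCell
      field
        raw : At h o A (i * K) μ
    open Cell

    record Room (i : ℕ) : Set where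
      constructor room
      field
        fits : suc i * K ≤ s
    open Room

    room-track : ∀ i {t} → Room i → t < K → i * K + t ≤ s
    room-track i {t} r t<K = ℕP.≤-trans (ℕP.+-monoʳ-≤ (i * K) (ℕP.<⇒≤ t<K)) (subst (_≤ s) (ℕP.+-comm K (i * K)) (fits r))

    room-here : ∀ i → Room i → i * K ≤ s
    room-here i r = ℕP.≤-trans (ℕP.m≤n+m (i * K) K) (fits r)

    room-≤ : ∀ {i j} → i ≤ j → Room j → Room i
    room-≤ i≤j r = room (ℕP.≤-trans (ℕP.*-monoˡ-≤ K (s≤s i≤j)) (fits r))

    inCellᵗ : ∀ {c h o A i b Q} → Triple c (At h o A (i * K)) b Q → Triple c (Cell h o A i) b Q
    inCellᵗ x p = x (raw p)

    onTrack-spec : ∀ {h o A A′ t c} i b → Room i → t < K →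
                   Triple c (At h o A (i * K + t)) b (At h o A′ (i * K + t)) → Triple (onTrack t c) (Cell h o A i) b (Cell h o A′ i)
    onTrack-spec {t = t} i true r t<K x = inCellᵗ {i = i} (seqᵗ (stepsR-spec t (room-track i r t<K)) (iteᵗ x (seqᵗ (stepsL-spec t (room-track i r t<K)) (mapᵗ inCell (ret-spec (room-here i r) true)))))
    onTrack-spec {t = t} i false r t<K x = inCellᵗ {i = i} (seqᵗ (stepsR-spec t (room-track i r t<K)) (iteᶠ x (seqᵗ (stepsL-spec t (room-track i r t<K)) (mapᵗ inCell (ret-spec (room-here i r) false)))))

    ret-cell : ∀ {h o A i} → Room i → ∀ b → Triple (ret b) (Cell h o A i) b (Cell h o A i)
    ret-cell {i = i} r b = inCellᵗ {i = i} (mapᵗ inCell (ret-spec (room-here i r) b))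

    rd-spec : ∀ {h o A i t b} → Room i → t < K → A i t ≡ b → Triple (rd t) (Cell h o A i) b (Cell h o A i)
    rd-spec {i = i} {b = b} r t<K e = onTrack-spec i b r t<K (test-read {i = i} t<K (room-track i r t<K) e)

    wr-spec : ∀ {h o A i t} b → Room i → t < K → Triple (wr′ t b) (Cell h o A i) true (Cell h o (update A i t b) i)
    wr-spec {i = i} b r t<K = onTrack-spec i true r t<K (write-update {i = i} b t<K (room-track i r t<K))

    right-spec : ∀ {h o A i} → Room i → Triple right (Cell h o A i) true (Cell h o A (suc i))
    right-spec {h} {o} {A} {i} r = inCellᵗ {i = i} (mapᵗ (λ {μ} p → inCell (subst (λ q → At h o A q μ) (ℕP.+-comm (i * K) K) p)) (stepsR-spec K (subst (_≤ s) (ℕP.+-comm K (i * K)) (fits r))))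

    left-spec : ∀ {h o A i} → Room i → Triple left (Cell h o A (suc i)) true (Cell h o A i)
    left-spec {h} {o} {A} {i} r = preᵗ (λ {μ} p → subst (λ q → At h o A q μ) (ℕP.+-comm K (i * K)) (raw p)) (mapᵗ inCell (stepsL-spec K (subst (_≤ s) (ℕP.+-comm K (i * K)) (fits r))))

    Column : Set
    Column = ℕ → Bool

    -- Everything behind the last column is blank. A cell opened by an increment therefore already
    -- holds digit 0 for all other counters.
    Stored : ℕ → List Column → Grid → Set
    Stored i [] A = ∀ j t → t < K → i ≤ j → A j t ≡ false
    Stored i (c ∷ cs) A = A i 0 ≡ true × (∀ x → x < V → A i (suc x) ≡ c x) × Stored (suc i) cs A

    Stored-cong : ∀ {i A A′} cs → (∀ j t → i ≤ j → A′ j t ≡ A j t) → Stored i cs A → Stored i cs A′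
    Stored-cong [] e st j t t<K i≤j = trans (e j t i≤j) (st j t t<K i≤j)
    Stored-cong (c ∷ cs) e (m , cx , st) = trans (e _ _ ℕP.≤-refl) m , (λ x x<V → trans (e _ _ ℕP.≤-refl) (cx x x<V)) ,
      Stored-cong cs (λ j t i<j → e j t (ℕP.≤-trans (ℕP.n≤1+n _) i<j)) st

    Filled : ℕ → Grid → Set
    Filled i A = A 0 0 ≡ false × (∀ k → 1 ≤ k → k < i → A k 0 ≡ true)

    Filled-suc : ∀ {i A} → Filled (suc i) A → A (suc i) 0 ≡ true → Filled (suc (suc i)) A
    Filled-suc {i} (z , f) e = z , λ k 1≤k k< → case k 1≤k k<
      where
        case : ∀ k → 1 ≤ k → k < suc (suc i) → _
        case k 1≤k k< with k ℕP.≟ suc i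
        ... | yes refl = e
        ... | no ne = f k 1≤k (ℕP.≤∧≢⇒< (ℕP.≤-pred k<) ne)

    Filled-cong : ∀ {i A A′} → (∀ j → j < i → A′ j 0 ≡ A j 0) → 0 < i → Filled i A → Filled i A′
    Filled-cong e 0<i (z , f) = trans (e 0 0<i) z , λ k 1≤k k< → trans (e k k<) (f k 1≤k k<)

    goLeft-spec : ∀ {h o A} i → Room i → Filled (suc i) A → Triple goLeft (Cell h o A (suc i)) false (Cell h o A 0)
    goLeft-spec zero r (z , f) = breakᵗ (seqᵗ (left-spec r) (rd-spec r (s≤s z≤n) z))
    goLeft-spec (suc i) r (z , f) = againᵗ (seqᵗ (left-spec r) (rd-spec r (s≤s z≤n) (f (suc i) (s≤s z≤n) ℕP.≤-refl)))
      (goLeft-spec i (room-≤ (ℕP.n≤1+n i) r) (z , λ k 1≤k k< → f k 1≤k (ℕP.≤-trans k< (ℕP.n≤1+n _))))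

    set : ℕ → Bool → Column → Column
    set x b c y = if y ≡ᵇ x then b else c y

    zeroCols : ℕ → List Column → List Column
    zeroCols x = map (set x false)

    incCols : ℕ → List Column → List Column
    incCols x [] = set x true (λ _ → false) ∷ []
    incCols x (c ∷ cs) = if c x then set x false c ∷ incCols x cs else set x true c ∷ cs

    eqCols : ℕ → ℕ → List Column → Bool
    eqCols x y [] = true
    eqCols x y (c ∷ cs) = if c x then (if c y then eqCols x y cs else false) else (if c y then false else eqCols x y cs)

    update-set : ∀ A i x b (c : Column) → (∀ y → y < V → A i (suc y) ≡ c y) → ∀ y → y < V → update A i (suc x) b i (suc y) ≡ set x b c y
    update-set A i x b c e y y<V rewrite ≡ᵇ-refl i with y ≡ᵇ x
    ... | true = refl
    ... | false = e y y<V

    Home : ℕ → List Bool → List Column → Mem → Set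
    Home h o cs μ = Σ Grid λ A → Cell h o A 0 μ × Filled 1 A × Stored 1 cs A

    -- The situation after a scan to the right that began in cell `suc i` and went k cells further.
    -- The last clause keeps the cells up to i unchanged; in the induction it protects the cell that
    -- the scan has just rewritten.
    Settled : ℕ → List Bool → List Column → Grid → ℕ → Mem → Set
    Settled h o cs A₀ i μ = Σ Grid λ A → Σ ℕ λ k → Cell h o A (suc (i + k)) μ × Filled (suc (i + k)) A × Stored (suc i) cs A
                          × k ≤ length cs × (∀ j t → j ≤ i → A j t ≡ A₀ j t)

    return-home : ∀ {h o cs A₀ i} → Room (i + length cs) → Triple goLeft (Settled h o cs A₀ i) false
                  (λ μ → Σ Grid λ A → Cell h o A 0 μ × Filled (suc i) A × Stored (suc i) cs A)
    return-home {i = i} r (A , k , cell , fl , st , k≤ , _) with goLeft-spec (i + k) (room-≤ (ℕP.+-monoʳ-≤ i k≤) r) fl cell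
    ... | _ , e , cell′ = _ , e , A , cell′ , (proj₁ fl , λ j 1≤j j< → proj₂ fl j 1≤j (ℕP.≤-trans j< (s≤s (ℕP.m≤m+n i k)))) , st

    Settled-shift : ∀ {h o i A B cs k μ} → Cell h o B (suc (suc i + k)) μ → Filled (suc (suc i + k)) B → Stored (suc i) cs B →
                    suc k ≤ length cs → (∀ j t → j ≤ i → B j t ≡ A j t) → Settled h o cs A i μ
    Settled-shift {h} {o} {i} {B = B} {k = k} {μ} cell f st k≤ same = B , suc k , subst (λ q → Cell h o B (suc q) μ) (sym (ℕP.+-suc i k)) cell ,
      subst (λ q → Filled (suc q) B) (sym (ℕP.+-suc i k)) f , st , k≤ , same

    Settled-here : ∀ {h o i A B cs μ} → Cell h o B (suc i) μ → Filled (suc i) B → Stored (suc i) cs B →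
                   (∀ j t → j ≤ i → B j t ≡ A j t) → Settled h o cs A i μ
    Settled-here {h} {o} {i} {B = B} {μ = μ} cell f st same = B , 0 , subst (λ q → Cell h o B (suc q) μ) (sym (ℕP.+-identityʳ i)) cell ,
      subst (λ q → Filled (suc q) B) (sym (ℕP.+-identityʳ i)) f , st , z≤n , same

    module AtColumn {i : ℕ} {cs : List Column} (fit : Room (suc (i + suc (length cs)))) where
      fit′ : Room (suc (suc i + length cs))
      fit′ = subst Room (cong suc (ℕP.+-suc i (length cs))) fit

      roomₙ : Room (suc (suc i))
      roomₙ = room-≤ (s≤s (s≤s (ℕP.m≤m+n i (length cs)))) fit′

      roomᵢ : Room (suc i)
      roomᵢ = room-≤ (ℕP.n≤1+n _) roomₙ

    module Clear {i : ℕ} {c : Column} {cs : List Column} {A : Grid} {x : ℕ} (x<V : x < V) (fit : Room (suc (i + suc (length cs))))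
                 (fl : Filled (suc i) A) (stored : Stored (suc i) (c ∷ cs) A) where
      open AtColumn {i} {cs} fit public

      A′ : Grid
      A′ = update A (suc i) (suc x) false

      mark : A′ (suc i) 0 ≡ true
      mark = trans (update-track A (suc i) (suc x) false (λ ())) (proj₁ stored)

      filled′ : Filled (suc (suc i)) A′
      filled′ = Filled-suc {A = A′} (Filled-cong {i = suc i} {A = A} {A′ = A′} (λ j j< → update-cell A (suc i) (suc x) false (ℕP.<⇒≢ j<)) (s≤s z≤n) fl) mark

      stored′ : Stored (suc (suc i)) cs A′
      stored′ = Stored-cong cs (λ j t i<j → update-cell A (suc i) (suc x) false (λ e → ℕP.<-irrefl (sym e) i<j)) (proj₂ (proj₂ stored))

      clear : ∀ {h o} → Triple (wr′ (suc x) false ⨾ right ⨾ ret true) (Cell h o A (suc i)) true (Cell h o A′ (suc (suc i)))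
      clear = seqᵗ (wr-spec false roomᵢ (s≤s x<V)) (seqᵗ (right-spec roomᵢ) (ret-cell roomₙ true))

      finish : ∀ {h o cs′ μ} → Settled h o cs′ A′ (suc i) μ → Settled h o (set x false c ∷ cs′) A i μ
      finish (B , k , cell , f , s′ , k≤ , same) = Settled-shift cell f
        (trans (same (suc i) 0 ℕP.≤-refl) mark ,
         (λ y y<V → trans (same (suc i) (suc y) ℕP.≤-refl) (update-set A (suc i) x false c (proj₁ (proj₂ stored)) y y<V)) , s′)
        (s≤s k≤) (λ j t j≤i → trans (same j t (ℕP.≤-trans j≤i (ℕP.n≤1+n i))) (update-cell A (suc i) (suc x) false (λ e → ℕP.<-irrefl e (s≤s j≤i))))

    zeroLoop-spec : ∀ {h o x} → x < V → ∀ cs i {A} → Room (suc (i + length cs)) → Filled (suc i) A → Stored (suc i) cs A →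
                    Triple (zeroLoop x) (Cell h o A (suc i)) false (Settled h o (zeroCols x cs) A i)
    zeroLoop-spec x<V [] i {A} fit fl st = breakᵗ (iteᶠ (rd-spec roomᵢ (s≤s z≤n) (st (suc i) 0 (s≤s z≤n) ℕP.≤-refl))
        (mapᵗ (λ cell → Settled-here cell fl st (λ _ _ _ → refl)) (ret-cell roomᵢ false)))
      where
        roomᵢ : Room (suc i)
        roomᵢ = subst Room (cong suc (ℕP.+-identityʳ i)) fit
    zeroLoop-spec {x = x} x<V (c ∷ cs) i {A} fit fl st = againᵗ (iteᵗ (rd-spec roomᵢ (s≤s z≤n) (proj₁ st)) clear)
        (mapᵗ finish (zeroLoop-spec x<V cs (suc i) fit′ filled′ stored′))
      where open Clear {i} {c} {cs} {A} {x} x<V fit fl st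

    zero-spec : ∀ {h o x} → x < V → ∀ cs → Room (suc (length cs)) → Triple (zero′ x) (Home h o cs) false (Home h o (zeroCols x cs))
    zero-spec x<V cs r (A , cell , fl , st) = seqᵗ (right-spec (room-≤ z≤n r)) (seqᵗ (zeroLoop-spec x<V cs 0 r fl st)
      (return-home (subst Room (sym (ListP.length-map _ cs)) (room-≤ (ℕP.n≤1+n _) r)))) cell

    -- Unrolls one round of a loop inside a sequence. The writes that follow the carry loop act
    -- where it stops, so the induction has to treat loop and writes together.
    loop-then : ∀ {c c′ P Q R b} → Triple c P true Q → Triple (loop c ⨾ c′) Q b R → Triple (loop c ⨾ c′) P b R
    loop-then x y p with x p
    ... | _ , e , q with y q
    ...   | _ , seq e₁ e₂ , r = _ , seq (again e e₁) e₂ , r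

    -- Serves both ends of a carry: in a cell in use the mark is merely rewritten, and for a blank
    -- cell `c` is constantly false.
    markTrue : ∀ {h o i A x} c cs → x < V → Room (suc i) → Filled (suc i) A → (∀ y → y < V → A (suc i) (suc y) ≡ c y) → Stored (suc (suc i)) cs A →
               Triple (wr′ 0 true ⨾ wr′ (suc x) true) (Cell h o A (suc i)) true (Settled h o (set x true c ∷ cs) A i)
    markTrue {i = i} {A} {x} c cs x<V roomᵢ fl cx st = seqᵗ (wr-spec true roomᵢ (s≤s z≤n)) (mapᵗ finish (wr-spec true roomᵢ (s≤s x<V)))
      where
        A₁ A₂ : Grid
        A₁ = update A (suc i) 0 true
        A₂ = update A₁ (suc i) (suc x) true
        other : ∀ {j} → j ≢ suc i → ∀ t → A₂ j t ≡ A j t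
        other ne t = trans (update-cell A₁ (suc i) (suc x) true ne) (update-cell A (suc i) 0 true ne)
        finish : ∀ {h o μ} → Cell h o A₂ (suc i) μ → Settled h o (set x true c ∷ cs) A i μ
        finish cell = Settled-here cell (Filled-cong {i = suc i} {A = A} {A′ = A₂} (λ j j< → other (ℕP.<⇒≢ j<) 0) (s≤s z≤n) fl)
          (trans (update-track A₁ (suc i) (suc x) true (λ ())) (update-same A (suc i) 0 true) ,
           (λ y y<V → update-set A₁ (suc i) x true c (λ z z<V → trans (update-track A (suc i) 0 true (λ ())) (cx z z<V)) y y<V) ,
           Stored-cong cs (λ j t i<j → other (λ e → ℕP.<-irrefl (sym e) i<j) t) st)
          (λ j t j≤i → other (λ e → ℕP.<-irrefl e (s≤s j≤i)) t)

    incLoop-spec : ∀ {h o x} → x < V → ∀ cs i {A} → Room (suc (i + length cs)) → Filled (suc i) A → Stored (suc i) cs A →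
                   Triple (incLoop x) (Cell h o A (suc i)) true (Settled h o (incCols x cs) A i)
    incLoop-spec x<V [] i {A} fit fl st = seqᵗ (breakᵗ (iteᶠ (rd-spec roomᵢ (s≤s z≤n) (st (suc i) 0 (s≤s z≤n) ℕP.≤-refl)) (ret-cell roomᵢ false)))
        (markTrue (λ _ → false) [] x<V roomᵢ fl (λ z z<V → st (suc i) (suc z) (s≤s z<V) ℕP.≤-refl) (λ j t t<K i<j → st j t t<K (ℕP.≤-trans (ℕP.n≤1+n _) i<j)))
      where
        roomᵢ : Room (suc i)
        roomᵢ = subst Room (cong suc (ℕP.+-identityʳ i)) fit
    incLoop-spec {h} {o} {x} x<V (c ∷ cs) i {A} fit fl st@(m , cx , st⁺) = branch (c x) refl
      where
        open Clear {i} {c} {cs} {A} {x} x<V fit fl st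
        branch : ∀ b → c x ≡ b → Triple (incLoop x) (Cell h o A (suc i)) true
                   (Settled h o (if b then set x false c ∷ incCols x cs else set x true c ∷ cs) A i)
        branch true e = loop-then (iteᵗ (rd-spec roomᵢ (s≤s z≤n) m) (iteᵗ (rd-spec roomᵢ (s≤s x<V) (trans (cx x x<V) e)) clear))
          (mapᵗ finish (incLoop-spec x<V cs (suc i) fit′ filled′ stored′))
        branch false e = seqᵗ (breakᵗ (iteᵗ (rd-spec roomᵢ (s≤s z≤n) m) (iteᶠ (rd-spec roomᵢ (s≤s x<V) (trans (cx x x<V) e)) (ret-cell roomᵢ false))))
          (markTrue c cs x<V roomᵢ fl cx st⁺)

    length-incCols : ∀ x cs → length (incCols x cs) ≤ suc (length cs)
    length-incCols x [] = s≤s z≤n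
    length-incCols x (c ∷ cs) with c x
    ... | true = s≤s (length-incCols x cs)
    ... | false = s≤s (ℕP.n≤1+n _)

    inc-spec : ∀ {h o x} → x < V → ∀ cs → Room (suc (length cs)) → Triple (inc′ x) (Home h o cs) false (Home h o (incCols x cs))
    inc-spec {x = x} x<V cs r (A , cell , fl , st) = seqᵗ (right-spec (room-≤ z≤n r)) (seqᵗ (incLoop-spec x<V cs 0 r fl st)
      (return-home (room-≤ (length-incCols x cs) r))) cell

    -- The scan stops at the first cell where x and y differ, or behind the last cell.
    Compared : ℕ → List Bool → Grid → ℕ → ℕ → Bool → Mem → Set
    Compared h o A i len b μ = Σ ℕ λ k → Cell h o A (suc (i + k)) μ × Filled (suc (i + k)) A × k ≤ len × A (suc (i + k)) 0 ≡ not b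

    eqLoop-spec : ∀ {h o x y} → x < V → y < V → ∀ cs i {A} → Room (suc (i + length cs)) → Filled (suc i) A → Stored (suc i) cs A →
                  Triple (eqLoop x y) (Cell h o A (suc i)) false (Compared h o A i (length cs) (eqCols x y cs))
    eqLoop-spec {h} {o} {x} {y} x<V y<V cs i {A} fit fl st = scan cs fit st
      where
        stop : ∀ {len b μ} → A (suc i) 0 ≡ not b → Cell h o A (suc i) μ → Compared h o A i len b μ
        stop {b = b} {μ} m a = 0 , subst (λ q → Cell h o A (suc q) μ) (sym (ℕP.+-identityʳ i)) a
          , subst (λ q → Filled (suc q) A) (sym (ℕP.+-identityʳ i)) fl , z≤n , subst (λ q → A (suc q) 0 ≡ not b) (sym (ℕP.+-identityʳ i)) m
        scan : ∀ cs → Room (suc (i + length cs)) → Stored (suc i) cs A →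
               Triple (eqLoop x y) (Cell h o A (suc i)) false (Compared h o A i (length cs) (eqCols x y cs))
        scan [] fit st = breakᵗ (iteᶠ (rd-spec roomᵢ (s≤s z≤n) e0) (mapᵗ (stop e0) (ret-cell roomᵢ false)))
          where
            e0 : A (suc i) 0 ≡ false
            e0 = st (suc i) 0 (s≤s z≤n) ℕP.≤-refl
            roomᵢ : Room (suc i)
            roomᵢ = subst Room (cong suc (ℕP.+-identityʳ i)) fit
        scan (c ∷ cs) fit (m , cx , st) = cases (c x) (c y) refl refl
          where
            open AtColumn {i} {cs} fit
            test : ∀ {c₁ c₂ z b b′ Q} → z < V → c z ≡ b → Triple (if b then c₁ else c₂) (Cell h o A (suc i)) b′ Q →
                   Triple (ite (rd (suc z)) c₁ c₂) (Cell h o A (suc i)) b′ Q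
            test {z = z} {true} z<V e = iteᵗ (rd-spec roomᵢ (s≤s z<V) (trans (cx z z<V) e))
            test {z = z} {false} z<V e = iteᶠ (rd-spec roomᵢ (s≤s z<V) (trans (cx z z<V) e))
            onward : Triple (right ⨾ ret true) (Cell h o A (suc i)) true (Cell h o A (suc (suc i)))
            onward = seqᵗ (right-spec roomᵢ) (ret-cell roomₙ true)
            halt : Triple (ret false) (Cell h o A (suc i)) false (Compared h o A i (suc (length cs)) false)
            halt = mapᵗ (stop m) (ret-cell roomᵢ false)
            rest : Triple (eqLoop x y) (Cell h o A (suc (suc i))) false (Compared h o A i (suc (length cs)) (eqCols x y cs))
            rest = mapᵗ (λ { {μ} (k , cell , f , k≤ , e) → suc k , subst (λ q → Cell h o A (suc q) μ) (sym (ℕP.+-suc i k)) cell ,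
                subst (λ q → Filled (suc q) A) (sym (ℕP.+-suc i k)) f , s≤s k≤ , subst (λ q → A (suc q) 0 ≡ not (eqCols x y cs)) (sym (ℕP.+-suc i k)) e })
              (eqLoop-spec x<V y<V cs (suc i) fit′ (Filled-suc {A = A} fl m) st)
            cases : ∀ a b → c x ≡ a → c y ≡ b → Triple (eqLoop x y) (Cell h o A (suc i)) false
              (Compared h o A i (suc (length cs)) (if a then (if b then eqCols x y cs else false) else (if b then false else eqCols x y cs)))
            cases true true ex ey = againᵗ (iteᵗ (rd-spec roomᵢ (s≤s z≤n) m) (test x<V ex (test y<V ey onward))) rest
            cases true false ex ey = breakᵗ (iteᵗ (rd-spec roomᵢ (s≤s z≤n) m) (test x<V ex (test y<V ey halt)))
            cases false true ex ey = breakᵗ (iteᵗ (rd-spec roomᵢ (s≤s z≤n) m) (test x<V ex (test y<V ey halt)))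
            cases false false ex ey = againᵗ (iteᵗ (rd-spec roomᵢ (s≤s z≤n) m) (test x<V ex (test y<V ey onward))) rest

    eq-spec : ∀ {h o x y} → x < V → y < V → ∀ cs → Room (suc (length cs)) → Triple (eq′ x y) (Home h o cs) (eqCols x y cs) (Home h o cs)
    eq-spec {h} {o} {x} {y} x<V y<V cs r (A , cell , fl , st) =
      seqᵗ (right-spec (room-≤ z≤n r)) (seqᵗ (eqLoop-spec x<V y<V cs 0 r fl st) (λ (k , cell , f , k≤ , e) → decide (eqCols x y cs) k f k≤ e cell)) cell
      where
        back : ∀ {h o} b k → Filled (suc k) A → k ≤ length cs → Triple (goLeft ⨾ ret b) (Cell h o A (suc k)) b (Home h o cs)
        back b k f k≤ = seqᵗ (goLeft-spec k (room-≤ (ℕP.≤-trans k≤ (ℕP.n≤1+n _)) r) f) (mapᵗ (λ cell → A , cell , fl , st) (ret-cell (room-≤ z≤n r) b))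
        decide : ∀ {h o} b k → Filled (suc k) A → k ≤ length cs → A (suc k) 0 ≡ not b →
                 Triple (ite (rd 0) (goLeft ⨾ ret false) (goLeft ⨾ ret true)) (Cell h o A (suc k)) b (Home h o cs)
        decide true k f k≤ e = iteᶠ (rd-spec (room-≤ (s≤s k≤) r) (s≤s z≤n) e) (back true k f k≤)
        decide false k f k≤ e = iteᵗ (rd-spec (room-≤ (s≤s k≤) r) (s≤s z≤n) e) (back false k f k≤)

-- Loop programs over bounded counters and their logarithmic space.

module LoopPrograms where
  open StructuredMachines
  open CounterTape

  -- Loop programs that print bits.  A program in Prog k reads k variables; the loop
  -- body has the loop counter as an additional variable, with de Bruijn index 0.
  infixr 5 _⨟_
  data Prog : ℕ → Set where
    print : ∀ {k} → Bool → Prog k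
    skip  : ∀ {k} → Prog k
    _⨟_   : ∀ {k} → Prog k → Prog k → Prog k
    for   : ∀ {k} → Fin k → Prog (suc k) → Prog k

  range : ℕ → ℕ → (ℕ → List Bool) → List Bool
  range x zero F = []
  range x (suc r) F = F x ++ range (suc x) r F

  eval : ∀ {k} → Prog k → Vec ℕ k → List Bool
  eval (print b) ρ = b ∷ []
  eval skip ρ = []
  eval (P ⨟ Q) ρ = eval P ρ ++ eval Q ρ
  eval (for y P) ρ = range 0 (lookup ρ y) (λ x → eval P (x ∷ ρ))

  -- Loops that are not nested in each other share a track, so the number of tracks depends on the
  -- nesting depth, a constant of the program.
  width : ∀ {k} → Prog k → ℕ
  width (print b) = 0
  width skip = 0
  width (P ⨟ Q) = width P ⊔ width Q
  width (for {k} y P) = suc k ⊔ width P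

  -- The variable with de Bruijn index i among k is stored on the track counted from
  -- the outermost variable, so that entering a loop moves nothing.
  track : ∀ {k} → Fin k → ℕ
  track {suc k} zero = k
  track (suc i) = track i

  track< : ∀ {k} (i : Fin k) → track i < k
  track< {suc k} zero = ℕP.≤-refl
  track< {suc k} (suc i) = ℕP.≤-trans (track< i) (ℕP.n≤1+n k)

  compileProg : ∀ (V : ℕ) {k} → Prog k → Cmd
  compileProg V (print b) = emit b
  compileProg V skip = ret true
  compileProg V (P ⨟ Q) = compileProg V P ⨾ compileProg V Q
  -- The comparison precedes the body, so an empty range prints nothing. A test for equality
  -- suffices, as the counter starts at 0 and grows by 1.
  compileProg V (for {k} y P) = Commands.zero′ V k
    ⨾ loop (ite (Commands.eq′ V k (track y)) (ret false) (compileProg V P ⨾ Commands.inc′ V k ⨾ ret true))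

  -- Reads n = suc n′ and d off the input onto tracks 1 and 0, and n′ onto track 2.
  readInput : ℕ → Cmd
  readInput V = inRight ⨾ inc′ 1 ⨾ inRight ⨾ loop (ite inTest (inc′ 1 ⨾ inc′ 2 ⨾ inRight ⨾ ret true) (ret false))
      ⨾ inRight ⨾ loop (ite inTest (inc′ 0 ⨾ inRight ⨾ ret true) (ret false))
    where open Commands V

  digit : Bool → ℕ
  digit false = 0
  digit true = 1

  Column : Set
  Column = ℕ → Bool

  val : ℕ → List Column → ℕ
  val x [] = 0
  val x (c ∷ cs) = digit (c x) + 2 * val x cs

  digit-val-injective : ∀ a b m n → digit a + 2 * m ≡ digit b + 2 * n → a ≡ b × m ≡ n
  digit-val-injective false false m n e = refl , ℕP.*-cancelˡ-≡ m n 2 e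
  digit-val-injective true true m n e = refl , ℕP.*-cancelˡ-≡ m n 2 (ℕP.suc-injective e)
  digit-val-injective false true m n e = ⊥-elim (odd≢even n m (sym e))
    where
      odd≢even : ∀ n m → suc (2 * n) ≢ 2 * m
      odd≢even n (suc m) e rewrite ℕP.+-suc m (m + 0) = odd≢even′ n m (ℕP.suc-injective e)
        where
          odd≢even′ : ∀ n m → 2 * n ≢ suc (2 * m)
          odd≢even′ (suc n) m e rewrite ℕP.+-suc n (n + 0) = odd≢even n m (ℕP.suc-injective e)
  digit-val-injective true false m n e with digit-val-injective false true n m (sym e)
  ... | () , _

  module _ (V : ℕ) (w : List Bool) (s : ℕ) where
    open Tape V w s hiding (Column)

    set-same : ∀ x b c → set x b c x ≡ b
    set-same x b c rewrite ≡ᵇ-refl x = refl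

    set-other : ∀ x b c {y} → y ≢ x → set x b c y ≡ c y
    set-other x b c ne rewrite ≡ᵇ-≢ ne = refl

    val-zero : ∀ x cs → val x (zeroCols x cs) ≡ 0
    val-zero x [] = refl
    val-zero x (c ∷ cs) = cong₂ (λ b m → digit b + 2 * m) (set-same x false c) (val-zero x cs)

    val-zero-other : ∀ x {y} cs → y ≢ x → val y (zeroCols x cs) ≡ val y cs
    val-zero-other x [] ne = refl
    val-zero-other x (c ∷ cs) ne = cong₂ (λ b m → digit b + 2 * m) (set-other x false c ne) (val-zero-other x cs ne)

    val-inc : ∀ x cs → val x (incCols x cs) ≡ suc (val x cs)
    val-inc x [] = cong (λ b → digit b + 0) (set-same x true (λ _ → false))
    val-inc x (c ∷ cs) with c x in eq
    ... | true = trans (cong₂ (λ b m → digit b + 2 * m) (set-same x false c) (val-inc x cs)) (double (val x cs))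
      where
        double : ∀ m → 2 * suc m ≡ suc (1 + 2 * m)
        double m = cong suc (ℕP.+-suc m (m + 0))
    ... | false = cong (λ b → digit b + 2 * val x cs) (set-same x true c)

    val-inc-other : ∀ x {y} cs → y ≢ x → val y (incCols x cs) ≡ val y cs
    val-inc-other x [] ne = cong (λ b → digit b + 0) (set-other x true (λ _ → false) ne)
    val-inc-other x (c ∷ cs) ne with c x
    ... | true = cong₂ (λ b m → digit b + 2 * m) (set-other x false c ne) (val-inc-other x cs ne)
    ... | false = cong (λ b → digit b + 2 * val _ cs) (set-other x true c ne)

    -- A new cell is allocated only when the incremented value is a power of two.
    length-inc : ∀ x cs → length (incCols x cs) ≡ length cs ⊎ 2 ^ length (incCols x cs) ≡ 2 * suc (val x cs)
    length-inc x [] = inj₂ refl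
    length-inc x (c ∷ cs) with c x
    ... | false = inj₁ refl
    ... | true with length-inc x cs
    ...   | inj₁ e = inj₁ (cong suc e)
    ...   | inj₂ e = inj₂ (trans (cong (2 *_) e) (cong (2 *_) (cong suc (ℕP.+-suc (val x cs) (val x cs + 0)))))

    eq-val : ∀ x y cs → eqCols x y cs ≡ true → val x cs ≡ val y cs
    eq-val x y [] e = refl
    eq-val x y (c ∷ cs) e with c x | c y
    ... | true | true = cong (λ m → 1 + 2 * m) (eq-val x y cs e)
    ... | false | false = cong (2 *_) (eq-val x y cs e)

    val-eq : ∀ x y cs → val x cs ≡ val y cs → eqCols x y cs ≡ true
    val-eq x y [] e = refl
    val-eq x y (c ∷ cs) e with c x | c y | digit-val-injective (c x) (c y) (val x cs) (val y cs) e
    ... | true | true | _ , e′ = val-eq x y cs e′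
    ... | false | false | _ , e′ = val-eq x y cs e′
    ... | true | false | () , _
    ... | false | true | () , _

    EnvIs : ∀ {k} → Vec ℕ k → List Column → Set
    EnvIs [] cs = ⊤
    EnvIs {suc k} (x ∷ ρ) cs = val k cs ≡ x × EnvIs ρ cs

    EnvIs-cong : ∀ {k} (ρ : Vec ℕ k) {cs cs′} → (∀ x → x < k → val x cs′ ≡ val x cs) → EnvIs ρ cs → EnvIs ρ cs′
    EnvIs-cong [] e env = tt
    EnvIs-cong {suc k} (x ∷ ρ) e (p , env) = trans (e k ℕP.≤-refl) p , EnvIs-cong ρ (λ y y<k → e y (ℕP.≤-trans y<k (ℕP.n≤1+n k))) env

    EnvIs-lookup : ∀ {k} (ρ : Vec ℕ k) {cs} i → EnvIs ρ cs → val (track i) cs ≡ lookup ρ i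
    EnvIs-lookup (x ∷ ρ) zero (p , env) = p
    EnvIs-lookup (x ∷ ρ) (suc i) (p , env) = EnvIs-lookup ρ i env

    module _ (M : ℕ) (space : ∀ len → 2 ^ len ≤ 2 * M → Room (suc len)) where

      -- M bounds the counters, and the bound on 2 ^ length keeps the number of cells logarithmic in
      -- M. The hypothesis `space` grants one cell behind the last, where scans stop and where an
      -- increment may open a new cell.
      Good : ∀ {k} → ℕ → List Bool → Vec ℕ k → Mem → Set
      Good h o ρ μ = Σ (List Column) λ cs → Home h o cs μ × EnvIs ρ cs × 2 ^ length cs ≤ 2 * M

      home-prim : ∀ {c h h′ o o′ b cs} → (∀ {A} → Room 0 → Triple c (At h o A 0) b (At h′ o′ A 0)) → 2 ^ length cs ≤ 2 * M →
                  Triple c (Home h o cs) b (Home h′ o′ cs)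
      home-prim {cs = cs} x le (A , cell , fl , st) with x (room-≤ z≤n (space (length cs) le)) (Cell.raw cell)
      ... | _ , e , a = _ , e , A , inCell a , fl , st

      good-prim : ∀ {c h h′ o o′ b k} {ρ : Vec ℕ k} → (∀ {A} → Room 0 → Triple c (At h o A 0) b (At h′ o′ A 0)) → Triple c (Good h o ρ) b (Good h′ o′ ρ)
      good-prim x (cs , home , env , le) with home-prim x le home
      ... | _ , e , home′ = _ , e , cs , home′ , env , le

      good-ret : ∀ {h o k} {ρ : Vec ℕ k} b → Triple (ret b) (Good h o ρ) b (Good h o ρ)
      good-ret b = good-prim (λ r → ret-spec z≤n b)

      good-inRight : ∀ {h o k} {ρ : Vec ℕ k} → h ≤ length w → Triple inRight (Good h o ρ) true (Good (suc h) o ρ)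
      good-inRight h≤ = good-prim (λ r → inRight-spec z≤n (s≤s h≤))

      good-inTest : ∀ {h o k b} {ρ : Vec ℕ k} → isOne (readIn w h) ≡ b → Triple inTest (Good h o ρ) b (Good h o ρ)
      good-inTest e = good-prim (λ r → inTest-spec z≤n e)

      inc-bound : ∀ x cs → suc (val x cs) ≤ M → 2 ^ length cs ≤ 2 * M → 2 ^ length (incCols x cs) ≤ 2 * M
      inc-bound x cs v≤ le with length-inc x cs
      ... | inj₁ e = subst (λ l → 2 ^ l ≤ 2 * M) (sym e) le
      ... | inj₂ e = subst (_≤ 2 * M) (sym e) (ℕP.*-monoʳ-≤ 2 v≤)

      IncTo : ∀ {k} → ℕ → Vec ℕ k → Vec ℕ k → Set
      IncTo x ρ ρ′ = ∀ cs cs′ → val x cs′ ≡ suc (val x cs) → (∀ {y} → y ≢ x → val y cs′ ≡ val y cs) → EnvIs ρ cs → EnvIs ρ′ cs′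

      good-inc : ∀ {h o k} x {ρ ρ′ : Vec ℕ k} → x < V → (∀ cs → EnvIs ρ cs → val x cs < M) → IncTo x ρ ρ′ →
                 Triple (Commands.inc′ V x) (Good h o ρ) false (Good h o ρ′)
      good-inc x x<V v< step (cs , home , env , le) with inc-spec x<V cs (space (length cs) le) home
      ... | _ , e , home′ = _ , e , incCols x cs , home′ , step cs (incCols x cs) (val-inc x cs) (λ ne → val-inc-other x cs ne) env ,
            inc-bound x cs (v< cs env) le

      Triple∃ : Cmd → (Mem → Set) → (Mem → Set) → Set
      Triple∃ c P Q = ∀ {μ} → P μ → Σ Bool λ b → Σ Mem λ μ′ → Exec w s c μ b μ′ × Q μ′

      prog-spec : ∀ {k} (P : Prog k) → width P ≤ V → ∀ {h o} (ρ : Vec ℕ k) → VecAll (_≤ M) ρ →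
                  Triple∃ (compileProg V P) (Good h o ρ) (Good h (o ++ eval P ρ) ρ)
      prog-spec (print b) wd ρ ρ≤ p = _ , good-prim (λ r → emit-spec z≤n b) p
      prog-spec skip wd {h} {o} ρ ρ≤ {μ} p = _ , good-ret true (subst (λ o → Good h o ρ μ) (sym (ListP.++-identityʳ o)) p)
      prog-spec (P ⨟ Q) wd {h} {o} ρ ρ≤ p with prog-spec P (ℕP.≤-trans (ℕP.m≤m⊔n (width P) (width Q)) wd) ρ ρ≤ p
      ... | _ , _ , e , q with prog-spec Q (ℕP.≤-trans (ℕP.m≤n⊔m (width P) (width Q)) wd) ρ ρ≤ q
      ...   | _ , μ , e′ , r = _ , μ , seq e e′ , subst (λ o → Good h o ρ μ) (ListP.++-assoc o (eval P ρ) (eval Q ρ)) r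
      prog-spec (for {k} y P) wd {h} {o} ρ ρ≤ (cs , home , env , le) with zero-spec k<V cs (space (length cs) le) home
        where
          k<V : k < V
          k<V = ℕP.≤-trans (ℕP.m≤m⊔n (suc k) (width P)) wd
      ... | _ , e , home′ with iterate 0 (lookup ρ y) refl
                               (zeroCols k cs , home′ , (val-zero k cs , EnvIs-cong ρ (λ x x<k → val-zero-other k cs (ℕP.<⇒≢ x<k)) env) , subst (λ l → 2 ^ l ≤ 2 * M) (sym (ListP.length-map _ cs)) le)
        where
          k<V : k < V
          k<V = ℕP.≤-trans (ℕP.m≤m⊔n (suc k) (width P)) wd
          F : ℕ → List Bool
          F x = eval P (x ∷ ρ)
          body : Cmd
          body = ite (Commands.eq′ V k (track y)) (ret false) (compileProg V P ⨾ Commands.inc′ V k ⨾ ret true)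
          y<V : track y < V
          y<V = ℕP.<-trans (track< y) k<V
          compare : ∀ {h o x b} → (∀ cs → EnvIs (x ∷ ρ) cs → eqCols k (track y) cs ≡ b) → Triple (Commands.eq′ V k (track y)) (Good h o (x ∷ ρ)) b (Good h o (x ∷ ρ))
          compare {h} {o} {x} {b} eb {μ} (cs , home , env , le) = subst (λ b → Σ Mem λ μ′ → Exec w s (Commands.eq′ V k (track y)) μ b μ′ × Good h o (x ∷ ρ) μ′) (eb cs env)
            (let (μ′ , e , home′) = eq-spec k<V y<V cs (space (length cs) le) home in μ′ , e , cs , home′ , env , le)
          iterate : ∀ {h o} x r → x + r ≡ lookup ρ y → Triple (loop body) (Good h o (x ∷ ρ)) false (Good h (o ++ range x r F) ρ)
          iterate {h} {o} x zero e = breakᵗ (iteᵗ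
              (compare (λ cs (vx , env) → val-eq k (track y) cs (trans vx (trans (trans (sym (ℕP.+-identityʳ x)) e) (sym (EnvIs-lookup ρ y env))))))
              (mapᵗ (λ { {μ} (cs , home , (_ , env) , le) → subst (λ o → Good h o ρ μ) (sym (ListP.++-identityʳ o)) (cs , home , env , le) }) (good-ret {ρ = x ∷ ρ} false)))
          iterate {h} {o} x (suc r) e p with compare {b = false} differ p
            where
              x< : x < lookup ρ y
              x< = subst (x <_) e (subst (x <_) (sym (ℕP.+-suc x r)) (s≤s (ℕP.m≤m+n x r)))
              differ : ∀ cs → EnvIs (x ∷ ρ) cs → eqCols k (track y) cs ≡ false
              differ cs (vx , env) with eqCols k (track y) cs in q
              ... | false = refl
              ... | true = ⊥-elim (ℕP.<-irrefl (trans (sym vx) (trans (eq-val k (track y) cs q) (EnvIs-lookup ρ y env))) x<)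
          ... | _ , e₁ , p₁ with prog-spec P (ℕP.≤-trans (ℕP.m≤n⊔m (suc k) (width P)) wd) (x ∷ ρ) (ℕP.≤-trans x≤ (VecAllP.lookup⁺ ρ≤ y) ∷ ρ≤) p₁
            where
              x≤ : x ≤ lookup ρ y
              x≤ = subst (x ≤_) e (ℕP.m≤m+n x (suc r))
          ...   | _ , _ , e₂ , p₂ with seqᵗ (good-inc k {x ∷ ρ} {suc x ∷ ρ} k<V (λ cs (vx , _) → subst (_< M) (sym vx) (ℕP.<-≤-trans x< (VecAllP.lookup⁺ ρ≤ y)))
                                           (λ cs cs′ v o (vx , env) → trans v (cong suc vx) , EnvIs-cong ρ (λ z z<k → o (ℕP.<⇒≢ z<k)) env))
                                         (good-ret true) p₂
            where
              x< : x < lookup ρ y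
              x< = subst (x <_) e (subst (x <_) (sym (ℕP.+-suc x r)) (s≤s (ℕP.m≤m+n x r)))
          ...     | _ , e₃ , p₃ with iterate (suc x) r (trans (sym (ℕP.+-suc x r)) e) p₃
          ...       | μ , e₄ , p₄ = μ , again (iteF e₁ (seq e₂ e₃)) e₄ , subst (λ o → Good h o ρ μ) (ListP.++-assoc o (F x) (range (suc x) r F)) p₄
      ...   | μ , e′ , q = false , μ , seq e e′ , q

  readIn-one : ∀ k tl i → i < k → readIn (replicate k true ++ tl) (suc i) ≡ just true
  readIn-one (suc k) tl zero _ = refl
  readIn-one (suc k) tl (suc i) (s≤s i<k) = readIn-one k tl i i<k

  readIn-past : ∀ k tl j → readIn (replicate k true ++ tl) (suc (k + j)) ≡ readIn tl (suc j)
  readIn-past zero tl j = refl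
  readIn-past (suc k) tl j = readIn-past k tl j

  readIn-end : ∀ w → readIn w (suc (length w)) ≡ nothing
  readIn-end [] = refl
  readIn-end (b ∷ w) = readIn-end w

  module ReadInput (V n′ d s : ℕ) (3≤V : 3 ≤ V) where

    n : ℕ
    n = suc n′
    w : List Bool
    w = encND n d
    open Tape V w s hiding (Column)

    length-w : length w ≡ n + suc d
    length-w = trans (ListP.length-++ (replicate n true)) (cong₂ _+_ (ListP.length-replicate n) (cong suc (ListP.length-replicate d)))

    module _ (space : ∀ len → 2 ^ len ≤ 2 * (n + d) → Room (suc len)) where

      M : ℕ
      M = n + d

      State3 : ℕ → ℕ → ℕ → ℕ → Mem → Set
      State3 h a b c = Good V w s M space h [] (a ∷ b ∷ c ∷ [])

      inc₀ : ∀ {h a b c} → c < M → Triple (Commands.inc′ V 0) (State3 h a b c) false (State3 h a b (suc c))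
      inc₀ c<M = good-inc V w s M space 0 (ℕP.≤-trans (s≤s z≤n) 3≤V) (λ cs (_ , _ , e , _) → subst (_< M) (sym e) c<M)
        (λ cs cs′ v o (ea , eb , ec , _) → trans (o (λ ())) ea , trans (o (λ ())) eb , trans v (cong suc ec) , tt)

      inc₁ : ∀ {h a b c} → b < M → Triple (Commands.inc′ V 1) (State3 h a b c) false (State3 h a (suc b) c)
      inc₁ b<M = good-inc V w s M space 1 (ℕP.≤-trans (s≤s (s≤s z≤n)) 3≤V) (λ cs (_ , e , _) → subst (_< M) (sym e) b<M)
        (λ cs cs′ v o (ea , eb , ec , _) → trans (o (λ ())) ea , trans v (cong suc eb) , trans (o (λ ())) ec , tt)

      inc₂ : ∀ {h a b c} → a < M → Triple (Commands.inc′ V 2) (State3 h a b c) false (State3 h (suc a) b c)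
      inc₂ a<M = good-inc V w s M space 2 (ℕP.≤-trans (s≤s (s≤s (s≤s z≤n))) 3≤V) (λ cs (e , _) → subst (_< M) (sym e) a<M)
        (λ cs cs′ v o (ea , eb , ec , _) → trans v (cong suc ea) , trans (o (λ ())) eb , trans (o (λ ())) ec , tt)

      move : ∀ {h a b c} → h ≤ n + suc d → Triple inRight (State3 h a b c) true (State3 (suc h) a b c)
      move {h} h≤ = good-inRight V w s M space (subst (h ≤_) (sym length-w) h≤)

      look : ∀ {h a b c t} → isOne (readIn w h) ≡ t → Triple inTest (State3 h a b c) t (State3 h a b c)
      look = good-inTest V w s M space

      done : ∀ {h a b c} t → Triple (ret t) (State3 h a b c) t (State3 h a b c)
      done t = good-ret V w s M space t

      n′<M : n′ < M
      n′<M = ℕP.m≤m+n n d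

      -- The first input bit is consumed before the loop, which is legitimate since n ≥ 1. Track 1
      -- thus stays one ahead of track 2, and they end with n and n′.
      read-n : ∀ r i → i + r ≡ n′ → Triple (loop (ite inTest (Commands.inc′ V 1 ⨾ Commands.inc′ V 2 ⨾ inRight ⨾ ret true) (ret false)))
               (State3 (2 + i) i (suc i) 0) false (State3 (2 + n′) n′ n 0)
      read-n zero i e = breakᵗ (iteᶠ
          (look (cong isOne (trans (cong (λ q → readIn w (suc (suc q))) (trans i≡ (sym (ℕP.+-identityʳ n′)))) (readIn-past n (false ∷ replicate d true) 0))))
          (mapᵗ (λ {μ} → subst (λ i → State3 (2 + i) i (suc i) 0 μ) i≡) (done false)))
        where
          i≡ : i ≡ n′
          i≡ = trans (sym (ℕP.+-identityʳ i)) e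
      read-n (suc r) i e = againᵗ (iteᵗ (look (cong isOne (readIn-one n _ (suc i) (s≤s i<n′))))
          (seqᵗ (inc₁ (ℕP.≤-trans (s≤s i<n′) n′<M)) (seqᵗ (inc₂ (ℕP.<-trans i<n′ n′<M))
            (seqᵗ (move (s≤s (ℕP.≤-trans i<n′ (ℕP.m≤m+n n′ (suc d))))) (done true)))))
        (read-n r (suc i) (trans (sym (ℕP.+-suc i r)) e))
        where
          i<n′ : i < n′
          i<n′ = subst (i <_) e (subst (i <_) (sym (ℕP.+-suc i r)) (s≤s (ℕP.m≤m+n i r)))

      at-d : ∀ j → readIn w (2 + n + j) ≡ readIn (replicate d true) (suc j)
      at-d j = trans (cong (λ q → readIn w (suc q)) (sym (ℕP.+-suc n j))) (readIn-past n _ (suc j))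

      read-d : ∀ r j → j + r ≡ d → Triple (loop (ite inTest (Commands.inc′ V 0 ⨾ inRight ⨾ ret true) (ret false)))
               (State3 (2 + n + j) n′ n j) false (State3 (2 + n + d) n′ n d)
      read-d zero j e = breakᵗ (iteᶠ (look (cong isOne (trans (at-d j) (trans (cong (λ q → readIn (replicate d true) (suc q)) j≡) (readIn-end (replicate d true))))))
          (mapᵗ (λ {μ} → subst (λ j → State3 (2 + n + j) n′ n j μ) (trans (sym (ℕP.+-identityʳ j)) e)) (done false)))
        where
          j≡ : j ≡ length (replicate d true)
          j≡ = trans (trans (sym (ℕP.+-identityʳ j)) e) (sym (ListP.length-replicate d))
      read-d (suc r) j e = againᵗ (iteᵗ (look (cong isOne (trans (at-d j) (trans (cong (λ l → readIn l (suc j)) (sym (ListP.++-identityʳ (replicate d true)))) (readIn-one d [] j j<d)))))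
          (seqᵗ (inc₀ (ℕP.≤-trans j<d (ℕP.m≤n+m d n))) (seqᵗ (move fits′)
            (mapᵗ (λ {μ} → subst (λ h → State3 h n′ n (suc j) μ) (sym (ℕP.+-suc (2 + n) j))) (done true)))))
        (read-d r (suc j) (trans (sym (ℕP.+-suc j r)) e))
        where
          j<d : j < d
          j<d = subst (j <_) e (subst (j <_) (sym (ℕP.+-suc j r)) (s≤s (ℕP.m≤m+n j r)))
          fits′ : 2 + n + j ≤ n + suc d
          fits′ = ℕP.≤-trans (ℕP.≤-reflexive (cong suc (sym (ℕP.+-suc n j)))) (subst (suc (n + suc j) ≤_) (sym (ℕP.+-suc n d)) (s≤s (ℕP.+-monoʳ-≤ n j<d)))

      start : State3 0 0 0 0 initMem
      start = [] , ((λ _ _ → false) , inCell (at refl refl refl (λ _ _ _ → refl)) , (refl , λ { (suc k) _ (s≤s ()) }) , (λ _ _ _ _ → refl)) ,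
        (refl , refl , refl , tt) , ℕP.≤-trans (s≤s z≤n) (ℕP.*-monoʳ-≤ 2 (ℕP.≤-trans (s≤s z≤n) n′<M))

      readInput-spec : Triple (readInput V) (State3 0 0 0 0) false (State3 (2 + n + d) n′ n d)
      readInput-spec = seqᵗ (move z≤n) (seqᵗ (inc₁ (ℕP.≤-trans (s≤s z≤n) n′<M)) (seqᵗ (move (s≤s z≤n)) (seqᵗ (read-n n′ 0 refl)
        (seqᵗ (move (s≤s (ℕP.≤-trans (ℕP.≤-reflexive (cong suc (sym (ℕP.+-identityʳ n′)))) (ℕP.≤-trans (s≤s (ℕP.+-monoʳ-≤ n′ z≤n)) (ℕP.≤-reflexive (sym (ℕP.+-suc n′ d)))))))
          (preᵗ (λ {μ} → subst (λ h → State3 h n′ n 0 μ) (sym (ℕP.+-identityʳ (2 + n)))) (read-d d 0 refl))))))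

  machineFor : Prog 3 → TM
  machineFor P = machine (readInput (3 ⊔ width P) ⨾ compileProg (3 ⊔ width P) P)

  space-bound : ∀ len N → 2 ^ len ≤ 2 * suc N → len ≤ suc ⌈log₂ suc N ⌉
  space-bound len N le = subst₂′ (⌈log₂2^n⌉≡n len) (⌈log₂2*n⌉≡1+⌈log₂n⌉ (suc N)) (⌈log₂⌉-mono-≤ le)
    where
      subst₂′ : ∀ {a b c d} → a ≡ b → c ≡ d → a ≤ c → b ≤ d
      subst₂′ refl refl p = p

  prog-computes : ∀ (P : Prog 3) n′ d → ComputesInSpace (machineFor P) (encND (suc n′) d) (eval P (n′ ∷ suc n′ ∷ d ∷ []))
                    (3 * suc (3 ⊔ width P) * (⌈log₂ length (encND (suc n′) d) ⌉ + 1))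
  prog-computes P n′ d = subst (λ o → ComputesInSpace (machineFor P) (encND (suc n′) d) o s) out-eq (exec-computes exec head≤)
    where
      V K lw s : ℕ
      V = 3 ⊔ width P
      K = suc V
      lw = ⌈log₂ length (encND (suc n′) d) ⌉
      -- At most len + 2 cells of K bits are visited and len ≤ lw + 1, so lw + 3 ≤ 3 (lw + 1) cells
      -- suffice.
      s = 3 * K * (lw + 1)
      open Tape V (encND (suc n′) d) s using (Room; room; Cell; Home)
      module RI = ReadInput V n′ d s (ℕP.m≤m⊔n 3 (width P))
      space : ∀ len → 2 ^ len ≤ 2 * (suc n′ + d) → Room (suc len)
      space len le = room (ℕP.≤-trans (ℕP.*-monoˡ-≤ K fit) (ℕP.≤-reflexive (arrange K lw)))
        where
          len≤ : len ≤ suc lw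
          len≤ = ℕP.≤-trans (space-bound len (n′ + d) le) (s≤s (⌈log₂⌉-mono-≤ (subst (suc n′ + d ≤_) (sym RI.length-w) (ℕP.+-monoʳ-≤ (suc n′) (ℕP.n≤1+n d)))))
          fit : suc (suc len) ≤ 3 * (lw + 1)
          fit = ℕP.≤-trans (s≤s (s≤s len≤)) (subst (suc (suc (suc lw)) ≤_) (shape lw) (ℕP.m≤m+n (suc (suc (suc lw))) (2 * lw)))
            where
              shape : ∀ l → suc (suc (suc l)) + 2 * l ≡ 3 * (l + 1)
              shape = solve-∀
          arrange : ∀ K l → 3 * (l + 1) * K ≡ 3 * K * (l + 1)
          arrange = solve-∀
      run₁ = RI.readInput-spec space (RI.start space)
      bounded : VecAll (_≤ suc n′ + d) (n′ ∷ suc n′ ∷ d ∷ [])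
      bounded = ℕP.≤-trans (ℕP.n≤1+n n′) (ℕP.m≤m+n (suc n′) d) ∷ ℕP.m≤m+n (suc n′) d ∷ ℕP.m≤n+m d (suc n′) ∷ []
      run₂ = prog-spec V (encND (suc n′) d) s (suc n′ + d) space P (ℕP.m≤n⊔m 3 (width P)) (n′ ∷ suc n′ ∷ d ∷ []) bounded (proj₂ (proj₂ run₁))
      final : Mem
      final = proj₁ (proj₂ run₂)
      exec : Exec (encND (suc n′) d) s (readInput V ⨾ compileProg V P) initMem (proj₁ run₂) final
      exec = seq (proj₁ (proj₂ run₁)) (proj₁ (proj₂ (proj₂ run₂)))
      homeCell = proj₁ (proj₂ (proj₁ (proj₂ (proj₂ (proj₂ (proj₂ run₂))))))
      head≤ : wh final ≤ s
      head≤ = subst (_≤ s) (sym (Tape.At.wh≡ (Tape.Cell.raw homeCell))) z≤n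
      out-eq : Mem.out final ≡ eval P (n′ ∷ suc n′ ∷ d ∷ [])
      out-eq = Tape.At.out≡ (Tape.Cell.raw homeCell)

  opaque
    spaceFactor : Prog 3 → ℕ
    spaceFactor P = 3 * suc (3 ⊔ width P)

    prog-logspace : ∀ (P : Prog 3) n′ d → ComputesInSpace (machineFor P) (encND (suc n′) d) (eval P (n′ ∷ suc n′ ∷ d ∷ []))
                      (spaceFactor P * (⌈log₂ length (encND (suc n′) d) ⌉ + 1))
    prog-logspace = prog-computes

-- The loop program that prints the encoding of the circuit.

module CircuitPrinter where
  open UniversalCircuit
  open LoopPrograms

  infixl 6 _⊕_
  infixr 7 _⊗_
  -- Numerals are unary, so a sum is printed as a concatenation and a product as a loop. The left
  -- factor of a product is a variable because it becomes the bound of that loop; the value of the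
  -- expression itself never has to fit in a counter.
  data Expr (k : ℕ) : Set where
    lit : ℕ → Expr k
    var : Fin k → Expr k
    _⊕_ : Expr k → Expr k → Expr k
    _⊗_ : Fin k → Expr k → Expr k

  ⟦_⟧ : ∀ {k} → Expr k → Vec ℕ k → ℕ
  ⟦ lit c ⟧ ρ = c
  ⟦ var x ⟧ ρ = lookup ρ x
  ⟦ E ⊕ F ⟧ ρ = ⟦ E ⟧ ρ + ⟦ F ⟧ ρ
  ⟦ x ⊗ E ⟧ ρ = lookup ρ x * ⟦ E ⟧ ρ

  printOnes : ∀ {k} → ℕ → Prog k
  printOnes zero = skip
  printOnes (suc c) = print true ⨟ printOnes c

  -- The renaming skips the counters of the loops that printing a product has opened; the expression
  -- is still read in its original scope.
  ones : ∀ {k k′} → Expr k → (Fin k → Fin k′) → Prog k′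
  ones (lit c) r = printOnes c
  ones (var x) r = for (r x) (print true)
  ones (E ⊕ F) r = ones E r ⨟ ones F r
  ones (x ⊗ E) r = for (r x) (ones E (λ i → suc (r i)))

  printNat : ∀ {k} → Expr k → Prog k
  printNat E = ones E (λ i → i) ⨟ print false

  replicate-+ : ∀ a b → replicate {A = Bool} (a + b) true ≡ replicate a true ++ replicate b true
  replicate-+ zero b = refl
  replicate-+ (suc a) b = cong (true ∷_) (replicate-+ a b)

  range-const : ∀ x r c {F : ℕ → List Bool} → (∀ y → F y ≡ replicate c true) → range x r F ≡ replicate (r * c) true
  range-const x zero c e = refl
  range-const x (suc r) c e = trans (cong₂ _++_ (e x) (range-const (suc x) r c e)) (sym (replicate-+ c (r * c)))

  eval-printOnes : ∀ {k} c (ρ : Vec ℕ k) → eval (printOnes c) ρ ≡ replicate c true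
  eval-printOnes zero ρ = refl
  eval-printOnes (suc c) ρ = cong (true ∷_) (eval-printOnes c ρ)

  eval-ones : ∀ {k k′} (E : Expr k) (r : Fin k → Fin k′) (ρ : Vec ℕ k) (ρ′ : Vec ℕ k′) → (∀ i → lookup ρ′ (r i) ≡ lookup ρ i) →
              eval (ones E r) ρ′ ≡ replicate (⟦ E ⟧ ρ) true
  eval-ones (lit c) r ρ ρ′ e = eval-printOnes c ρ′
  eval-ones (var x) r ρ ρ′ e rewrite e x = trans (range-const 0 (lookup ρ x) 1 (λ _ → refl)) (cong (λ c → replicate c true) (ℕP.*-identityʳ _))
  eval-ones (E ⊕ F) r ρ ρ′ e = trans (cong₂ _++_ (eval-ones E r ρ ρ′ e) (eval-ones F r ρ ρ′ e)) (sym (replicate-+ (⟦ E ⟧ ρ) (⟦ F ⟧ ρ)))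
  eval-ones (x ⊗ E) r ρ ρ′ e rewrite e x = range-const 0 (lookup ρ x) (⟦ E ⟧ ρ) (λ y → eval-ones E (λ i → suc (r i)) ρ (y ∷ ρ′) e)

  eval-printNat : ∀ {k} (E : Expr k) ρ {c} → ⟦ E ⟧ ρ ≡ c → eval (printNat E) ρ ≡ encNat c
  eval-printNat E ρ refl = cong (_++ false ∷ []) (eval-ones E (λ i → i) ρ ρ (λ _ → refl))

  items : ∀ {A : Set} → (A → List Bool) → List A → List Bool
  items f = concatMap (λ x → true ∷ f x)

  encList-items : ∀ {A : Set} (f : A → List Bool) xs → encList f xs ≡ items f xs ++ false ∷ []
  encList-items f [] = refl
  encList-items f (x ∷ xs) = cong (true ∷_) (trans (cong (f x ++_) (encList-items f xs)) (sym (ListP.++-assoc (f x) (items f xs) _)))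

  range-tabulate : ∀ {A : Set} (h : A → List Bool) n {F : ℕ → List Bool} x (G : Fin n → A) → (∀ i → F (x + toℕ i) ≡ h (G i)) →
                   range x n F ≡ concatMap h (tabulate G)
  range-tabulate h zero x G e = refl
  range-tabulate h (suc n) {F} x G e = cong₂ _++_ (trans (cong F (sym (ℕP.+-identityʳ x))) (e zero))
    (range-tabulate h n (suc x) (λ i → G (suc i)) (λ i → trans (cong F (sym (ℕP.+-suc x (toℕ i)))) (e (suc i))))

  range-allFin : ∀ n {F : ℕ → List Bool} {H : Fin n → List Bool} → (∀ i → F (toℕ i) ≡ H i) → range 0 n F ≡ concatMap H (allFin n)
  range-allFin n {F} {H} e = range-tabulate H n 0 (λ i → i) e

  concatMap-cartesian : ∀ {A B : Set} (h : A × B → List Bool) xs (ys : List B) →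
                        concatMap h (cartesianProduct xs ys) ≡ concatMap (λ x → concatMap (λ y → h (x , y)) ys) xs
  concatMap-cartesian h [] ys = refl
  concatMap-cartesian h (x ∷ xs) ys = trans (ListP.concatMap-++ h (map (x ,_) ys) (cartesianProduct xs ys))
    (cong₂ _++_ (concatMap-map h (x ,_) ys) (concatMap-cartesian h xs ys))

  concatMap-concatMap : ∀ {A B : Set} (h : B → List Bool) (F : A → List B) xs → concatMap h (concatMap F xs) ≡ concatMap (λ x → concatMap h (F x)) xs
  concatMap-concatMap h F [] = refl
  concatMap-concatMap h F (x ∷ xs) = trans (ListP.concatMap-++ h (F x) (concatMap F xs)) (cong (concatMap h (F x) ++_) (concatMap-concatMap h F xs))

  -- Symbolic qubit labels: the indices are loop variables.
  data Sym (k : ℕ) : Set where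
    v τ τ′ : Fin k → Sym k
    f e p r : Fin k → Fin k → Sym k

  -- `pn` points to n′: the encoding of a gate with n targets or n controls contains the numeral n′,
  -- and loop programs cannot subtract.
  record Scope (k : ℕ) : Set where
    field
      ln nn dn pn : Fin k
  open Scope

  scope₃ : Scope 4
  scope₃ = record { ln = zero ; pn = suc zero ; nn = suc (suc zero) ; dn = suc (suc (suc zero)) }

  deeper : ∀ {k} → Scope k → Scope (suc k)
  deeper σ = record { ln = suc (ln σ) ; pn = suc (pn σ) ; nn = suc (nn σ) ; dn = suc (dn σ) }

  module _ {k : ℕ} (σ : Scope k) where

    rowsE : Expr k
    rowsE = lit 2 ⊕ (var (nn σ) ⊕ var (nn σ))

    -- The block of n * rows encoding bits of the current level comes after n data qubits and the
    -- blocks of the earlier levels. The factors are ordered so that each left factor is a variable.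
    encE : Expr k → Fin k → Expr k
    encE ρ i = var (nn σ) ⊕ (ln σ ⊗ nn σ ⊗ rowsE ⊕ (nn σ ⊗ ρ ⊕ var i))

    -- `encE` with d in place of the level: the ancillas begin where a further level would.
    ancE : Expr k → Fin k → Expr k
    ancE ρ i = var (nn σ) ⊕ (dn σ ⊗ nn σ ⊗ rowsE ⊕ (nn σ ⊗ ρ ⊕ var i))

    addrE : Sym k → Expr k
    addrE (v i) = var i
    addrE (τ i) = encE (lit 0) i
    addrE (τ′ i) = encE (lit 1) i
    addrE (f j i) = encE (lit 2 ⊕ var j) i
    addrE (e j i) = encE (lit 2 ⊕ (var (nn σ) ⊕ var j)) i
    addrE (p i j) = ancE (var i) j
    addrE (r j i) = ancE (var (nn σ) ⊕ var j) i

    printQ : Sym k → Prog k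
    printQ x = printNat (addrE x)

    printH printT : Sym k → Prog k
    printH x = printNat (lit 0) ⨟ printQ x
    printT x = printNat (lit 1) ⨟ printQ x

    printCnot : Sym k → Sym k → Prog k
    printCnot c t = printNat (lit 2) ⨟ printNat (lit 0) ⨟ printQ c ⨟ print true ⨟ printQ t ⨟ print false

  module _ {k : ℕ} (σ : Scope k) where

    printRow : Sym (suc k) → Prog k
    printRow x = for (nn σ) (print true ⨟ printQ (deeper σ) x) ⨟ print false

    printFan printTof : Sym k → Sym (suc k) → Prog k
    printFan c x = printNat (lit 2) ⨟ printNat (var (pn σ)) ⨟ printQ σ c ⨟ printRow x
    printTof t x = printNat (lit 3) ⨟ printNat (var (pn σ)) ⨟ printRow x ⨟ printQ σ t

  module Generator (n′ d : ℕ) where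
    open Circuits n′ d renaming (v to vᵇ; τ to τᵇ; τ′ to τ′ᵇ; f to fᵇ; e to eᵇ; p to pᵇ; r to rᵇ)

    record Reads {k} (σ : Scope k) (l : Fin d) (ρ : Vec ℕ k) : Set where
      field
        ln≡ : lookup ρ (ln σ) ≡ toℕ l
        pn≡ : lookup ρ (pn σ) ≡ n′
        nn≡ : lookup ρ (nn σ) ≡ n
        dn≡ : lookup ρ (dn σ) ≡ d
    open Reads

    deeper-reads : ∀ {k} {σ : Scope k} {l ρ} x → Reads σ l ρ → Reads (deeper σ) l (x ∷ ρ)
    deeper-reads x R = record { ln≡ = ln≡ R ; pn≡ = pn≡ R ; nn≡ = nn≡ R ; dn≡ = dn≡ R }

    -- Relates a symbolic label to the label it stands for under ρ. The level is no index of a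
    -- symbol; it is always that of the enclosing level loop.
    data Names {k} (ρ : Vec ℕ k) (l : Fin d) : Sym k → Lab → Set where
      v : ∀ {x i} → lookup ρ x ≡ toℕ i → Names ρ l (v x) (vᵇ i)
      τ : ∀ {x i} → lookup ρ x ≡ toℕ i → Names ρ l (τ x) (τᵇ l i)
      τ′ : ∀ {x i} → lookup ρ x ≡ toℕ i → Names ρ l (τ′ x) (τ′ᵇ l i)
      f : ∀ {x i y j} → lookup ρ y ≡ toℕ j → lookup ρ x ≡ toℕ i → Names ρ l (f y x) (fᵇ l j i)
      e : ∀ {x i y j} → lookup ρ y ≡ toℕ j → lookup ρ x ≡ toℕ i → Names ρ l (e y x) (eᵇ l j i)
      p : ∀ {x i y j} → lookup ρ y ≡ toℕ j → lookup ρ x ≡ toℕ i → Names ρ l (p y x) (pᵇ j i)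
      r : ∀ {x i y j} → lookup ρ y ≡ toℕ j → lookup ρ x ≡ toℕ i → Names ρ l (r y x) (rᵇ j i)

    toℕ-row : ∀ {k} (ρ : Fin k) (i : Fin n) → toℕ (combine ρ i) ≡ n * toℕ ρ + toℕ i
    toℕ-row ρ i = FinP.toℕ-combine ρ i

    second : Fin n → Fin (n + n)
    second j = n ↑ʳ j

    toℕ-second : ∀ (j : Fin n) → n + toℕ j ≡ toℕ (second j)
    toℕ-second j = sym (FinP.toℕ-↑ʳ n j)

    toℕ-encAddr : ∀ l (ρ : Fin rows) (i : Fin n) → toℕ (encAddr (encRow l ρ i)) ≡ n + (toℕ l * (n * rows) + (n * toℕ ρ + toℕ i))
    toℕ-encAddr l ρ i = trans (FinP.toℕ-↑ʳ n (encRow l ρ i ↑ˡ a)) (cong (n +_) (trans (FinP.toℕ-↑ˡ (encRow l ρ i) a)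
      (trans (FinP.toℕ-combine l (combine ρ i)) (cong₂ _+_ (trans (ℕP.*-comm (rows * n) (toℕ l)) (cong (toℕ l *_) (ℕP.*-comm rows n))) (toℕ-row ρ i)))))

    toℕ-ancAddr : ∀ (ρ : Fin (n + n)) (i : Fin n) → toℕ (ancAddr (combine ρ i)) ≡ n + (d * (n * rows) + (n * toℕ ρ + toℕ i))
    toℕ-ancAddr ρ i = trans (FinP.toℕ-↑ʳ n (m ↑ʳ combine ρ i)) (cong (n +_) (trans (FinP.toℕ-↑ʳ m (combine ρ i))
      (cong₂ _+_ (cong (d *_) (ℕP.*-comm rows n)) (toℕ-row ρ i))))

    module _ {k : ℕ} {σ : Scope k} {l : Fin d} {ρ : Vec ℕ k} (R : Reads σ l ρ) where

      encE-value : ∀ (E : Expr k) x {row : Fin rows} {i : Fin n} → ⟦ E ⟧ ρ ≡ toℕ row → lookup ρ x ≡ toℕ i → ⟦ encE σ E x ⟧ ρ ≡ toℕ (encAddr (encRow l row i))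
      encE-value E x {row} {i} eE ex rewrite nn≡ R | ln≡ R | eE | ex = sym (toℕ-encAddr l row i)

      ancE-value : ∀ (E : Expr k) x {row : Fin (n + n)} {i : Fin n} → ⟦ E ⟧ ρ ≡ toℕ row → lookup ρ x ≡ toℕ i → ⟦ ancE σ E x ⟧ ρ ≡ toℕ (ancAddr (combine row i))
      ancE-value E x {row} {i} eE ex rewrite nn≡ R | dn≡ R | eE | ex = sym (toℕ-ancAddr row i)

      opaque
        unfolding addr

        addrE-value : ∀ {x lb} → Names ρ l x lb → ⟦ addrE σ x ⟧ ρ ≡ toℕ (addr lb)
        addrE-value (v {i = i} ei) = trans ei (sym (FinP.toℕ-↑ˡ i (m + a)))
        addrE-value (τ {x} ei) = encE-value (lit 0) x {zero} refl ei
        addrE-value (τ′ {x} ei) = encE-value (lit 1) x {suc zero} refl ei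
        addrE-value (f {x} {y = y} {j} ej ei) = encE-value (lit 2 ⊕ var y) x {rowF j} (cong (2 +_) (trans ej (sym (FinP.toℕ-↑ˡ j n)))) ei
        addrE-value (e {x} {y = y} {j} ej ei) = encE-value (lit 2 ⊕ (var (nn σ) ⊕ var y)) x {rowE j}
          (cong (2 +_) (trans (cong₂ _+_ (nn≡ R) ej) (toℕ-second j))) ei
        addrE-value (p {x} {y = y} {j} ej ei) = ancE-value (var y) x {j ↑ˡ n} (trans ej (sym (FinP.toℕ-↑ˡ j n))) ei
        addrE-value (r {x} {y = y} {j} ej ei) = ancE-value (var (nn σ) ⊕ var y) x {second j} (trans (cong₂ _+_ (nn≡ R) ej) (toℕ-second j)) ei

      printQ-eval : ∀ {x lb} → Names ρ l x lb → eval (printQ σ x) ρ ≡ encFin (addr lb)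
      printQ-eval {x} nm = eval-printNat (addrE σ x) ρ (addrE-value nm)

      printH-eval : ∀ {g x lb} → Names ρ l x lb → eval (printH σ x) ρ ≡ encPlaced {g} (pH (addr lb))
      printH-eval nm = cong (encNat 0 ++_) (printQ-eval nm)

      printT-eval : ∀ {g x lb} → Names ρ l x lb → eval (printT σ x) ρ ≡ encPlaced {g} (pT (addr lb))
      printT-eval nm = cong (encNat 1 ++_) (printQ-eval nm)

      printCnot-eval : ∀ {g c t cb tb} → Names ρ l c cb → Names ρ l t tb → eval (printCnot σ c t) ρ ≡ encPlaced {g} (cnot cb tb)
      printCnot-eval nc nt = cong (λ z → encNat 2 ++ encNat 0 ++ z) (cong₂ _++_ (printQ-eval nc) (cong (true ∷_) (cong (_++ false ∷ []) (printQ-eval nt))))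

    module _ {k : ℕ} {σ : Scope k} {l : Fin d} {ρ : Vec ℕ k} (R : Reads σ l ρ) where

      printRow-eval : ∀ {x} (F : Fin n → Lab) → (∀ i → Names (toℕ i ∷ ρ) l x (F i)) →
                      eval (printRow σ x) ρ ≡ encList encFin (Vec.toList (Vec.tabulate (λ i → addr (F i))))
      printRow-eval {x} F nm rewrite nn≡ R = trans
        (cong (_++ false ∷ []) (range-tabulate (λ q → true ∷ encFin q) n {λ y → true ∷ eval (printQ (deeper σ) x) (y ∷ ρ)} 0 (λ i → addr (F i)) (λ i → cong (true ∷_) (printQ-eval (deeper-reads (toℕ i) R) (nm i)))))
        (trans (sym (encList-items encFin (tabulate (λ i → addr (F i))))) (cong (encList encFin) (trans (sym (ListP.map-tabulate F addr)) (sym (row-supp F)))))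

      prime-eval : eval (printNat (var (pn σ))) ρ ≡ encNat n′
      prime-eval = eval-printNat (var (pn σ)) ρ (pn≡ R)

      printFan-eval : ∀ {g c x cb} (F : Fin n → Lab) → Names ρ l c cb → (∀ i → Names (toℕ i ∷ ρ) l x (F i)) →
                      eval (printFan σ c x) ρ ≡ encPlaced {g} (pF n′ (addr cb) (Vec.tabulate (λ i → addr (F i))))
      printFan-eval F nc nm = cong (encNat 2 ++_) (cong₂ _++_ prime-eval (cong₂ _++_ (printQ-eval R nc) (printRow-eval F nm)))

      printTof-eval : ∀ {t x tb} (F : Fin n → Lab) → Names ρ l t tb → (∀ i → Names (toℕ i ∷ ρ) l x (F i)) →
                      eval (printTof σ t x) ρ ≡ encPlaced (pTof n′ (Vec.tabulate (λ i → addr (F i))) (addr tb))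
      printTof-eval F nt nm = cong (encNat 3 ++_) (cong₂ _++_ prime-eval (cong₂ _++_ (printRow-eval F nm) (printQ-eval R nt)))

  0F 1F : ∀ {k} → Fin (suc (suc k))
  0F = zero
  1F = suc zero

  scope₅ : Scope 5
  scope₅ = deeper scope₃

  scope₆ : Scope 6
  scope₆ = deeper scope₅

  gateVP : ∀ {g} → VKind g → Prog 5
  gateVP vH = printH scope₅ (v 0F)
  gateVP vT = printT scope₅ (v 0F)
  gateVP vτ = printCnot scope₅ (τ 0F) (v 0F)
  gateVP vτ′ = printCnot scope₅ (τ′ 0F) (v 0F)
  gateVP vR = printTof scope₅ (v 0F) (r 1F 0F)

  gateCP : PKind → Prog 6
  gateCP kH = printH scope₆ (r 1F 0F)
  gateCP kT = printT scope₆ (r 1F 0F)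
  gateCP kF = printCnot scope₆ (f 1F 0F) (r 1F 0F)
  gateCP kE = printCnot scope₆ (e 1F 0F) (r 1F 0F)
  gateCP kP = printCnot scope₆ (p 0F 1F) (r 1F 0F)

  listV : Prog 5 → Prog 4
  listV P = for (nn scope₃) (print true ⨟ P) ⨟ print false

  listC : Prog 6 → Prog 4
  listC P = for (nn scope₃) (for (nn scope₅) (print true ⨟ P)) ⨟ print false

  kindP : ∀ {g} → Kind g → Prog 4
  kindP (onV k) = listV (gateVP k)
  kindP (onC rH) = listC (gateCP kH)
  kindP (onC rT) = listC (gateCP kT)
  kindP (onC rF) = listC (gateCP kF)
  kindP (onC rE) = listC (gateCP kE)
  kindP (onC rP) = listC (gateCP kP)
  kindP (onC rV) = listV (printFan scope₅ (v 0F) (r 1F 0F))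
  kindP copyV = listV (printFan scope₅ (v 0F) (p 1F 0F))
  kindP diagT = listV (printT scope₅ (r 0F 0F))

  -- The layers of a block form a fixed finite list and are unrolled in the program text; only the
  -- level and the qubit indices are loop variables.
  kindsP : ∀ {g} → List (Kind g) → Prog 4
  kindsP [] = skip
  kindsP (κ ∷ κs) = (print true ⨟ kindP κ) ⨟ kindsP κs

  generator : Bool → Prog 3
  generator g = printNat (2F ⊗ 1F ⊗ (lit 2 ⊕ (var 1F ⊕ var 1F))) ⨟ printNat (1F ⊗ (var 1F ⊕ var 1F))
      ⨟ for 2F (kindsP (blockKinds g)) ⨟ print false
    where
      2F : Fin 3
      2F = suc (suc zero)

  module Correctness (n′ d : ℕ) where
    open Generator n′ d
    open Circuits n′ d renaming (v to vᵇ; τ to τᵇ; τ′ to τ′ᵇ; f to fᵇ; e to eᵇ; p to pᵇ; r to rᵇ)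

    ρ₄ : Fin d → Vec ℕ 4
    ρ₄ l = toℕ l ∷ n′ ∷ n ∷ d ∷ []

    reads₄ : ∀ l → Reads scope₃ l (ρ₄ l)
    reads₄ l = record { ln≡ = refl ; pn≡ = refl ; nn≡ = refl ; dn≡ = refl }

    reads₅ : ∀ l i → Reads scope₅ l (toℕ i ∷ ρ₄ l)
    reads₅ l i = deeper-reads (toℕ {n} i) (reads₄ l)

    reads₆ : ∀ l j i → Reads scope₆ l (toℕ i ∷ toℕ j ∷ ρ₄ l)
    reads₆ l j i = deeper-reads (toℕ {n} i) (reads₅ l j)

    listV-eval : ∀ {g} l P (G : Fin n → Placed g N) → (∀ i → eval P (toℕ i ∷ ρ₄ l) ≡ encPlaced (G i)) →
                 eval (listV P) (ρ₄ l) ≡ encList encPlaced (map G (allFin n))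
    listV-eval l P G h = trans (cong (_++ false ∷ []) (trans (range-allFin n {λ x → true ∷ eval P (x ∷ ρ₄ l)} {λ i → true ∷ encPlaced (G i)} (λ i → cong (true ∷_) (h i)))
        (sym (concatMap-map (λ x → true ∷ encPlaced x) G (allFin n))))) (sym (encList-items encPlaced (map G (allFin n))))

    listC-eval : ∀ {g} l P (G : Fin n × Fin n → Placed g N) → (∀ j i → eval P (toℕ i ∷ toℕ j ∷ ρ₄ l) ≡ encPlaced (G (j , i))) →
                 eval (listC P) (ρ₄ l) ≡ encList encPlaced (map G (pairs n))
    listC-eval l P G h = trans (cong (_++ false ∷ []) (trans (range-allFin n {λ x → eval (for (nn scope₅) (print true ⨟ P)) (x ∷ ρ₄ l)} {λ j → concatMap (λ i → true ∷ encPlaced (G (j , i))) (allFin n)}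
          (λ j → range-allFin n {λ y → true ∷ eval P (y ∷ toℕ j ∷ ρ₄ l)} {λ i → true ∷ encPlaced (G (j , i))} (λ i → cong (true ∷_) (h j i))))
        (trans (sym (concatMap-cartesian (λ x → true ∷ encPlaced (G x)) (allFin n) (allFin n)))
          (sym (concatMap-map (λ x → true ∷ encPlaced x) G (pairs n)))))) (sym (encList-items encPlaced (map G (pairs n))))

    gateVP-eval : ∀ {g} (k : VKind g) l i → eval (gateVP k) (toℕ i ∷ ρ₄ l) ≡ encPlaced (gateV k l i)
    gateVP-eval {g} vH l i = printH-eval (reads₅ l i) {g} {v 0F} {vᵇ i} (v refl)
    gateVP-eval {g} vT l i = printT-eval (reads₅ l i) {g} {v 0F} {vᵇ i} (v refl)
    gateVP-eval {g} vτ l i = printCnot-eval (reads₅ l i) {g} {τ 0F} {v 0F} {τᵇ l i} {vᵇ i} (τ refl) (v refl)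
    gateVP-eval {g} vτ′ l i = printCnot-eval (reads₅ l i) {g} {τ′ 0F} {v 0F} {τ′ᵇ l i} {vᵇ i} (τ′ refl) (v refl)
    gateVP-eval vR l j = printTof-eval (reads₅ l j) {v 0F} {r 1F 0F} {vᵇ j} (rᵇ j) (v refl) (λ _ → r refl refl)

    gateCP-eval : ∀ {g} k l j i → eval (gateCP k) (toℕ i ∷ toℕ j ∷ ρ₄ l) ≡ encPlaced (gateC {g} k l (j , i))
    gateCP-eval {g} kH l j i = printH-eval (reads₆ l j i) {g} {r 1F 0F} {rᵇ j i} (r refl refl)
    gateCP-eval {g} kT l j i = printT-eval (reads₆ l j i) {g} {r 1F 0F} {rᵇ j i} (r refl refl)
    gateCP-eval {g} kF l j i = printCnot-eval (reads₆ l j i) {g} {f 1F 0F} {r 1F 0F} {fᵇ l j i} {rᵇ j i} (f refl refl) (r refl refl)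
    gateCP-eval {g} kE l j i = printCnot-eval (reads₆ l j i) {g} {e 1F 0F} {r 1F 0F} {eᵇ l j i} {rᵇ j i} (e refl refl) (r refl refl)
    gateCP-eval {g} kP l j i = printCnot-eval (reads₆ l j i) {g} {p 0F 1F} {r 1F 0F} {pᵇ i j} {rᵇ j i} (p refl refl) (r refl refl)

    kindP-eval : ∀ {g} (κ : Kind g) l → eval (kindP κ) (ρ₄ l) ≡ encList encPlaced (proj₁ (layer κ l))
    kindP-eval (onV k) l = listV-eval l (gateVP k) (gateV k l) (gateVP-eval k l)
    kindP-eval {g} (onC rH) l = listC-eval l (gateCP kH) (gateC {g} kH l) (gateCP-eval {g} kH l)
    kindP-eval {g} (onC rT) l = listC-eval l (gateCP kT) (gateC {g} kT l) (gateCP-eval {g} kT l)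
    kindP-eval {g} (onC rF) l = listC-eval l (gateCP kF) (gateC {g} kF l) (gateCP-eval {g} kF l)
    kindP-eval {g} (onC rE) l = listC-eval l (gateCP kE) (gateC {g} kE l) (gateCP-eval {g} kE l)
    kindP-eval {g} (onC rP) l = listC-eval l (gateCP kP) (gateC {g} kP l) (gateCP-eval {g} kP l)
    kindP-eval {g} (onC rV) l = listV-eval l (printFan scope₅ (v 0F) (r 1F 0F)) (gateRV {g})
      (λ j → printFan-eval (reads₅ l j) {g} {v 0F} {r 1F 0F} {vᵇ j} (rᵇ j) (v refl) (λ _ → r refl refl))
    kindP-eval {g} copyV l = listV-eval l (printFan scope₅ (v 0F) (p 1F 0F)) (gateP {g})
      (λ i → printFan-eval (reads₅ l i) {g} {v 0F} {p 1F 0F} {vᵇ i} (pᵇ i) (v refl) (λ _ → p refl refl))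
    kindP-eval {g} diagT l = listV-eval l (printT scope₅ (r 0F 0F)) (gateD {g}) (λ i → printT-eval (reads₅ l i) {g} {r 0F 0F} {rᵇ i i} (r refl refl))

    encLayer : ∀ {g} → Layer g N → List Bool
    encLayer Λ = encList encPlaced (proj₁ Λ)

    kindsP-eval : ∀ {g} (κs : List (Kind g)) l → eval (kindsP κs) (ρ₄ l) ≡ items encLayer (map (λ κ → layer κ l) κs)
    kindsP-eval [] l = refl
    kindsP-eval (κ ∷ κs) l = cong₂ _++_ (cong (true ∷_) (kindP-eval κ l)) (kindsP-eval κs l)

    generator-eval : ∀ g → eval (generator g) (n′ ∷ n ∷ d ∷ []) ≡ encU n m a (circuit g)
    generator-eval g = cong₂ _++_ (eval-printNat (suc (suc zero) ⊗ 1F ⊗ (lit 2 ⊕ (var 1F ⊕ var 1F))) (n′ ∷ n ∷ d ∷ []) (cong (d *_) (ℕP.*-comm n rows)))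
      (cong₂ _++_ (eval-printNat (1F ⊗ (var 1F ⊕ var 1F)) (n′ ∷ n ∷ d ∷ []) (ℕP.*-comm n (n + n)))
        (trans (cong (_++ false ∷ []) (trans (range-allFin d {λ x → eval (kindsP (blockKinds g)) (x ∷ n′ ∷ n ∷ d ∷ [])} {λ l → items encLayer (block g l)} (λ l → trans (kindsP-eval (blockKinds g) l) (cong (items encLayer) (sym (block-≡ g l)))))
            (sym (concatMap-concatMap (λ Λ → true ∷ encLayer Λ) (block g) (allFin d)))))
          (sym (encList-items encLayer (circuit g)))))

-- The family, its size bounds and the two conclusions.

open UniversalCircuit
open UniversalityProof
open LoopPrograms using (machineFor; spaceFactor; prog-logspace)
open CircuitPrinter using (generator; module Correctness)

universalFamily : (g : Bool) → Family g
-- A default value; both conclusions assume 1 ≤ n.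
universalFamily g zero d = 0 , 0 , []
universalFamily g (suc n′) d = m , a , circuit g
  where open Circuits n′ d

length-concatMap : ∀ {A B : Set} (f : A → List B) c → (∀ x → length (f x) ≡ c) → ∀ xs → length (concatMap f xs) ≡ length xs * c
length-concatMap f c e [] = refl
length-concatMap f c e (x ∷ xs) = trans (ListP.length-++ (f x)) (cong₂ _+_ (e x) (length-concatMap f c e xs))

-- The count is 2 · 21 for the switched Hadamard layers, 2 · 22 for the Toffoli word and its
-- inverse, 2 for copying, 5 for the T gates, 2 for the rows e and 3 for the combination.
length-blockKinds : ∀ g → length (blockKinds g) ≡ 98
length-blockKinds false = refl
length-blockKinds true = refl

depth-bound : ∀ g n′ d → depth (Circuits.circuit n′ d g) ≡ 98 * d
depth-bound g n′ d = trans (length-concatMap (block g) 98 each (allFin d))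
    (trans (cong (_* 98) (ListP.length-tabulate {n = d} (λ i → i))) (ℕP.*-comm d 98))
  where
    open Circuits n′ d
    each : ∀ l → length (block g l) ≡ 98
    each l = trans (cong length (block-≡ g l)) (trans (ListP.length-map _ (blockKinds g)) (length-blockKinds g))

rows-bound : ∀ n′ → 2 + (suc n′ + suc n′) ≤ 4 * suc n′
rows-bound n′ = subst (2 + (suc n′ + suc n′) ≤_) (sum n′) (ℕP.m≤m+n _ (n′ + n′))
  where
    sum : ∀ n′ → 2 + (suc n′ + suc n′) + (n′ + n′) ≡ 4 * suc n′
    sum = solve-∀

encoding-bound : ∀ n′ d → d * ((2 + (suc n′ + suc n′)) * suc n′) ≤ 98 * (suc n′ + d) ^ 3
encoding-bound n′ d = ℕP.≤-trans
  (ℕP.*-mono-≤ (ℕP.m≤n+m d (suc n′)) (ℕP.*-mono-≤ (ℕP.≤-trans (rows-bound n′) (ℕP.*-monoʳ-≤ 4 (ℕP.m≤m+n (suc n′) d))) (ℕP.m≤m+n (suc n′) d)))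
  (ℕP.≤-trans (ℕP.≤-reflexive (cube (suc n′ + d))) (ℕP.*-monoˡ-≤ ((suc n′ + d) ^ 3) (ℕP.m≤m+n 4 94)))
  where
    cube : ∀ s → s * (4 * s * s) ≡ 4 * (s * (s * (s * 1)))
    cube = solve-∀

qubits-bound : ∀ n′ d′ → let n = suc n′ ; d = suc d′ in n + (d * ((2 + (n + n)) * n) + (n + n) * n) ≤ 98 * (n * n * d)
qubits-bound n′ d′ = ℕP.≤-trans (ℕP.+-mono-≤ data≤ (ℕP.+-mono-≤ enc≤ anc≤))
    (ℕP.≤-trans (ℕP.≤-reflexive (seven (n * n * d))) (ℕP.*-monoˡ-≤ (n * n * d) (ℕP.m≤m+n 7 91)))
  where
    n d : ℕ
    n = suc n′
    d = suc d′
    n² : n * n ≤ n * n * d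
    n² = ℕP.m≤m*n (n * n) d
    data≤ : n ≤ n * n * d
    data≤ = ℕP.≤-trans (ℕP.m≤m*n n n) n²
    enc≤ : d * ((2 + (n + n)) * n) ≤ 4 * (n * n * d)
    enc≤ = ℕP.≤-trans (ℕP.*-monoʳ-≤ d (ℕP.*-monoˡ-≤ n (rows-bound n′))) (ℕP.≤-reflexive (arrange n d))
      where
        arrange : ∀ n d → d * (4 * n * n) ≡ 4 * (n * n * d)
        arrange = solve-∀
    anc≤ : (n + n) * n ≤ 2 * (n * n * d)
    anc≤ = ℕP.≤-trans (ℕP.≤-reflexive (double n)) (ℕP.*-monoʳ-≤ 2 n²)
      where
        double : ∀ n → (n + n) * n ≡ 2 * (n * n)
        double = solve-∀
    seven : ∀ q → q + (4 * q + 2 * q) ≡ 7 * q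
    seven = solve-∀

depth-universal : ∀ g → DepthUniversal (universalFamily g)
-- One constant has to serve every bound: 98 is the depth per level and exceeds the factors 4 and 7
-- = 1 + 4 + 2 that the qubit counts require. The number of encoding qubits is at most cubic in n +
-- d.
depth-universal g = 98 , 3 , bounds
  where
    U = universalFamily g
    bounds : ∀ n d → 1 ≤ n → 1 ≤ d →
               UniversalFor n d (mOf U n d) (aOf U n d) (circOf U n d)
             × depth (circOf U n d) ≤ 98 * d
             × mOf U n d ≤ 98 * (n + d) ^ 3
             × n + (mOf U n d + aOf U n d) ≤ 98 * (n * n * d)
    bounds (suc n′) (suc d′) _ _ = Universality.universal n′ (suc d′) g , ℕP.≤-reflexive (depth-bound g n′ (suc d′)) ,
      encoding-bound n′ (suc d′) , qubits-bound n′ d′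

log-space-uniform : ∀ g → LogSpaceUniform (universalFamily g)
log-space-uniform g = machineFor (generator g) , spaceFactor (generator g) , computes
  where
    computes : ∀ n d → 1 ≤ n → 1 ≤ d →
               ComputesInSpace (machineFor (generator g)) (encND n d)
                 (encU n (mOf (universalFamily g) n d) (aOf (universalFamily g) n d) (circOf (universalFamily g) n d))
                 (spaceFactor (generator g) * (⌈log₂ length (encND n d) ⌉ + 1))
    computes (suc n′) d _ _ = subst
      (λ o → ComputesInSpace (machineFor (generator g)) (encND (suc n′) d) o (spaceFactor (generator g) * (⌈log₂ length (encND (suc n′) d) ⌉ + 1)))
      (Correctness.generator-eval n′ d g) (prog-logspace (generator g) n′ d)

theorem1 : (g : Bool) → Σ (Family g) (λ U → DepthUniversal U × LogSpaceUniform U)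
theorem1 g = universalFamily g , depth-universal g , log-space-uniform g
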